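{- There exists an absolute constant $C$ such that, for all $\delta,\varepsilon\in(0,1)$ and all nonnegative integers $d,m,n,r$ satisfying $r\ge 2$ and $1\le m\le(1-\delta)\binom{n}{2}$, \[ \mathbb{P}\big(G(n,m)\text{ is not }(d,r,\varepsilon)\text{ -rigid}\big)\le\frac{Cr}{\varepsilon}\cdot\left(\left(\frac{d+1}{\delta}+r\right)\cdot\sqrt{\frac{n}{m}}+\sqrt[4]{\frac{n}{m}}\right). \]
   Context: An $r$-cut in a graph $G$ is a partition of its vertex set into $r$ subsets (parts may be empty); its size is the number of edges of $G$ with endpoints in different parts. Let $b_r(G)$ be the maximum size of an $r$-cut of $G$. The deficit of an $r$-cut in $G$ is $b_r(G)$ minus its size. For integers $r\ge 2$ and $d\ge 0$, two vertices are $(d,r)$-equivalent in $G$ if they are in the same part of every $r$-cut in $G$ with deficit at most $d$. An $n$-vertex graph $G$ is $(d,r,\varepsilon)$-rigid, for $\varepsilon>0$, if there are at least $\frac{1-\varepsilon}{r}\binom{n}{2}$ (unordered) pairs of distinct $(d,r)$-equivalent vertices. $G(n,m)$ is the uniformly random graph with vertex set $\{1,\dotsc,n\}$ and exactly $m$ edges. -}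

module Defs where

open import Data.Bool.Base using (true; false)
open import Data.Fin.Base as Fin using (Fin)
import Data.Fin.Properties as Fin
open import Data.Fin.Subset using (Subset; ∣_∣)
open import Data.Fin.Subset.Properties using (_∈?_)
open import Data.Integer.Base as ℤ using (+_)
import Data.Integer.Properties as ℤ
open import Data.List.Base as List
  using (List; []; _∷_; length; map; filter; cartesianProduct;
         cartesianProductWith; allFin)
open import Data.List.Extrema.Nat using (max)
open import Data.List.Membership.Propositional using (_∈_)
open import Data.List.Membership.Propositional.Properties
  using (∈-cartesianProductWith⁺; ∈-allFin)
open import Data.List.Relation.Unary.All as All using (All; all?)
open import Data.List.Relation.Unary.Any using (here)
open import Data.Nat.Base as ℕ using (ℕ; zero; suc)
open import Data.Nat.Combinatorics using (_C_)
import Data.Nat.DivMod as ℕ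
import Data.Nat.Properties as ℕ
open import Data.Product.Base using (∃; _×_; _,_; proj₁; proj₂)
open import Data.Rational.Base as ℚ using (ℚ; 0ℚ; 1ℚ; ½; ↥_; ↧ₙ_; toℚᵘ)
import Data.Rational.Properties as ℚ
open import Data.Rational.Solver using (module +-*-Solver)
open import Data.Rational.Unnormalised.Base as ℚᵘ using (mkℚᵘ)
import Data.Rational.Unnormalised.Properties as ℚᵘ
open import Data.Sum.Base using (inj₁; inj₂)
open import Data.Vec.Base as Vec using (Vec; []; _∷_; lookup)
open import Level using (0ℓ)
open import Relation.Binary.PropositionalEquality
  using (_≡_; refl; sym; trans; cong; cong₂; subst; subst₂)
open import Relation.Nullary using (¬_; Dec; yes; no; contradiction)
open import Relation.Nullary.Decidable using (map′; ¬?; _→-dec_)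
open import Relation.Unary using (Pred; Decidable; _⊆_)

Cauchy : (ℕ → ℚ) → Set
Cauchy x = ∀ η → 0ℚ ℚ.< η →
  ∃ λ N → ∀ i j → N ℕ.≤ i → N ℕ.≤ j → ℚ.∣ x i ℚ.- x j ∣ ℚ.≤ η

open +-*-Solver

half+half : ∀ q → q ℚ.* ½ ℚ.+ q ℚ.* ½ ≡ q
half+half = solve 1 (λ q → q :* con ½ :+ q :* con ½ := q) refl

*-pos : ∀ {p q} → 0ℚ ℚ.< p → 0ℚ ℚ.< q → 0ℚ ℚ.< p ℚ.* q
*-pos {p} {q} 0<p 0<q =
  ℚ.positive⁻¹ (p ℚ.* q) {{ℚ.pos*pos⇒pos p {{ℚ.positive 0<p}} q {{ℚ.positive 0<q}}}}

half-pos : ∀ {q} → 0ℚ ℚ.< q → 0ℚ ℚ.< q ℚ.* ½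
half-pos 0<q = *-pos 0<q (ℚ.positive⁻¹ ½)

shrink : ∀ {B η} → 0ℚ ℚ.< B → 0ℚ ℚ.< η → ∃ λ θ → 0ℚ ℚ.< θ × B ℚ.* θ ≡ η
shrink {B} {η} 0<B 0<η = 1/B ℚ.* η , *-pos (ℚ.positive⁻¹ 1/B {{ℚ.1/pos⇒pos B}}) 0<η ,
  trans (sym (ℚ.*-assoc B 1/B η))
    (trans (cong (ℚ._* η) (ℚ.*-inverseʳ B)) (ℚ.*-identityˡ η))
  where
  instance
    posB = ℚ.positive 0<B
    nzB  = ℚ.pos⇒nonZero B
  1/B = ℚ.1/ B

*-mono : ∀ {a b c d} → 0ℚ ℚ.≤ a → 0ℚ ℚ.≤ d → a ℚ.≤ b → c ℚ.≤ d →
         a ℚ.* c ℚ.≤ b ℚ.* d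
*-mono {a} {b} {c} {d} 0≤a 0≤d a≤b c≤d = ℚ.≤-trans
  (ℚ.*-monoˡ-≤-nonNeg a {{ℚ.nonNegative 0≤a}} c≤d)
  (ℚ.*-monoʳ-≤-nonNeg d {{ℚ.nonNegative 0≤d}} a≤b)

abs-≤ : ∀ {p η} → p ℚ.≤ η → ℚ.- p ℚ.≤ η → ℚ.∣ p ∣ ℚ.≤ η
abs-≤ {p} p≤η -p≤η with ℚ.∣p∣≡p∨∣p∣≡-p p
... | inj₁ e = ℚ.≤-trans (ℚ.≤-reflexive e) p≤η
... | inj₂ e = ℚ.≤-trans (ℚ.≤-reflexive e) -p≤η

abs-diff : ∀ p q → ℚ.∣ p ∣ ℚ.≤ ℚ.∣ q ∣ ℚ.+ ℚ.∣ p ℚ.- q ∣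
abs-diff p q = ℚ.≤-trans
  (ℚ.≤-reflexive (cong ℚ.∣_∣ (solve 2 (λ p q → p := q :+ (p :- q)) refl p q)))
  (ℚ.∣p+q∣≤∣p∣+∣q∣ q (p ℚ.- q))

both : ∀ {P Q : ℕ → Set} → (∃ λ N → ∀ i → N ℕ.≤ i → P i) →
       (∃ λ N → ∀ i → N ℕ.≤ i → Q i) → ∃ λ N → ∀ i → N ℕ.≤ i → P i × Q i
both (M , p) (N , q) = M ℕ.⊔ N , λ i h →
  p i (ℕ.≤-trans (ℕ.m≤m⊔n M N) h) , q i (ℕ.≤-trans (ℕ.m≤n⊔m M N) h)

bounded : ∀ {x} → Cauchy x →
          ∃ λ B → 0ℚ ℚ.< B × ∃ λ N → ∀ i → N ℕ.≤ i → ℚ.∣ x i ∣ ℚ.≤ B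
bounded {x} cx = ℚ.∣ x N ∣ ℚ.+ 1ℚ , 0<B , N , λ i N≤i → ℚ.≤-trans
    (abs-diff (x i) (x N))
    (ℚ.+-monoʳ-≤ ℚ.∣ x N ∣ (h i N N≤i ℕ.≤-refl))
  where
  N = proj₁ (cx 1ℚ (ℚ.positive⁻¹ 1ℚ))
  h = proj₂ (cx 1ℚ (ℚ.positive⁻¹ 1ℚ))
  0<B : 0ℚ ℚ.< ℚ.∣ x N ∣ ℚ.+ 1ℚ
  0<B = ℚ.+-mono-≤-< (ℚ.0≤∣p∣ (x N)) (ℚ.positive⁻¹ 1ℚ)

-- Real numbers as Cauchy sequences of rationals.  Operations act
-- termwise on representatives.
record ℝ : Set where
  constructor real
  field
    seq    : ℕ → ℚ
    cauchy : Cauchy seq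

open ℝ public

infix  4 _≤_ _<_
infixl 6 _+_ _-_
infixl 7 _*_ _/_[_]

_≤_ : ℝ → ℝ → Set
x ≤ y = ∀ η → 0ℚ ℚ.< η →
  ∃ λ N → ∀ k → N ℕ.≤ k → seq x k ℚ.≤ seq y k ℚ.+ η

_<_ : ℝ → ℝ → Set
x < y = ∃ λ η → 0ℚ ℚ.< η ×
  ∃ λ N → ∀ k → N ℕ.≤ k → seq x k ℚ.+ η ℚ.≤ seq y k

fromℚ : ℚ → ℝ
fromℚ q = real (λ _ → q) λ η 0<η → 0 , λ _ _ _ _ → ℚ.≤-trans
  (ℚ.≤-reflexive (cong ℚ.∣_∣ (ℚ.+-inverseʳ q))) (ℚ.<⇒≤ 0<η)

fromℕ : ℕ → ℝ
fromℕ n = fromℚ (+ n ℚ./ 1)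

0ℝ 1ℝ : ℝ
0ℝ = fromℕ 0
1ℝ = fromℕ 1

+-cauchy : ∀ {x y} → Cauchy x → Cauchy y → Cauchy (λ k → x k ℚ.+ y k)
+-cauchy {x} {y} cx cy η 0<η = M ℕ.⊔ N , λ i j hi hj →
  ℚ.≤-trans (ℚ.≤-reflexive (cong ℚ.∣_∣
    (solve 4 (λ a b c d → (a :+ b) :- (c :+ d) := (a :- c) :+ (b :- d)) refl
      (x i) (y i) (x j) (y j))))
  (ℚ.≤-trans (ℚ.∣p+q∣≤∣p∣+∣q∣ (x i ℚ.- x j) (y i ℚ.- y j))
  (ℚ.≤-trans (ℚ.+-mono-≤
      (proj₂ cx′ i j (ℕ.≤-trans (ℕ.m≤m⊔n M N) hi) (ℕ.≤-trans (ℕ.m≤m⊔n M N) hj))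
      (proj₂ cy′ i j (ℕ.≤-trans (ℕ.m≤n⊔m M N) hi) (ℕ.≤-trans (ℕ.m≤n⊔m M N) hj)))
    (ℚ.≤-reflexive (half+half η))))
  where
  cx′ = cx (η ℚ.* ½) (half-pos 0<η)
  cy′ = cy (η ℚ.* ½) (half-pos 0<η)
  M = proj₁ cx′
  N = proj₁ cy′

neg-cauchy : ∀ {x} → Cauchy x → Cauchy (λ k → ℚ.- x k)
neg-cauchy {x} cx η 0<η = proj₁ (cx η 0<η) , λ i j hi hj → ℚ.≤-trans
  (ℚ.≤-reflexive (trans
    (cong ℚ.∣_∣ (solve 2 (λ a b → (:- a) :- (:- b) := :- (a :- b)) refl (x i) (x j)))
    (ℚ.∣-p∣≡∣p∣ (x i ℚ.- x j))))
  (proj₂ (cx η 0<η) i j hi hj)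

*-cauchy : ∀ {x y} → Cauchy x → Cauchy y → Cauchy (λ k → x k ℚ.* y k)
*-cauchy {x} {y} cx cy η 0<η = bN ℕ.⊔ (M ℕ.⊔ N) , λ i j hi hj →
    let l₁ = ℕ.m≤m⊔n bN (M ℕ.⊔ N)
        l₂ = ℕ.≤-trans (ℕ.m≤m⊔n M N) (ℕ.m≤n⊔m bN (M ℕ.⊔ N))
        l₃ = ℕ.≤-trans (ℕ.m≤n⊔m M N) (ℕ.m≤n⊔m bN (M ℕ.⊔ N))
    in begin
    ℚ.∣ x i ℚ.* y i ℚ.- x j ℚ.* y j ∣
      ≡⟨ cong ℚ.∣_∣ (solve 4 (λ a b c d →
           a :* b :- c :* d := a :* (b :- d) :+ d :* (a :- c)) refl
           (x i) (y i) (x j) (y j)) ⟩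
    ℚ.∣ x i ℚ.* (y i ℚ.- y j) ℚ.+ y j ℚ.* (x i ℚ.- x j) ∣
      ≤⟨ ℚ.∣p+q∣≤∣p∣+∣q∣ (x i ℚ.* (y i ℚ.- y j)) (y j ℚ.* (x i ℚ.- x j)) ⟩
    ℚ.∣ x i ℚ.* (y i ℚ.- y j) ∣ ℚ.+ ℚ.∣ y j ℚ.* (x i ℚ.- x j) ∣
      ≡⟨ cong₂ ℚ._+_ (ℚ.∣p*q∣≡∣p∣*∣q∣ (x i) (y i ℚ.- y j))
                     (ℚ.∣p*q∣≡∣p∣*∣q∣ (y j) (x i ℚ.- x j)) ⟩
    ℚ.∣ x i ∣ ℚ.* ℚ.∣ y i ℚ.- y j ∣ ℚ.+ ℚ.∣ y j ∣ ℚ.* ℚ.∣ x i ℚ.- x j ∣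
      ≤⟨ ℚ.+-mono-≤
           (*-mono (ℚ.0≤∣p∣ (x i)) (ℚ.<⇒≤ 0<α)
             (proj₁ (bounds i (ℕ.≤-trans l₁ hi)))
             (hy i j (ℕ.≤-trans l₃ hi) (ℕ.≤-trans l₃ hj)))
           (*-mono (ℚ.0≤∣p∣ (y j)) (ℚ.<⇒≤ 0<β)
             (proj₂ (bounds j (ℕ.≤-trans l₁ hj)))
             (hx i j (ℕ.≤-trans l₂ hi) (ℕ.≤-trans l₂ hj))) ⟩
    A ℚ.* α ℚ.+ B ℚ.* β        ≡⟨ cong₂ ℚ._+_ Aα Bβ ⟩
    η ℚ.* ½ ℚ.+ η ℚ.* ½        ≡⟨ half+half η ⟩
    η                          ∎
  where
  open ℚ.≤-Reasoning
  bx = bounded {x} cx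
  by = bounded {y} cy
  A  = proj₁ bx
  B  = proj₁ by
  bN = proj₁ (both (proj₂ (proj₂ bx)) (proj₂ (proj₂ by)))
  bounds = proj₂ (both (proj₂ (proj₂ bx)) (proj₂ (proj₂ by)))
  sα = shrink {A} (proj₁ (proj₂ bx)) (half-pos 0<η)
  sβ = shrink {B} (proj₁ (proj₂ by)) (half-pos 0<η)
  α = proj₁ sα
  β = proj₁ sβ
  0<α = proj₁ (proj₂ sα)
  0<β = proj₁ (proj₂ sβ)
  Aα = proj₂ (proj₂ sα)
  Bβ = proj₂ (proj₂ sβ)
  M  = proj₁ (cx β 0<β)
  hx = proj₂ (cx β 0<β)
  N  = proj₁ (cy α 0<α)
  hy = proj₂ (cy α 0<α)

_+_ _-_ _*_ : ℝ → ℝ → ℝ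
real x cx + real y cy = real (λ k → x k ℚ.+ y k) (+-cauchy {x} {y} cx cy)
real x cx - real y cy =
  real (λ k → x k ℚ.- y k) (+-cauchy {x} {λ k → ℚ.- y k} cx (neg-cauchy {y} cy))
real x cx * real y cy = real (λ k → x k ℚ.* y k) (*-cauchy {x} {y} cx cy)

-- Finitely many terms of a positive real may be zero; there the value
-- of the reciprocal is irrelevant.
recip : ℚ → ℚ
recip q with q ℚ.≟ 0ℚ
... | yes _   = 0ℚ
... | no  q≢0 = (ℚ.1/ q) {{ℚ.≢-nonZero q≢0}}

recip-inverse : ∀ {q} → 0ℚ ℚ.< q → q ℚ.* recip q ≡ 1ℚ
recip-inverse {q} 0<q with q ℚ.≟ 0ℚ
... | yes refl = contradiction 0<q (ℚ.<-irrefl refl)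
... | no  q≢0  = ℚ.*-inverseʳ q {{ℚ.≢-nonZero q≢0}}

recip-nonNeg : ∀ {q} → 0ℚ ℚ.< q → 0ℚ ℚ.≤ recip q
recip-nonNeg {q} 0<q with q ℚ.≟ 0ℚ
... | yes _   = ℚ.≤-refl
... | no  q≢0 = ℚ.<⇒≤ (ℚ.positive⁻¹ _ {{ℚ.1/pos⇒pos q {{ℚ.positive 0<q}}}})

recip-anti : ∀ {c a} → 0ℚ ℚ.< c → c ℚ.≤ a → recip a ℚ.≤ recip c
recip-anti {c} {a} 0<c c≤a = begin
  recip a                          ≡⟨ ℚ.*-identityʳ (recip a) ⟨
  recip a ℚ.* 1ℚ                   ≡⟨ cong (recip a ℚ.*_) (recip-inverse 0<c) ⟨
  recip a ℚ.* (c ℚ.* recip c)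
    ≤⟨ ℚ.*-monoˡ-≤-nonNeg (recip a) {{ℚ.nonNegative (recip-nonNeg 0<a)}}
         (ℚ.*-monoʳ-≤-nonNeg (recip c) {{ℚ.nonNegative (recip-nonNeg 0<c)}} c≤a) ⟩
  recip a ℚ.* (a ℚ.* recip c)
    ≡⟨ solve 3 (λ r a s → r :* (a :* s) := (a :* r) :* s) refl (recip a) a (recip c) ⟩
  (a ℚ.* recip a) ℚ.* recip c      ≡⟨ cong (ℚ._* recip c) (recip-inverse 0<a) ⟩
  1ℚ ℚ.* recip c                   ≡⟨ ℚ.*-identityˡ (recip c) ⟩
  recip c                          ∎
  where
  open ℚ.≤-Reasoning
  0<a = ℚ.<-≤-trans 0<c c≤a

recip-cauchy : ∀ {x} → Cauchy x →
  (∃ λ c → 0ℚ ℚ.< c × ∃ λ N → ∀ k → N ℕ.≤ k → 0ℚ ℚ.+ c ℚ.≤ x k) →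
  Cauchy (λ k → recip (x k))
recip-cauchy {x} cx (c , 0<c , N , lower) η 0<η = M ℕ.⊔ N , λ i j hi hj →
    let l₁ = ℕ.m≤m⊔n M N
        l₂ = ℕ.m≤n⊔m M N
        ci = c≤ i (ℕ.≤-trans l₂ hi)
        cj = c≤ j (ℕ.≤-trans l₂ hj)
        0<xi = ℚ.<-≤-trans 0<c ci
        0<xj = ℚ.<-≤-trans 0<c cj
        r = recip (x i)
        s = recip (x j)
        0≤r = recip-nonNeg 0<xi
        0≤s = recip-nonNeg 0<xj
        rc = recip c
        0≤rc = recip-nonNeg 0<c
    in begin
    ℚ.∣ r ℚ.- s ∣
      ≡⟨ cong ℚ.∣_∣ (cong₂ ℚ._-_
           (trans (sym (ℚ.*-identityʳ r)) (cong (r ℚ.*_) (sym (recip-inverse 0<xj))))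
           (trans (sym (ℚ.*-identityʳ s)) (cong (s ℚ.*_) (sym (recip-inverse 0<xi))))) ⟩
    ℚ.∣ r ℚ.* (x j ℚ.* s) ℚ.- s ℚ.* (x i ℚ.* r) ∣
      ≡⟨ cong ℚ.∣_∣ (solve 4 (λ r s a b →
           r :* (b :* s) :- s :* (a :* r) := (r :* s) :* (b :- a)) refl r s (x i) (x j)) ⟩
    ℚ.∣ r ℚ.* s ℚ.* (x j ℚ.- x i) ∣
      ≡⟨ ℚ.∣p*q∣≡∣p∣*∣q∣ (r ℚ.* s) (x j ℚ.- x i) ⟩
    ℚ.∣ r ℚ.* s ∣ ℚ.* ℚ.∣ x j ℚ.- x i ∣
      ≡⟨ cong (ℚ._* ℚ.∣ x j ℚ.- x i ∣) (trans (ℚ.∣p*q∣≡∣p∣*∣q∣ r s)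
           (cong₂ ℚ._*_ (ℚ.0≤p⇒∣p∣≡p 0≤r) (ℚ.0≤p⇒∣p∣≡p 0≤s))) ⟩
    r ℚ.* s ℚ.* ℚ.∣ x j ℚ.- x i ∣
      ≤⟨ *-mono (ℚ.nonNegative⁻¹ (r ℚ.* s)
                   {{ℚ.nonNeg*nonNeg⇒nonNeg r {{ℚ.nonNegative 0≤r}} s {{ℚ.nonNegative 0≤s}}}})
           (ℚ.<⇒≤ ccη)
           (*-mono 0≤r 0≤rc (recip-anti 0<c ci) (recip-anti 0<c cj))
           (hx j i (ℕ.≤-trans l₁ hj) (ℕ.≤-trans l₁ hi)) ⟩
    rc ℚ.* rc ℚ.* (c ℚ.* c ℚ.* η)
      ≡⟨ solve 3 (λ r c η → r :* r :* (c :* c :* η) := (c :* r) :* (c :* r) :* η)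
           refl rc c η ⟩
    (c ℚ.* rc) ℚ.* (c ℚ.* rc) ℚ.* η
      ≡⟨ cong₂ (λ a b → a ℚ.* b ℚ.* η) (recip-inverse 0<c) (recip-inverse 0<c) ⟩
    1ℚ ℚ.* 1ℚ ℚ.* η            ≡⟨ ℚ.*-identityˡ η ⟩
    η                          ∎
  where
  open ℚ.≤-Reasoning
  ccη : 0ℚ ℚ.< c ℚ.* c ℚ.* η
  ccη = *-pos (*-pos 0<c 0<c) 0<η
  M  = proj₁ (cx (c ℚ.* c ℚ.* η) ccη)
  hx = proj₂ (cx (c ℚ.* c ℚ.* η) ccη)
  c≤ : ∀ k → N ℕ.≤ k → c ℚ.≤ x k
  c≤ k h = subst (ℚ._≤ x k) (ℚ.+-identityˡ c) (lower k h)

_/_[_] : (x y : ℝ) → 0ℝ < y → ℝ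
x / real y cy [ 0<y ] = x * real (λ k → recip (y k)) (recip-cauchy {y} cy 0<y)

⌊√_⌋ : ℕ → ℕ
⌊√ zero ⌋ = 0
⌊√ suc n ⌋ with suc ⌊√ n ⌋ ℕ.* suc ⌊√ n ⌋ ℕ.≤? suc n
... | yes _ = suc ⌊√ n ⌋
... | no  _ = ⌊√ n ⌋

-- The largest multiple of 1/(k+1) whose square is at most ∣q∣.
root : ℕ → ℚ → ℚ
root k q = + ⌊√ ℤ.∣ ↥ q ∣ ℕ.* (suc k ℕ.* suc k) ℕ./ ↧ₙ q ⌋ ℚ./ suc k

⌊√⌋-lower : ∀ n → ⌊√ n ⌋ ℕ.* ⌊√ n ⌋ ℕ.≤ n
⌊√⌋-lower zero = ℕ.z≤n
⌊√⌋-lower (suc n) with suc ⌊√ n ⌋ ℕ.* suc ⌊√ n ⌋ ℕ.≤? suc n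
... | yes h = h
... | no  _ = ℕ.m≤n⇒m≤1+n (⌊√⌋-lower n)

⌊√⌋-upper : ∀ n → n ℕ.< suc ⌊√ n ⌋ ℕ.* suc ⌊√ n ⌋
⌊√⌋-upper zero = ℕ.s≤s ℕ.z≤n
⌊√⌋-upper (suc n) with suc ⌊√ n ⌋ ℕ.* suc ⌊√ n ⌋ ℕ.≤? suc n
... | no ¬h = ℕ.≰⇒> ¬h
... | yes _ = ℕ.≤-<-trans (⌊√⌋-upper n) (square-< ⌊√ n ⌋)
  where
  square-< : ∀ s → suc s ℕ.* suc s ℕ.< suc (suc s) ℕ.* suc (suc s)
  square-< s = ℕ.*-mono-< (ℕ.n<1+n (suc s)) (ℕ.n<1+n (suc s))

[_]² : ℚ → ℚ
[ q ]² = q ℚ.* q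

toℚᵘ-/ : ∀ j k → toℚᵘ (+ j ℚ./ suc k) ℚᵘ.≃ mkℚᵘ (+ j) k
toℚᵘ-/ j k = ℚ.toℚᵘ-fromℚᵘ (mkℚᵘ (+ j) k)

toℚᵘ-/² : ∀ j k → toℚᵘ [ + j ℚ./ suc k ]² ℚᵘ.≃ mkℚᵘ (+ j) k ℚᵘ.* mkℚᵘ (+ j) k
toℚᵘ-/² j k = ℚᵘ.≃-trans (ℚ.toℚᵘ-homo-* (+ j ℚ./ suc k) (+ j ℚ./ suc k))
  (ℚᵘ.*-cong (toℚᵘ-/ j k) (toℚᵘ-/ j k))

step : ℕ → ℚ
step k = + 1 ℚ./ suc k

/-suc : ∀ j k → + suc j ℚ./ suc k ≡ + j ℚ./ suc k ℚ.+ step k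
/-suc j k = ℚ.toℚᵘ-injective (ℚᵘ.≃-trans (toℚᵘ-/ (suc j) k)
  (ℚᵘ.≃-trans eq (ℚᵘ.≃-sym (ℚᵘ.≃-trans
    (ℚ.toℚᵘ-homo-+ (+ j ℚ./ suc k) (step k))
    (ℚᵘ.+-cong (toℚᵘ-/ j k) (toℚᵘ-/ 1 k))))))
  where
  K = + suc k
  eq : mkℚᵘ (+ suc j) k ℚᵘ.≃ mkℚᵘ (+ j) k ℚᵘ.+ mkℚᵘ (+ 1) k
  eq = ℚᵘ.*≡* (trans (sym (ℤ.*-assoc (+ suc j) K K)) (cong (ℤ._* K)
    (trans (cong (ℤ._* K) (ℤ.+-comm (+ 1) (+ j))) (ℤ.*-distribʳ-+ K (+ j) (+ 1)))))

root-lower : ∀ k q → [ root k q ]² ℚ.≤ ℚ.∣ q ∣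
root-lower k q@(ℚ.mkℚ a b _) = ℚ.toℚᵘ-cancel-≤ (ℚᵘ.≤-trans
  (ℚᵘ.≤-reflexive (toℚᵘ-/² j k))
  (ℚᵘ.*≤* (subst₂ ℤ._≤_
    (trans (ℤ.pos-* (j ℕ.* j) (suc b)) (cong (ℤ._* + suc b) (ℤ.pos-* j j)))
    (ℤ.pos-* n KK)
    (ℤ.+≤+ (ℕ.≤-trans (ℕ.*-monoˡ-≤ (suc b) (⌊√⌋-lower (n ℕ.* KK ℕ./ suc b)))
      (ℕ.m/n*n≤m (n ℕ.* KK) (suc b)))))))
  where
  n = ℤ.∣ a ∣
  KK = suc k ℕ.* suc k
  j = ⌊√ n ℕ.* KK ℕ./ suc b ⌋

root-upper : ∀ k q → ℚ.∣ q ∣ ℚ.< [ root k q ℚ.+ step k ]²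
root-upper k q@(ℚ.mkℚ a b _) = subst (λ s → ℚ.∣ q ∣ ℚ.< [ s ]²) (/-suc j k)
  (ℚ.toℚᵘ-cancel-< (ℚᵘ.<-≤-trans
    (ℚᵘ.*<* (subst₂ ℤ._<_
      (ℤ.pos-* n KK)
      (trans (ℤ.pos-* (suc j ℕ.* suc j) (suc b))
        (cong (ℤ._* + suc b) (ℤ.pos-* (suc j) (suc j))))
      (ℤ.+<+ bound)))
    (ℚᵘ.≤-reflexive (ℚᵘ.≃-sym (toℚᵘ-/² (suc j) k)))))
  where
  n = ℤ.∣ a ∣
  KK = suc k ℕ.* suc k
  j = ⌊√ n ℕ.* KK ℕ./ suc b ⌋
  bound : n ℕ.* KK ℕ.< suc j ℕ.* suc j ℕ.* suc b
  bound = ℕ.≰⇒> λ h → ℕ.<⇒≱ (⌊√⌋-upper (n ℕ.* KK ℕ./ suc b))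
    (subst (ℕ._≤ n ℕ.* KK ℕ./ suc b) (ℕ.m*n/n≡m (suc j ℕ.* suc j) (suc b))
      (ℕ./-monoˡ-≤ (suc b) h))

/-nonNeg : ∀ j k → 0ℚ ℚ.≤ + j ℚ./ suc k
/-nonNeg j k = ℚ.nonNegative⁻¹ _ {{ℚ.normalize-nonNeg j (suc k)}}

root-nonNeg : ∀ k q → 0ℚ ℚ.≤ root k q
root-nonNeg k q = /-nonNeg ⌊√ ℤ.∣ ↥ q ∣ ℕ.* (suc k ℕ.* suc k) ℕ./ ↧ₙ q ⌋ k

step-small : ∀ {h} → 0ℚ ℚ.< h → ∃ λ N → ∀ k → N ℕ.≤ k → step k ℚ.≤ h
step-small {h@(ℚ.mkℚ a b _)} 0<h = suc b , λ k b<k →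
  ℚ.toℚᵘ-cancel-≤ (ℚᵘ.≤-trans (ℚᵘ.≤-reflexive (toℚᵘ-/ 1 k)) (ℚᵘ.*≤* (go a (ℚ.positive 0<h) b<k)))
  where
  go : ∀ a {k} → ℤ.Positive a → suc b ℕ.≤ k →
       + 1 ℤ.* + suc b ℤ.≤ a ℤ.* + suc k
  go (+ suc n) {k} _ b<k = subst₂ ℤ._≤_ (ℤ.pos-* 1 (suc b)) (ℤ.pos-* (suc n) (suc k))
    (ℤ.+≤+ (ℕ.*-mono-≤ {1} {suc n} (ℕ.s≤s ℕ.z≤n) (ℕ.m≤n⇒m≤1+n b<k)))

²-mono : ∀ {p q} → 0ℚ ℚ.≤ p → p ℚ.≤ q → [ p ]² ℚ.≤ [ q ]²
²-mono 0≤p p≤q = *-mono 0≤p (ℚ.≤-trans 0≤p p≤q) p≤q p≤q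

-- If a² ≤ p, q < (b + u)² with u ≤ h, and p exceeds q by at most h²,
-- then a ≤ b + 2h.
root-stable : ∀ {a b u h p q} → 0ℚ ℚ.≤ b → 0ℚ ℚ.≤ u → u ℚ.≤ h →
  [ a ]² ℚ.≤ p → q ℚ.< [ b ℚ.+ u ]² → p ℚ.≤ q ℚ.+ [ h ]² → a ℚ.≤ b ℚ.+ (h ℚ.+ h)
root-stable {a} {b} {u} {h} {p} {q} 0≤b 0≤u u≤h a²≤p q<b+u² p≤q+h²
  with a ℚ.≤? b ℚ.+ (h ℚ.+ h)
... | yes le = le
... | no ¬le = contradiction chain (ℚ.<-irrefl refl)
  where
  open ℚ.≤-Reasoning
  0≤h = ℚ.≤-trans 0≤u u≤h
  0≤b+h : 0ℚ ℚ.≤ b ℚ.+ h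
  0≤b+h = ℚ.+-mono-≤ 0≤b 0≤h
  cross : 0ℚ ℚ.≤ (b ℚ.+ h) ℚ.* h
  cross = *-mono {0ℚ} {b ℚ.+ h} {0ℚ} {h} ℚ.≤-refl 0≤h 0≤b+h 0≤h
  chain : q ℚ.+ [ h ]² ℚ.< q ℚ.+ [ h ]²
  chain = begin-strict
    q ℚ.+ [ h ]²                 <⟨ ℚ.+-monoˡ-< [ h ]² q<b+u² ⟩
    [ b ℚ.+ u ]² ℚ.+ [ h ]²
      ≤⟨ ℚ.+-monoˡ-≤ [ h ]² (²-mono (ℚ.+-mono-≤ 0≤b 0≤u) (ℚ.+-monoʳ-≤ b u≤h)) ⟩
    [ b ℚ.+ h ]² ℚ.+ [ h ]²
      ≡⟨ ℚ.+-identityʳ _ ⟨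
    [ b ℚ.+ h ]² ℚ.+ [ h ]² ℚ.+ 0ℚ
      ≤⟨ ℚ.+-monoʳ-≤ ([ b ℚ.+ h ]² ℚ.+ [ h ]²) (ℚ.+-mono-≤ cross cross) ⟩
    [ b ℚ.+ h ]² ℚ.+ [ h ]² ℚ.+ ((b ℚ.+ h) ℚ.* h ℚ.+ (b ℚ.+ h) ℚ.* h)
      ≡⟨ solve 2 (λ b h →
           (b :+ h) :* (b :+ h) :+ h :* h :+ ((b :+ h) :* h :+ (b :+ h) :* h)
           := (b :+ (h :+ h)) :* (b :+ (h :+ h))) refl b h ⟩
    [ b ℚ.+ (h ℚ.+ h) ]²
      ≤⟨ ²-mono (ℚ.+-mono-≤ 0≤b (ℚ.+-mono-≤ 0≤h 0≤h)) (ℚ.<⇒≤ (ℚ.≰⇒> ¬le)) ⟩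
    [ a ]²                       ≤⟨ a²≤p ⟩
    p                            ≤⟨ p≤q+h² ⟩
    q ℚ.+ [ h ]²                 ∎

√-cauchy : ∀ {x} → Cauchy x → Cauchy (λ k → root k (x k))
√-cauchy {x} cx η 0<η = M ℕ.⊔ N , λ i j hi hj → abs-≤
    (half i j hi hj)
    (subst (ℚ._≤ η) (solve 2 (λ a b → b :- a := :- (a :- b)) refl
      (root i (x i)) (root j (x j))) (half j i hj hi))
  where
  h   = η ℚ.* ½
  0<h = half-pos 0<η
  M   = proj₁ (step-small 0<h)
  hs  = proj₂ (step-small 0<h)
  N   = proj₁ (cx [ h ]² (*-pos 0<h 0<h))
  hx  = proj₂ (cx [ h ]² (*-pos 0<h 0<h))
  half : ∀ i j → M ℕ.⊔ N ℕ.≤ i → M ℕ.⊔ N ℕ.≤ j →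
         root i (x i) ℚ.- root j (x j) ℚ.≤ η
  half i j hi hj = begin
    root i (x i) ℚ.- root j (x j)
      ≤⟨ ℚ.+-monoˡ-≤ (ℚ.- root j (x j)) (root-stable
           {root i (x i)} {root j (x j)} {step j} {h} {ℚ.∣ x i ∣} {ℚ.∣ x j ∣}
           (root-nonNeg j (x j)) (/-nonNeg 1 j) (hs j (ℕ.≤-trans (ℕ.m≤m⊔n M N) hj))
           (root-lower i (x i)) (root-upper j (x j))
           (ℚ.≤-trans (abs-diff (x i) (x j)) (ℚ.+-monoʳ-≤ ℚ.∣ x j ∣
             (hx i j (ℕ.≤-trans (ℕ.m≤n⊔m M N) hi) (ℕ.≤-trans (ℕ.m≤n⊔m M N) hj))))) ⟩
    root j (x j) ℚ.+ (h ℚ.+ h) ℚ.- root j (x j)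
      ≡⟨ solve 2 (λ b e → b :+ e :- b := e) refl (root j (x j)) (h ℚ.+ h) ⟩
    h ℚ.+ h              ≡⟨ half+half η ⟩
    η                    ∎
    where open ℚ.≤-Reasoning

-- The square root of the absolute value.
√_ : ℝ → ℝ
√ real x cx = real (λ k → root k (x k)) (√-cauchy {x} cx)

∜_ : ℝ → ℝ
∜ x = √ (√ x)

vectors : ∀ {A : Set} → List A → ∀ n → List (Vec A n)
vectors xs zero    = [] ∷ []
vectors xs (suc n) = cartesianProductWith _∷_ xs (vectors xs n)

∈-vectors : ∀ {A : Set} {xs : List A} → (∀ x → x ∈ xs) →
            ∀ {n} (v : Vec A n) → v ∈ vectors xs n
∈-vectors all []      = here refl
∈-vectors all (x ∷ v) = ∈-cartesianProductWith⁺ _∷_ (all x) (∈-vectors all v)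

pairs : ∀ n → List (Fin n × Fin n)
pairs n = filter (λ (u , v) → u Fin.<? v) (cartesianProduct (allFin n) (allFin n))

-- A simple graph on Fin n is a set of positions in the list of pairs
-- u < v, so distinct values are distinct graphs.
record Graph (n : ℕ) : Set where
  constructor graph
  field
    edgeSet : Subset (length (pairs n))

open Graph public

edges : ∀ {n} → Graph n → List (Fin n × Fin n)
edges {n} G = map (List.lookup (pairs n)) (filter (_∈? edgeSet G) (allFin _))

graphs : ∀ n → ℕ → List (Graph n)
graphs n m = map graph
  (filter (λ S → ∣ S ∣ ℕ.≟ m) (vectors (true ∷ false ∷ []) (length (pairs n))))

-- Entry v is the part containing vertex v, so parts may be empty and
-- are labelled; neither size nor equivalence depends on the labels.
Cut : ℕ → ℕ → Set
Cut r n = Vec (Fin r) n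

cuts : ∀ r n → List (Cut r n)
cuts r n = vectors (allFin r) n

size : ∀ {r n} → Graph n → Cut r n → ℕ
size G c = length (filter (λ (u , v) → ¬? (lookup c u Fin.≟ lookup c v)) (edges G))

maxCut : ∀ r {n} → Graph n → ℕ
maxCut r {n} G = max 0 (map (size G) (cuts r n))

deficit : ∀ {r n} → Graph n → Cut r n → ℕ
deficit {r} G c = maxCut r G ℕ.∸ size G c

Equivalent : ∀ d r {n} → Graph n → Fin n → Fin n → Set
Equivalent d r {n} G u v =
  (c : Cut r n) → deficit G c ℕ.≤ d → lookup c u ≡ lookup c v

equivalent? : ∀ d r {n} (G : Graph n) u v → Dec (Equivalent d r G u v)
equivalent? d r {n} G u v = map′
  (λ all c → All.lookup all (∈-vectors ∈-allFin c))
  (λ eq → All.tabulate λ {c} _ → eq c)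
  (all? (λ c → (deficit G c ℕ.≤? d) →-dec (lookup c u Fin.≟ lookup c v)) (cuts r n))

equivalentPairs : ∀ d r {n} → Graph n → ℕ
equivalentPairs d r {n} G = length (filter (λ (u , v) → equivalent? d r G u v) (pairs n))

-- Used only with a nonzero denominator.
ratio : ℕ → ℕ → ℚ
ratio a zero      = 0ℚ
ratio a b@(suc _) = + a ℚ./ b

Rigid : ∀ d r → ℝ → ∀ {n} → Graph n → Set
Rigid d r ε {n} G =
  (1ℝ - ε) * fromℚ (ratio 1 r) * fromℕ (n C 2) ≤ fromℕ (equivalentPairs d r G)

ℙ : ∀ n m {A : Pred (Graph n) 0ℓ} → Decidable A → ℚ
ℙ n m A? = ratio (length (filter A? (graphs n m))) (length (graphs n m))

-- Comparison of reals is undecidable, so an event E such as non-rigidity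
-- (for real ε) need not be decidable.  P(E) ≤ p means that no decidable
-- event contained in E has probability above p; for a decidable E this
-- is the bound fromℚ (ℙ n m E?) ≤ p, by monotonicity.
ProbAtMost : ∀ n m → Pred (Graph n) 0ℓ → ℝ → Set₁
ProbAtMost n m E p =
  {A : Pred (Graph n) 0ℓ} (A? : Decidable A) → A ⊆ E → fromℚ (ℙ n m A?) ≤ p

{-# OPTIONS --safe #-}
module Submission where

-- Write N for the number of pairs of vertices and, for a graph with m edges,
-- let ι(k, m) be the average number of (k, r)-equivalent pairs of G(n, m).
-- The proof bounds ι(d, m) from below by about N/r.  Equivalent pairs are inside
-- the parts of every maximum cut, so their number rarely exceeds N/r by much
-- (eqPairs-upper), and Markov's inequality makes non-rigidity unlikely
-- (bad-bound).
--
-- Put an edge e uniformly at random into a random graph G with m edges.  Then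
-- G + e is a random graph with m + 1 edges and e is a random edge of it.
--  * If a maximum cut of G + e does not cut e, then e is (0, r)-equivalent in G
--    (equivalent-0).  A maximum cut has at most about an (r - 1)/r fraction of
--    the edges, so this has probability at least about 1/r.
--  * If e is (k, r)-equivalent in G + e, then it is (k + 1, r)-equivalent in G
--    (equivalent-suc).
-- Hence a random non-edge of G(n, m) is (k + 1, r)-equivalent at least as
-- often as a random edge of G(n, m + 1) is (k, r)-equivalent.  Up to a small
-- error, edges and non-edges can be replaced by arbitrary pairs, so ι(k + 1, m)
-- is at least about ι(k, m + 1), and iterating reduces ι(d, m) to ι(0, m + d)
-- with d + 1 errors (𝔼-eqPairs-lower).  The factor 1/δ comes from comparing
-- non-edges with pairs; if d exceeds about δ N / 4 the bound is trivial.
--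
-- The error is controlled uniformly over all partitions of the vertices
-- (deviation), since equivalence is a partition that depends on the graph.
-- For 2-colourings this is a union bound over 2^n exponential moments, each
-- bounded by Maclaurin's inequality for elementary symmetric polynomials; the
-- exponential itself is avoided by the inequality of arithmetic and geometric
-- means (exp-bound).  A partition into any number of parts is an average of
-- 2-colourings, by colouring its parts at random.  The resulting error is of
-- order t m for every rational t with n ≤ t² m, and t is taken to be a rational
-- approximation from above of the square root of n/m.  Neither the fourth root
-- nor the summand r is needed, so the bound holds without them.

open import Data.Nat.Base as ℕ using (ℕ)
open import Data.Nat.Combinatorics using (_C_)
open import Data.Product.Base using (∃; _,_)
open import Relation.Nullary.Negation.Core using (¬_)

-- Here the arithmetic and the order of the rationals have the names that
-- the theorem uses for the reals.
module Rationals where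

  open import Data.Bool.Base using (Bool; true; false; if_then_else_; not)
  open import Data.Fin.Base as Fin using (Fin; zero; suc)
  import Data.Fin.Properties as Fin
  open import Data.Fin.Subset using (Subset) renaming (∣_∣ to card)
  open import Data.Fin.Subset.Properties using (_∈?_)
  import Data.Integer.Base as ℤ
  import Data.Integer.Properties as ℤ
  open import Data.List.Base as List
    using (List; []; _∷_; length; map; filter; _++_; foldr; replicate; allFin;
           cartesianProduct; cartesianProductWith)
  open import Data.List.Extrema.Nat using (argmax; f[xs]≤f[argmax]; xs≤max; max≤v⁺)
  open import Data.List.Membership.Propositional using (_∈_)
  open import Data.List.Membership.Propositional.Properties
    using (∈-filter⁺; ∈-filter⁻; ∈-lookup; ∈-allFin; ∈-map⁺)
  open import Data.List.Properties
    using (length-++; length-map; length-replicate; length-tabulate;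
           map-tabulate; tabulate-lookup; filter-≐)
  open import Data.List.Relation.Unary.All as All using (All; []; _∷_)
  import Data.List.Relation.Unary.All.Properties as All
  open import Data.List.Relation.Unary.Any using (here; there)
  open import Data.Nat.Base using (zero; suc)
  open import Data.Nat.Combinatorics using (nC1≡n; nCk+nC[k+1]≡[n+1]C[k+1])
  import Data.Nat.Properties as ℕ
  open import Data.Product.Base using (_×_; proj₁; proj₂)
  open import Data.Rational.Base
    using (ℚ; 0ℚ; 1ℚ; ½; _+_; _-_; _*_; -_; _/_; _≤_; _<_; *≤*; ∣_∣;
           nonNegative; positive)
  open import Data.Rational.Properties
  open import Data.Rational.Solver using (module +-*-Solver)
  import Data.Rational.Unnormalised.Base as ℚᵘ
  import Data.Rational.Unnormalised.Properties as ℚᵘ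
  open import Data.Sum.Base using (_⊎_; inj₁; inj₂)
  open import Data.Vec.Base as Vec using (Vec; []; _∷_; lookup; _[_]≔_)
  open import Data.Vec.Properties using (lookup∘tabulate)
  open import Function.Base using (_∘_; id)
  open import Level using (0ℓ)
  open import Relation.Binary.PropositionalEquality hiding ([_])
  open import Relation.Nullary using (Dec; yes; no; does; contradiction)
  open import Relation.Nullary.Decidable using (¬?; decidable-stable)
  open import Relation.Unary using (Pred; Decidable)
  import Defs as ℝ
  open import Defs
    using (real; Cauchy; recip; recip-inverse; recip-nonNeg; half-pos; ²-mono;
           root; root-nonNeg; root-upper; step; step-small; toℚᵘ-/; /-suc;
           vectors; ∈-vectors; pairs; Graph; graph; edges; graphs; Cut; cuts;
           size; maxCut; deficit; Equivalent; equivalent?; equivalentPairs;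
           ratio; Rigid; ℙ)
  open +-*-Solver
  open ≤-Reasoning

  -- Inequalities of rational numbers

  0≤+ : ∀ {a b} → 0ℚ ≤ a → 0ℚ ≤ b → 0ℚ ≤ a + b
  0≤+ p q = +-mono-≤ p q

  0≤* : ∀ {a b} → 0ℚ ≤ a → 0ℚ ≤ b → 0ℚ ≤ a * b
  0≤* {a} {b} p q = nonNegative⁻¹ (a * b)
    {{nonNeg*nonNeg⇒nonNeg a {{nonNegative p}} b {{nonNegative q}}}}

  0≤- : ∀ {a b} → a ≤ b → 0ℚ ≤ b - a
  0≤- {a} {b} p = subst (_≤ b - a) (+-inverseʳ a) (+-monoˡ-≤ (- a) p)

  -- Most inequalities below are proved by exhibiting the difference of the two
  -- sides as an expression built from hypotheses 0 ≤ b - a by sums and products.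
  by-difference : ∀ {p q e} → 0ℚ ≤ e → q - p ≡ e → p ≤ q
  by-difference {p} {q} 0≤e eq = begin
    p             ≡⟨ +-identityˡ p ⟨
    0ℚ + p        ≤⟨ +-monoˡ-≤ p (subst (0ℚ ≤_) (sym eq) 0≤e) ⟩
    q - p + p     ≡⟨ solve 2 (λ q p → q :- p :+ p := q) refl q p ⟩
    q             ∎

  0≤² : ∀ a → 0ℚ ≤ a * a
  0≤² a = subst (0ℚ ≤_) (trans (∣p*q∣≡∣p∣*∣q∣ a a) (sq a)) (0≤∣p∣ (a * a))
    where
    sq : ∀ a → ∣ a ∣ * ∣ a ∣ ≡ a * a
    sq a with ∣p∣≡p∨∣p∣≡-p a
    ... | inj₁ e = cong₂ _*_ e e
    ... | inj₂ e = trans (cong₂ _*_ e e) (solve 1 (λ a → (:- a) :* (:- a) := a :* a) refl a)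

  0≤1 : 0ℚ ≤ 1ℚ
  0≤1 = nonNegative⁻¹ 1ℚ

  *-monoˡ : ∀ {a b c} → 0ℚ ≤ a → b ≤ c → a * b ≤ a * c
  *-monoˡ {a} p = *-monoˡ-≤-nonNeg a {{nonNegative p}}

  *-monoʳ : ∀ {a b c} → 0ℚ ≤ a → b ≤ c → b * a ≤ c * a
  *-monoʳ {a} p = *-monoʳ-≤-nonNeg a {{nonNegative p}}

  *-cancelˡ : ∀ {a b c} → 0ℚ < a → a * b ≤ a * c → b ≤ c
  *-cancelˡ {a} p = *-cancelˡ-≤-pos a {{positive p}}

  -- Natural numbers as rationals

  opaque

    -- Opaque, so that the normalisation of fractions never unfolds.
    ⌜_⌝ : ℕ → ℚ
    ⌜ n ⌝ = ℤ.+ n / 1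

    ⌜⌝-def : ∀ n → ⌜ n ⌝ ≡ ℤ.+ n / 1
    ⌜⌝-def n = refl

    ⌜0⌝ : ⌜ 0 ⌝ ≡ 0ℚ
    ⌜0⌝ = refl

    ⌜1⌝ : ⌜ 1 ⌝ ≡ 1ℚ
    ⌜1⌝ = refl

    ⌜suc⌝ : ∀ n → ⌜ suc n ⌝ ≡ 1ℚ + ⌜ n ⌝
    ⌜suc⌝ n = trans (/-suc n 0) (+-comm ⌜ n ⌝ 1ℚ)

    0≤⌜⌝ : ∀ n → 0ℚ ≤ ⌜ n ⌝
    0≤⌜⌝ n = nonNegative⁻¹ ⌜ n ⌝ {{normalize-nonNeg n 1}}

    0<⌜suc⌝ : ∀ n → 0ℚ < ⌜ suc n ⌝
    0<⌜suc⌝ n = positive⁻¹ ⌜ suc n ⌝ {{normalize-pos (suc n) 1}}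

  2ℚ : ℚ
  2ℚ = 1ℚ + 1ℚ

  ⌜+⌝ : ∀ m n → ⌜ m ℕ.+ n ⌝ ≡ ⌜ m ⌝ + ⌜ n ⌝
  ⌜+⌝ zero    n = sym (trans (cong (_+ ⌜ n ⌝) ⌜0⌝) (+-identityˡ ⌜ n ⌝))
  ⌜+⌝ (suc m) n = begin-equality
    ⌜ suc (m ℕ.+ n) ⌝      ≡⟨ ⌜suc⌝ (m ℕ.+ n) ⟩
    1ℚ + ⌜ m ℕ.+ n ⌝       ≡⟨ cong (λ z → 1ℚ + z) (⌜+⌝ m n) ⟩
    1ℚ + (⌜ m ⌝ + ⌜ n ⌝)   ≡⟨ +-assoc 1ℚ ⌜ m ⌝ ⌜ n ⌝ ⟨
    1ℚ + ⌜ m ⌝ + ⌜ n ⌝     ≡⟨ cong (_+ ⌜ n ⌝) (⌜suc⌝ m) ⟨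
    ⌜ suc m ⌝ + ⌜ n ⌝      ∎

  ⌜⌝-mono : ∀ {m n} → m ℕ.≤ n → ⌜ m ⌝ ≤ ⌜ n ⌝
  ⌜⌝-mono {m} {n} m≤n = subst₂ _≤_ (+-identityʳ ⌜ m ⌝)
    (trans (sym (⌜+⌝ m (n ℕ.∸ m))) (cong ⌜_⌝ (ℕ.m+[n∸m]≡n m≤n)))
    (+-monoʳ-≤ ⌜ m ⌝ (0≤⌜⌝ (n ℕ.∸ m)))

  0<⌜⌝ : ∀ {n} → 1 ℕ.≤ n → 0ℚ < ⌜ n ⌝
  0<⌜⌝ {suc n} _ = 0<⌜suc⌝ n

  ⌜⌝-cancel-≤ : ∀ {m n} → ⌜ m ⌝ ≤ ⌜ n ⌝ → m ℕ.≤ n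
  ⌜⌝-cancel-≤ {m} {n} p with m ℕ.≤? n
  ... | yes q = q
  ... | no ¬q = contradiction (begin-strict
      ⌜ n ⌝        ≡⟨ +-identityˡ ⌜ n ⌝ ⟨
      0ℚ + ⌜ n ⌝   <⟨ +-monoˡ-< ⌜ n ⌝ (positive⁻¹ 1ℚ) ⟩
      1ℚ + ⌜ n ⌝   ≡⟨ ⌜suc⌝ n ⟨
      ⌜ suc n ⌝    ≤⟨ ⌜⌝-mono (ℕ.≰⇒> ¬q) ⟩
      ⌜ m ⌝        ≤⟨ p ⟩
      ⌜ n ⌝        ∎) (<-irrefl refl)

  -- Sums over lists

  ∑ : ∀ {A : Set} → List A → (A → ℚ) → ℚ
  ∑ []       f = 0ℚ
  ∑ (x ∷ xs) f = f x + ∑ xs f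

  module _ {A : Set} where

    ∑-cong : ∀ (xs : List A) {f g} → (∀ x → f x ≡ g x) → ∑ xs f ≡ ∑ xs g
    ∑-cong []       h = refl
    ∑-cong (x ∷ xs) h = cong₂ _+_ (h x) (∑-cong xs h)

    ∑-mono : ∀ (xs : List A) {f g} → (∀ x → f x ≤ g x) → ∑ xs f ≤ ∑ xs g
    ∑-mono []       h = ≤-refl
    ∑-mono (x ∷ xs) h = +-mono-≤ (h x) (∑-mono xs h)

    ∑-zero : ∀ (xs : List A) → ∑ xs (λ _ → 0ℚ) ≡ 0ℚ
    ∑-zero []       = refl
    ∑-zero (x ∷ xs) = trans (+-identityˡ _) (∑-zero xs)

    ∑-nonNeg : ∀ (xs : List A) {f} → (∀ x → 0ℚ ≤ f x) → 0ℚ ≤ ∑ xs f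
    ∑-nonNeg xs h = subst (_≤ ∑ xs _) (∑-zero xs) (∑-mono xs h)

    ∑-+ : ∀ (xs : List A) f g → ∑ xs (λ x → f x + g x) ≡ ∑ xs f + ∑ xs g
    ∑-+ []       f g = refl
    ∑-+ (x ∷ xs) f g = trans (cong (f x + g x +_) (∑-+ xs f g))
      (solve 4 (λ a b c d → a :+ b :+ (c :+ d) := a :+ c :+ (b :+ d)) refl
        (f x) (g x) (∑ xs f) (∑ xs g))

    ∑-*ˡ : ∀ (xs : List A) c f → ∑ xs (λ x → c * f x) ≡ c * ∑ xs f
    ∑-*ˡ []       c f = sym (*-zeroʳ c)
    ∑-*ˡ (x ∷ xs) c f = trans (cong (c * f x +_) (∑-*ˡ xs c f)) (sym (*-distribˡ-+ c (f x) (∑ xs f)))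

    ∑-*ʳ : ∀ (xs : List A) c f → ∑ xs (λ x → f x * c) ≡ ∑ xs f * c
    ∑-*ʳ xs c f = trans (∑-cong xs (λ x → *-comm (f x) c)) (trans (∑-*ˡ xs c f) (*-comm c _))

    ∑-- : ∀ (xs : List A) f g → ∑ xs (λ x → f x - g x) ≡ ∑ xs f - ∑ xs g
    ∑-- []       f g = refl
    ∑-- (x ∷ xs) f g = trans (cong (f x - g x +_) (∑-- xs f g))
      (solve 4 (λ a b c d → a :- b :+ (c :- d) := a :+ c :- (b :+ d)) refl
        (f x) (g x) (∑ xs f) (∑ xs g))

    ∑-const : ∀ (xs : List A) c → ∑ xs (λ _ → c) ≡ ⌜ length xs ⌝ * c
    ∑-const []       c = sym (trans (cong (_* c) ⌜0⌝) (*-zeroˡ c))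
    ∑-const (x ∷ xs) c = trans (cong (c +_) (∑-const xs c))
      (trans (solve 2 (λ c n → c :+ n :* c := (con 1ℚ :+ n) :* c) refl c ⌜ length xs ⌝)
        (cong (_* c) (sym (⌜suc⌝ (length xs)))))

    ∑-++ : ∀ (xs ys : List A) f → ∑ (xs ++ ys) f ≡ ∑ xs f + ∑ ys f
    ∑-++ []       ys f = sym (+-identityˡ _)
    ∑-++ (x ∷ xs) ys f = trans (cong (f x +_) (∑-++ xs ys f)) (sym (+-assoc (f x) _ _))

    ∑-map : ∀ {B : Set} (h : B → A) (xs : List B) f → ∑ (map h xs) f ≡ ∑ xs (f ∘ h)
    ∑-map h []       f = refl
    ∑-map h (x ∷ xs) f = cong (f (h x) +_) (∑-map h xs f)

  ∑-swap : ∀ {A B : Set} (xs : List A) (ys : List B) (f : A → B → ℚ) →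
           ∑ xs (λ x → ∑ ys (λ y → f x y)) ≡ ∑ ys (λ y → ∑ xs (λ x → f x y))
  ∑-swap []       ys f = sym (∑-zero ys)
  ∑-swap (x ∷ xs) ys f = trans (cong (∑ ys (f x) +_) (∑-swap xs ys f))
      (sym (∑-+ ys (f x) (λ y → ∑ xs (λ x → f x y))))

  ∑-cartesianProductWith : ∀ {A B C : Set} (g : A → B → C) xs ys f →
    ∑ (cartesianProductWith g xs ys) f ≡ ∑ xs (λ x → ∑ ys (λ y → f (g x y)))
  ∑-cartesianProductWith g []       ys f = refl
  ∑-cartesianProductWith g (x ∷ xs) ys f = trans (∑-++ (map (g x) ys) _ f)
    (cong₂ _+_ (∑-map (g x) ys f) (∑-cartesianProductWith g xs ys f))

  ∑-allFin-suc : ∀ n f → ∑ (allFin (suc n)) f ≡ f zero + ∑ (allFin n) (f ∘ suc)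
  ∑-allFin-suc n f = cong (f zero +_) (trans
    (cong (λ l → ∑ l f) (sym (map-tabulate id suc))) (∑-map suc (allFin n) f))

  ∑-vectors-suc : ∀ {A : Set} (xs : List A) n f →
    ∑ (vectors xs (suc n)) f ≡ ∑ xs (λ x → ∑ (vectors xs n) (λ v → f (x Vec.∷ v)))
  ∑-vectors-suc xs n f = ∑-cartesianProductWith _ xs (vectors xs n) f

  -- A sum over a list as a sum over its positions.
  ∑-lookup : ∀ {A : Set} (xs : List A) f → ∑ xs f ≡ ∑ (allFin (length xs)) (f ∘ List.lookup xs)
  ∑-lookup xs f = trans
    (cong (λ l → ∑ l f) (sym (trans (map-tabulate id (List.lookup xs)) (tabulate-lookup xs))))
    (∑-map (List.lookup xs) (allFin (length xs)) f)

  -- Indicators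

  -- The indicator of a Boolean; the indicator of a decidable P is [ does P? ].
  [_] : Bool → ℚ
  [ b ] = if b then 1ℚ else 0ℚ

  []-nonNeg : ∀ b → 0ℚ ≤ [ b ]
  []-nonNeg true  = 0≤1
  []-nonNeg false = ≤-refl

  []≤1 : ∀ b → [ b ] ≤ 1ℚ
  []≤1 true  = ≤-refl
  []≤1 false = 0≤1

  [not] : ∀ b → [ not b ] ≡ 1ℚ - [ b ]
  [not] true  = refl
  [not] false = refl

  []-yes : ∀ {P : Set} (P? : Dec P) → P → [ does P? ] ≡ 1ℚ
  []-yes (yes _) p = refl
  []-yes (no ¬p) p = contradiction p ¬p

  []-no : ∀ {P : Set} (P? : Dec P) → ¬ P → [ does P? ] ≡ 0ℚ
  []-no (yes p) ¬p = contradiction p ¬p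
  []-no (no _)  ¬p = refl

  []-mono : ∀ {P Q : Set} (P? : Dec P) (Q? : Dec Q) → (P → Q) → [ does P? ] ≤ [ does Q? ]
  []-mono (yes p) Q? f = ≤-reflexive (sym ([]-yes Q? (f p)))
  []-mono (no _)  Q? f = []-nonNeg (does Q?)

  []-cong : ∀ {P Q : Set} (P? : Dec P) (Q? : Dec Q) → (P → Q) → (Q → P) → [ does P? ] ≡ [ does Q? ]
  []-cong P? Q? f g = ≤-antisym ([]-mono P? Q? f) ([]-mono Q? P? g)

  []-disjoint : ∀ {P Q : Set} (P? : Dec P) (Q? : Dec Q) → (P → ¬ Q) → [ does P? ] + [ does Q? ] ≤ 1ℚ
  []-disjoint (yes p) Q? f = ≤-reflexive (cong (1ℚ +_) ([]-no Q? (f p)))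
  []-disjoint (no _)  Q? f = ≤-trans (≤-reflexive (+-identityˡ _)) ([]≤1 (does Q?))

  module _ {A : Set} {P : A → Set} (P? : Decidable P) where

    ∑-filter : ∀ xs f → ∑ (filter P? xs) f ≡ ∑ xs (λ x → [ does (P? x) ] * f x)
    ∑-filter []       f = refl
    ∑-filter (x ∷ xs) f with does (P? x)
    ... | true  = cong₂ _+_ (sym (*-identityˡ (f x))) (∑-filter xs f)
    ... | false = trans (∑-filter xs f) (trans (sym (+-identityˡ _)) (cong (_+ _) (sym (*-zeroˡ (f x)))))

    length-filter : ∀ xs → ⌜ length (filter P? xs) ⌝ ≡ ∑ xs (λ x → [ does (P? x) ])
    length-filter xs = trans (sym (trans (∑-const (filter P? xs) 1ℚ) (*-identityʳ _)))
      (trans (∑-filter xs (λ _ → 1ℚ)) (∑-cong xs (λ x → *-identityʳ _)))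

    ∑-filter-mono : ∀ xs {f g} → (∀ x → P x → f x ≤ g x) → ∑ (filter P? xs) f ≤ ∑ (filter P? xs) g
    ∑-filter-mono []       h = ≤-refl
    ∑-filter-mono (x ∷ xs) h with P? x
    ... | yes p = +-mono-≤ (h x p) (∑-filter-mono xs h)
    ... | no  _ = ∑-filter-mono xs h

  -- Powers

  infixr 8 _^_
  _^_ : ℚ → ℕ → ℚ
  p ^ zero  = 1ℚ
  p ^ suc k = p * p ^ k

  ^-nonNeg : ∀ {p} k → 0ℚ ≤ p → 0ℚ ≤ p ^ k
  ^-nonNeg zero    h = 0≤1
  ^-nonNeg (suc k) h = 0≤* h (^-nonNeg k h)

  ^-pos : ∀ {p} k → 0ℚ < p → 0ℚ < p ^ k
  ^-pos zero    h = positive⁻¹ 1ℚ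
  ^-pos {p} (suc k) h = positive⁻¹ (p * p ^ k)
    {{pos*pos⇒pos p {{positive h}} (p ^ k) {{positive (^-pos k h)}}}}

  ^-mono : ∀ {p q} k → 0ℚ ≤ p → p ≤ q → p ^ k ≤ q ^ k
  ^-mono zero    h p≤q = ≤-refl
  ^-mono {p} {q} (suc k) h p≤q = ≤-trans (*-monoˡ h (^-mono k h p≤q)) (*-monoʳ (^-nonNeg k (≤-trans h p≤q)) p≤q)

  1^ : ∀ k → 1ℚ ^ k ≡ 1ℚ
  1^ zero    = refl
  1^ (suc k) = trans (*-identityˡ _) (1^ k)

  -- Means and products

  -- Bernoulli's inequality (a + d)^(k + 1) ≥ a^(k + 1) + (k + 1) a^k d.
  bernoulli : ∀ k {a d} → 0ℚ ≤ a → 0ℚ ≤ a + d →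
              a ^ k * (a + ⌜ suc k ⌝ * d) ≤ (a + d) ^ suc k
  bernoulli zero {a} {d} 0≤a 0≤a+d = ≤-reflexive (trans
    (cong (λ c → 1ℚ * (a + c * d)) ⌜1⌝)
    (solve 2 (λ a d → con 1ℚ :* (a :+ con 1ℚ :* d) := (a :+ d) :* con 1ℚ) refl a d))
  bernoulli (suc k) {a} {d} 0≤a 0≤a+d = begin
    a * a ^ k * (a + ⌜ suc (suc k) ⌝ * d)
      ≡⟨ cong (λ c → a * a ^ k * (a + c * d)) (⌜suc⌝ (suc k)) ⟩
    a * a ^ k * (a + (1ℚ + ⌜ suc k ⌝) * d)
      ≤⟨ by-difference (0≤* (0≤* (^-nonNeg k 0≤a) (0≤⌜⌝ (suc k))) (0≤² d))
          (solve 4 (λ a d p c →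
             (a :+ d) :* (p :* (a :+ c :* d)) :- a :* p :* (a :+ (con 1ℚ :+ c) :* d)
               := p :* c :* (d :* d)) refl a d (a ^ k) ⌜ suc k ⌝) ⟩
    (a + d) * (a ^ k * (a + ⌜ suc k ⌝ * d))
      ≤⟨ *-monoˡ 0≤a+d (bernoulli k 0≤a 0≤a+d) ⟩
    (a + d) * (a + d) ^ suc k ∎

  -- For n = 0 the mean may be any number; it is taken to be 0.
  mean : ∀ n {s} → 0ℚ ≤ s → (n ≡ 0 → s ≡ 0ℚ) → ∃ λ a → 0ℚ ≤ a × ⌜ n ⌝ * a ≡ s
  mean zero    0≤s h = 0ℚ , ≤-refl , trans (*-zeroʳ ⌜ 0 ⌝) (sym (h refl))
  mean (suc n) {s} 0≤s h = recip c * s , 0≤* (recip-nonNeg 0<c) 0≤s ,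
    trans (sym (*-assoc c (recip c) s))
      (trans (cong (_* s) (recip-inverse 0<c)) (*-identityˡ s))
    where
    c = ⌜ suc n ⌝
    0<c = 0<⌜suc⌝ n

  -- If n + 1 numbers have mean a and all but the first, x, have mean b,
  -- then x = b + (n + 1) (a - b).
  mean-step : ∀ {n x s a b} → (1ℚ + ⌜ n ⌝) * a ≡ x + s → ⌜ n ⌝ * b ≡ s →
              x ≡ b + ⌜ suc n ⌝ * (a - b)
  mean-step {n} {x} {s} {a} {b} eq eq′ = begin-equality
    x             ≡⟨ solve 2 (λ x s → x := x :+ s :- s) refl x s ⟩
    x + s - s     ≡⟨ cong₂ _-_ (sym eq) (sym eq′) ⟩
    (1ℚ + ⌜ n ⌝) * a - ⌜ n ⌝ * b
      ≡⟨ solve 3 (λ a b k → (con 1ℚ :+ k) :* a :- k :* b := b :+ (con 1ℚ :+ k) :* (a :- b)) refl a b ⌜ n ⌝ ⟩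
    b + (1ℚ + ⌜ n ⌝) * (a - b)   ≡⟨ cong (λ c → b + c * (a - b)) (⌜suc⌝ n) ⟨
    b + ⌜ suc n ⌝ * (a - b) ∎

  ∏ : List ℚ → ℚ
  ∏ = foldr _*_ 1ℚ

  ∏-nonNeg : ∀ {xs} → All (0ℚ ≤_) xs → 0ℚ ≤ ∏ xs
  ∏-nonNeg []       = 0≤1
  ∏-nonNeg (p ∷ ps) = 0≤* p (∏-nonNeg ps)

  ∑-All : ∀ {xs} → All (0ℚ ≤_) xs → 0ℚ ≤ ∑ xs id
  ∑-All []       = ≤-refl
  ∑-All (p ∷ ps) = 0≤+ p (∑-All ps)

  -- The inequality of arithmetic and geometric means.  If the tail has mean b,
  -- then x = b + (k + 1)(a - b), so Bernoulli's inequality gives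
  -- x b^k ≤ a^(k + 1).
  am-gm : ∀ xs {a} → All (0ℚ ≤_) xs → 0ℚ ≤ a → ⌜ length xs ⌝ * a ≡ ∑ xs id → ∏ xs ≤ a ^ length xs
  am-gm []       []       0≤a eq = ≤-refl
  am-gm (x ∷ xs) {a} (p ∷ ps) 0≤a eq = begin
    x * ∏ xs                ≤⟨ *-monoˡ p (am-gm xs ps 0≤b eq′) ⟩
    x * b ^ k               ≡⟨ cong (_* b ^ k) x≡ ⟩
    (b + ⌜ suc k ⌝ * (a - b)) * b ^ k   ≡⟨ *-comm _ (b ^ k) ⟩
    b ^ k * (b + ⌜ suc k ⌝ * (a - b))
      ≤⟨ bernoulli k 0≤b (subst (0ℚ ≤_) (sym b+) 0≤a) ⟩
    (b + (a - b)) ^ suc k   ≡⟨ cong (_^ suc k) b+ ⟩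
    a ^ suc k               ∎
    where
    k = length xs
    m = mean k (∑-All ps) λ { e → empty xs e }
      where
      empty : ∀ xs → length xs ≡ 0 → ∑ xs id ≡ 0ℚ
      empty [] _ = refl
    b = proj₁ m
    0≤b = proj₁ (proj₂ m)
    eq′ = proj₂ (proj₂ m)
    b+ : b + (a - b) ≡ a
    b+ = solve 2 (λ a b → b :+ (a :- b) := a) refl a b
    x≡ : x ≡ b + ⌜ suc k ⌝ * (a - b)
    x≡ = mean-step {k} {b = b} (trans (cong (_* a) (sym (⌜suc⌝ k))) eq) eq′

  ∏≤1 : ∀ xs → All (0ℚ ≤_) xs → ∑ xs id ≤ ⌜ length xs ⌝ → ∏ xs ≤ 1ℚ
  ∏≤1 []       _  _ = ≤-refl
  ∏≤1 xs@(_ ∷ xs′) ps h = begin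
    ∏ xs     ≤⟨ am-gm xs ps 0≤a eq ⟩
    a ^ k    ≤⟨ ^-mono k 0≤a a≤1 ⟩
    1ℚ ^ k   ≡⟨ 1^ k ⟩
    1ℚ       ∎
    where
    k = length xs
    m = mean k (∑-All ps) λ ()
    a = proj₁ m
    0≤a = proj₁ (proj₂ m)
    eq = proj₂ (proj₂ m)
    a≤1 : a ≤ 1ℚ
    a≤1 = *-cancelˡ (0<⌜suc⌝ (length xs′))
      (≤-trans (≤-reflexive eq) (≤-trans h (≤-reflexive (sym (*-identityʳ ⌜ k ⌝)))))

  ∏-++ : ∀ xs ys → ∏ (xs ++ ys) ≡ ∏ xs * ∏ ys
  ∏-++ []       ys = sym (*-identityˡ _)
  ∏-++ (x ∷ xs) ys = trans (cong (x *_) (∏-++ xs ys)) (sym (*-assoc x _ _))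

  ∏-replicate : ∀ k c → ∏ (replicate k c) ≡ c ^ k
  ∏-replicate zero    c = refl
  ∏-replicate (suc k) c = cong (c *_) (∏-replicate k c)

  -- The inequality 1 + y ≥ exp (y - 2 y²), valid for y ≥ -1/2, multiplied over
  -- a list and followed by e^l ≥ 1 + l, gives a form without exponentials:
  -- the product of the 1 + y is at least 2^k (1 + l) with
  -- l = ∑ (y - 2 y²) - k.
  module _ (ys : List ℚ) (ps : All (λ y → 0ℚ ≤ ½ + y) ys) where

    private
      -- z is an upper bound for 1/(1 + y).
      z w : ℚ → ℚ
      z y = 1ℚ - y + 2ℚ * (y * y)
      w y = y - 2ℚ * (y * y)

      0≤½ : 0ℚ ≤ ½
      0≤½ = nonNegative⁻¹ ½

      0≤2 : 0ℚ ≤ 2ℚ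
      0≤2 = nonNegative⁻¹ 2ℚ

      0≤z : ∀ y → 0ℚ ≤ z y
      0≤z y = subst (0ℚ ≤_)
        (solve 1 (λ y → con ½ :+ con ½ :* ((con 1ℚ :- y) :* (con 1ℚ :- y)) :+ (con 1ℚ :+ con ½) :* (y :* y)
           := con 1ℚ :- y :+ con 2ℚ :* (y :* y)) refl y)
        (0≤+ (0≤+ 0≤½ (0≤* 0≤½ (0≤² (1ℚ - y)))) (0≤* (0≤+ 0≤1 0≤½) (0≤² y)))

      0≤1+y : ∀ {y} → 0ℚ ≤ ½ + y → 0ℚ ≤ 1ℚ + y
      0≤1+y {y} p = subst (0ℚ ≤_) (solve 1 (λ y → con ½ :+ (con ½ :+ y) := con 1ℚ :+ y) refl y) (0≤+ 0≤½ p)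

      ∏1+-nonNeg : ∀ {ys} → All (λ y → 0ℚ ≤ ½ + y) ys → 0ℚ ≤ ∏ (map (1ℚ +_) ys)
      ∏1+-nonNeg []       = 0≤1
      ∏1+-nonNeg {y ∷ _} (p ∷ ps) = 0≤* (0≤1+y {y} p) (∏1+-nonNeg ps)

      z-nonNeg : ∀ ys → All (0ℚ ≤_) (map z ys)
      z-nonNeg []       = []
      z-nonNeg (y ∷ ys) = 0≤z y ∷ z-nonNeg ys

      -- (1 + y) z y = 1 + y² (1 + 2 y)
      z-inverse : ∀ {ys} → All (λ y → 0ℚ ≤ ½ + y) ys → 1ℚ ≤ ∏ (map z ys) * ∏ (map (1ℚ +_) ys)
      z-inverse []                       = ≤-refl
      z-inverse {y ∷ ys} (p ∷ ps) = ≤-trans (z-inverse ps)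
        (by-difference
          (0≤* (0≤* (∏-nonNeg (z-nonNeg ys)) (∏1+-nonNeg ps)) (0≤* 0≤2 (0≤* (0≤² y) p)))
          (solve 3 (λ y P Q →
             (con 1ℚ :- y :+ con 2ℚ :* (y :* y)) :* P :* ((con 1ℚ :+ y) :* Q) :- P :* Q
               := P :* Q :* (con 2ℚ :* (y :* y :* (con ½ :+ y))))
            refl y (∏ (map z ys)) (∏ (map (1ℚ +_) ys))))

      ∑z : ∀ ys → ∑ (map z ys) id ≡ ⌜ length ys ⌝ - ∑ ys w
      ∑z []       = sym (trans (+-identityʳ ⌜ 0 ⌝) ⌜0⌝)
      ∑z (y ∷ ys) = begin-equality
        z y + ∑ (map z ys) id              ≡⟨ cong (z y +_) (∑z ys) ⟩
        z y + (⌜ length ys ⌝ - ∑ ys w)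
          ≡⟨ solve 3 (λ y l s → con 1ℚ :- y :+ con 2ℚ :* (y :* y) :+ (l :- s)
               := con 1ℚ :+ l :- (y :- con 2ℚ :* (y :* y) :+ s)) refl y ⌜ length ys ⌝ (∑ ys w) ⟩
        1ℚ + ⌜ length ys ⌝ - (w y + ∑ ys w)
          ≡⟨ cong (_- (w y + ∑ ys w)) (⌜suc⌝ (length ys)) ⟨
        ⌜ suc (length ys) ⌝ - (w y + ∑ ys w) ∎

      ∑-replicate : ∀ k → ∑ (replicate k 2ℚ) id ≡ ⌜ k ⌝ + ⌜ k ⌝
      ∑-replicate zero    = sym (cong₂ _+_ ⌜0⌝ ⌜0⌝)
      ∑-replicate (suc k) = begin-equality
        2ℚ + ∑ (replicate k 2ℚ) id ≡⟨ cong (2ℚ +_) (∑-replicate k) ⟩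
        2ℚ + (⌜ k ⌝ + ⌜ k ⌝)
          ≡⟨ solve 1 (λ k → con 2ℚ :+ (k :+ k) := con 1ℚ :+ k :+ (con 1ℚ :+ k)) refl ⌜ k ⌝ ⟩
        1ℚ + ⌜ k ⌝ + (1ℚ + ⌜ k ⌝)  ≡⟨ cong₂ _+_ (⌜suc⌝ k) (⌜suc⌝ k) ⟨
        ⌜ suc k ⌝ + ⌜ suc k ⌝      ∎

    -- If 1 + l is positive, then the list of 1 + l, k copies of 2 and the z y has
    -- sum equal to its length, hence product at most 1.
    exp-bound : ∀ k → 2ℚ ^ k * (1ℚ + ∑ ys (λ y → y - 2ℚ * (y * y)) - ⌜ k ⌝) ≤ ∏ (map (1ℚ +_) ys)
    exp-bound k with ≤-total (1ℚ + ∑ ys w - ⌜ k ⌝) 0ℚ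
    ... | inj₁ l≤0 = begin
      2ℚ ^ k * l   ≤⟨ *-monoˡ (^-nonNeg k 0≤2) l≤0 ⟩
      2ℚ ^ k * 0ℚ  ≡⟨ *-zeroʳ (2ℚ ^ k) ⟩
      0ℚ           ≤⟨ ∏1+-nonNeg ps ⟩
      ∏ (map (1ℚ +_) ys) ∎
      where l = 1ℚ + ∑ ys w - ⌜ k ⌝
    ... | inj₂ 0≤l = begin
      2ℚ ^ k * l          ≡⟨ *-identityʳ _ ⟨
      2ℚ ^ k * l * 1ℚ     ≤⟨ *-monoˡ (0≤* (^-nonNeg k 0≤2) 0≤l) (z-inverse ps) ⟩
      2ℚ ^ k * l * (Z * Y)
        ≡⟨ solve 4 (λ p l z y → p :* l :* (z :* y) := l :* (p :* z) :* y) refl (2ℚ ^ k) l Z Y ⟩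
      l * (2ℚ ^ k * Z) * Y  ≡⟨ cong (λ q → l * q * Y) (trans (∏-++ (replicate k 2ℚ) (map z ys))
                                 (cong (_* Z) (∏-replicate k 2ℚ))) ⟨
      ∏ ws * Y            ≤⟨ *-monoʳ (∏1+-nonNeg ps) (∏≤1 ws ws-nonNeg (≤-reflexive sum)) ⟩
      1ℚ * Y              ≡⟨ *-identityˡ Y ⟩
      Y                   ∎
      where
      l = 1ℚ + ∑ ys w - ⌜ k ⌝
      Y = ∏ (map (1ℚ +_) ys)
      Z = ∏ (map z ys)
      ws = l ∷ replicate k 2ℚ ++ map z ys
      ws-nonNeg : All (0ℚ ≤_) ws
      ws-nonNeg = 0≤l ∷ All.++⁺ (All.replicate⁺ k 0≤2) (z-nonNeg ys)
      sum : ∑ ws id ≡ ⌜ length ws ⌝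
      sum = begin-equality
        l + ∑ (replicate k 2ℚ ++ map z ys) id
          ≡⟨ cong (l +_) (trans (∑-++ (replicate k 2ℚ) (map z ys) id) (cong₂ _+_ (∑-replicate k) (∑z ys))) ⟩
        l + (⌜ k ⌝ + ⌜ k ⌝ + (⌜ length ys ⌝ - ∑ ys w))
          ≡⟨ solve 3 (λ k n s → con 1ℚ :+ s :- k :+ (k :+ k :+ (n :- s)) := con 1ℚ :+ (k :+ n))
               refl ⌜ k ⌝ ⌜ length ys ⌝ (∑ ys w) ⟩
        1ℚ + (⌜ k ⌝ + ⌜ length ys ⌝)     ≡⟨ cong (1ℚ +_) (⌜+⌝ k (length ys)) ⟨
        1ℚ + ⌜ k ℕ.+ length ys ⌝         ≡⟨ ⌜suc⌝ (k ℕ.+ length ys) ⟨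
        ⌜ suc (k ℕ.+ length ys) ⌝
          ≡⟨ cong (λ j → ⌜ suc j ⌝) (trans (length-++ (replicate k 2ℚ))
               (cong₂ ℕ._+_ (length-replicate k) (length-map z ys))) ⟨
        ⌜ length ws ⌝                    ∎

  -- Maclaurin's inequality

  -- The elementary symmetric polynomial of degree m in N variables.
  elementary : ∀ N → ℕ → (Fin N → ℚ) → ℚ
  elementary N       zero    x = 1ℚ
  elementary zero    (suc m) x = 0ℚ
  elementary (suc N) (suc m) x =
    elementary N (suc m) (x ∘ suc) + x zero * elementary N m (x ∘ suc)

  pascal : ∀ n k → ⌜ suc n C suc k ⌝ ≡ ⌜ n C k ⌝ + ⌜ n C suc k ⌝
  pascal n k = trans (cong ⌜_⌝ (sym (nCk+nC[k+1]≡[n+1]C[k+1] n k))) (⌜+⌝ (n C k) (n C suc k))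

  absorption : ∀ n k → ⌜ suc n ⌝ * ⌜ n C k ⌝ ≡ ⌜ suc k ⌝ * ⌜ suc n C suc k ⌝
  absorption zero    zero    = refl
  absorption zero    (suc k) = trans (cong (⌜ 1 ⌝ *_) ⌜0⌝)
    (trans (*-zeroʳ ⌜ 1 ⌝) (sym (trans (cong (⌜ suc (suc k) ⌝ *_) ⌜0⌝) (*-zeroʳ ⌜ suc (suc k) ⌝))))
  absorption (suc n) zero    = trans (*-comm ⌜ suc (suc n) ⌝ ⌜ 1 ⌝)
    (cong (λ c → ⌜ 1 ⌝ * ⌜ c ⌝) (sym (nC1≡n (suc (suc n)))))
  absorption (suc n) (suc k) = begin-equality
    ⌜ suc (suc n) ⌝ * ⌜ suc n C suc k ⌝
      ≡⟨ cong₂ (λ a b → a * b) (⌜suc⌝ (suc n)) (pascal n k) ⟩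
    (1ℚ + ⌜ suc n ⌝) * (a + b)
      ≡⟨ solve 3 (λ n a b → (con 1ℚ :+ n) :* (a :+ b) := a :+ b :+ n :* a :+ n :* b) refl ⌜ suc n ⌝ a b ⟩
    a + b + ⌜ suc n ⌝ * a + ⌜ suc n ⌝ * b
      ≡⟨ cong₂ (λ u v → a + b + u + v) (absorption n k) (absorption n (suc k)) ⟩
    a + b + ⌜ suc k ⌝ * c + ⌜ suc (suc k) ⌝ * d
      ≡⟨ cong₂ (λ u v → u + ⌜ suc k ⌝ * c + v * d) (sym (pascal n k)) (⌜suc⌝ (suc k)) ⟩
    c + ⌜ suc k ⌝ * c + (1ℚ + ⌜ suc k ⌝) * d
      ≡⟨ solve 3 (λ k c d → c :+ k :* c :+ (con 1ℚ :+ k) :* d := (con 1ℚ :+ k) :* (c :+ d)) refl ⌜ suc k ⌝ c d ⟩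
    (1ℚ + ⌜ suc k ⌝) * (c + d)
      ≡⟨ cong₂ _*_ (⌜suc⌝ (suc k)) (pascal (suc n) (suc k)) ⟨
    ⌜ suc (suc k) ⌝ * ⌜ suc (suc n) C suc (suc k) ⌝ ∎
    where
    a = ⌜ n C k ⌝
    b = ⌜ n C suc k ⌝
    c = ⌜ suc n C suc k ⌝
    d = ⌜ suc n C suc (suc k) ⌝

  -- Maclaurin's inequality e_m(x) ≤ C(N, m) a^m, where a is the mean of x.
  -- In the induction on N, the recursions for e_m and for the binomial
  -- coefficients reduce it to Bernoulli's inequality, as for am-gm.
  maclaurin : ∀ N m (x : Fin N → ℚ) {a} → (∀ i → 0ℚ ≤ x i) → 0ℚ ≤ a →
              ⌜ N ⌝ * a ≡ ∑ (allFin N) x → elementary N m x ≤ ⌜ N C m ⌝ * a ^ m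
  maclaurin N       zero    x 0≤x 0≤a eq = ≤-reflexive (sym (trans (*-identityʳ ⌜ 1 ⌝) ⌜1⌝))
  maclaurin zero    (suc m) x {a} 0≤x 0≤a eq = ≤-reflexive (sym (trans (cong (_* a ^ suc m) ⌜0⌝)
      (*-zeroˡ (a ^ suc m))))
  maclaurin (suc N) (suc m) x {a} 0≤x 0≤a eq = begin
    elementary N (suc m) y + x zero * elementary N m y
      ≤⟨ +-mono-≤ (maclaurin N (suc m) y 0≤y 0≤b eq′) (*-monoˡ (0≤x zero) (maclaurin N m y 0≤y 0≤b eq′)) ⟩
    q * (b * b ^ m) + x zero * (p * b ^ m)
      ≡⟨ cong (λ z → q * (b * b ^ m) + z * (p * b ^ m)) x≡ ⟩
    q * (b * b ^ m) + (b + ⌜ suc N ⌝ * (a - b)) * (p * b ^ m)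
      ≡⟨ solve 6 (λ q b t n d p → q :* (b :* t) :+ (b :+ n :* d) :* (p :* t)
           := t :* ((p :+ q) :* b :+ n :* p :* d)) refl q b (b ^ m) ⌜ suc N ⌝ (a - b) p ⟩
    b ^ m * ((p + q) * b + ⌜ suc N ⌝ * p * (a - b))
      ≡⟨ cong₂ (λ u v → b ^ m * (u * b + v * (a - b))) (sym (pascal N m)) (absorption N m) ⟩
    b ^ m * (r * b + ⌜ suc m ⌝ * r * (a - b))
      ≡⟨ solve 5 (λ t r b m d → t :* (r :* b :+ m :* r :* d) := r :* (t :* (b :+ m :* d)))
           refl (b ^ m) r b ⌜ suc m ⌝ (a - b) ⟩
    r * (b ^ m * (b + ⌜ suc m ⌝ * (a - b)))
      ≤⟨ *-monoˡ (0≤⌜⌝ (suc N C suc m)) (bernoulli m 0≤b (subst (0ℚ ≤_) (sym b+) 0≤a)) ⟩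
    r * (b + (a - b)) ^ suc m   ≡⟨ cong (λ z → r * z ^ suc m) b+ ⟩
    r * a ^ suc m ∎
    where
    y = x ∘ suc
    0≤y : ∀ i → 0ℚ ≤ y i
    0≤y i = 0≤x (suc i)
    s = ∑ (allFin N) y
    p = ⌜ N C m ⌝
    q = ⌜ N C suc m ⌝
    r = ⌜ suc N C suc m ⌝
    μ = mean N (∑-nonNeg (allFin N) 0≤y) λ { refl → refl }
    b = proj₁ μ
    0≤b = proj₁ (proj₂ μ)
    eq′ = proj₂ (proj₂ μ)
    b+ : b + (a - b) ≡ a
    b+ = solve 2 (λ a b → b :+ (a :- b) := a) refl a b
    x≡ : x zero ≡ b + ⌜ suc N ⌝ * (a - b)
    x≡ = mean-step {N} {b = b} (trans (cong (_* a) (sym (⌜suc⌝ N))) (trans eq (∑-allFin-suc N x))) eq′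

  -- Subsets of a given size

  subsets : ∀ N → List (Subset N)
  subsets N = vectors (true ∷ false ∷ []) N

  -- The subsets of size m.
  level : ∀ N → ℕ → List (Subset N)
  level N m = filter (λ S → card S ℕ.≟ m) (subsets N)

  ∑-subsets-suc : ∀ N f → ∑ (subsets (suc N)) f ≡
    ∑ (subsets N) (λ S → f (true ∷ S)) + ∑ (subsets N) (λ S → f (false ∷ S))
  ∑-subsets-suc N f = trans (∑-vectors-suc (true ∷ false ∷ []) N f)
    (cong (∑ (subsets N) (λ S → f (true ∷ S)) +_) (+-identityʳ _))

  ∑-level : ∀ N m f → ∑ (level N m) f ≡ ∑ (subsets N) (λ S → [ does (card S ℕ.≟ m) ] * f S)
  ∑-level N m f = ∑-filter (λ S → card S ℕ.≟ m) (subsets N) f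

  -- The values of x at the elements of S.
  select : ∀ {N} → Subset N → (Fin N → ℚ) → List ℚ
  select []          x = []
  select (true ∷ S)  x = x zero ∷ select S (x ∘ suc)
  select (false ∷ S) x = select S (x ∘ suc)

  length-select : ∀ {N} (S : Subset N) x → length (select S x) ≡ card S
  length-select []          x = refl
  length-select (true ∷ S)  x = cong suc (length-select S (x ∘ suc))
  length-select (false ∷ S) x = length-select S (x ∘ suc)

  map-select : ∀ {N} (h : ℚ → ℚ) (S : Subset N) x → map h (select S x) ≡ select S (h ∘ x)
  map-select h []          x = refl
  map-select h (true ∷ S)  x = cong (h (x zero) ∷_) (map-select h S (x ∘ suc))
  map-select h (false ∷ S) x = map-select h S (x ∘ suc)

  All-select : ∀ {N} {P : ℚ → Set} (S : Subset N) {x} → (∀ i → P (x i)) → All P (select S x)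
  All-select []          h = []
  All-select (true ∷ S)  h = h zero ∷ All-select S (h ∘ suc)
  All-select (false ∷ S) h = All-select S (h ∘ suc)

  ∑-select : ∀ {N} (S : Subset N) x (h : ℚ → ℚ) →
    ∑ (select S x) h ≡ ∑ (allFin N) (λ i → [ lookup S i ] * h (x i))
  ∑-select []                  x h = refl
  ∑-select {suc N} (true ∷ S)  x h = trans
    (cong₂ _+_ (sym (*-identityˡ (h (x zero)))) (∑-select S (x ∘ suc) h))
    (sym (∑-allFin-suc N (λ i → [ lookup (true ∷ S) i ] * h (x i))))
  ∑-select {suc N} (false ∷ S) x h = trans
    (trans (∑-select S (x ∘ suc) h) (sym (trans
      (cong (_+ ∑ (allFin N) (λ i → [ lookup S i ] * h (x (suc i)))) (*-zeroˡ (h (x zero))))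
      (+-identityˡ _))))
    (sym (∑-allFin-suc N (λ i → [ lookup (false ∷ S) i ] * h (x i))))

  ∑-level-∏ : ∀ N m (x : Fin N → ℚ) → ∑ (level N m) (λ S → ∏ (select S x)) ≡ elementary N m x
  ∑-level-∏ N m x = trans (∑-level N m _) (go N m x)
    where
    go : ∀ N m (x : Fin N → ℚ) →
      ∑ (subsets N) (λ S → [ does (card S ℕ.≟ m) ] * ∏ (select S x)) ≡ elementary N m x
    go zero    zero    x = refl
    go zero    (suc m) x = refl
    go (suc N) zero    x = trans (∑-subsets-suc N _) (trans
      (cong₂ _+_ (trans (∑-cong (subsets N) (λ S → *-zeroˡ (∏ (select (true ∷ S) x))))
          (∑-zero (subsets N))) (go N zero (x ∘ suc)))
      (+-identityˡ 1ℚ))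
    go (suc N) (suc m) x = trans (∑-subsets-suc N _) (trans
      (cong₂ _+_
        (trans (∑-cong (subsets N) (λ S → solve 3 (λ b x p → b :* (x :* p) := x :* (b :* p)) refl
            [ does (card S ℕ.≟ m) ] (x zero) (∏ (select S (x ∘ suc)))))
          (trans (∑-*ˡ (subsets N) (x zero) _) (cong (x zero *_) (go N m (x ∘ suc)))))
        (go N (suc m) (x ∘ suc)))
      (+-comm (x zero * elementary N m (x ∘ suc)) _))

  ∏-select-1 : ∀ {N} (S : Subset N) → ∏ (select S (λ _ → 1ℚ)) ≡ 1ℚ
  ∏-select-1 []          = refl
  ∏-select-1 (true ∷ S)  = trans (*-identityˡ _) (∏-select-1 S)
  ∏-select-1 (false ∷ S) = ∏-select-1 S

  length-level : ∀ N m → ⌜ length (level N m) ⌝ ≡ ⌜ N C m ⌝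
  length-level N m = begin-equality
    ⌜ length (level N m) ⌝                        ≡⟨ *-identityʳ _ ⟨
    ⌜ length (level N m) ⌝ * 1ℚ                   ≡⟨ ∑-const (level N m) 1ℚ ⟨
    ∑ (level N m) (λ _ → 1ℚ)                      ≡⟨ ∑-cong (level N m) ∏-select-1 ⟨
    ∑ (level N m) (λ S → ∏ (select S (λ _ → 1ℚ))) ≡⟨ ∑-level-∏ N m (λ _ → 1ℚ) ⟩
    elementary N m (λ _ → 1ℚ)                     ≡⟨ go N m ⟩
    ⌜ N C m ⌝                                     ∎
    where
    go : ∀ N m → elementary N m (λ _ → 1ℚ) ≡ ⌜ N C m ⌝
    go N       zero    = sym ⌜1⌝
    go zero    (suc m) = sym ⌜0⌝
    go (suc N) (suc m) = trans
      (cong₂ _+_ (go N (suc m)) (trans (*-identityˡ _) (go N m)))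
      (trans (+-comm ⌜ N C suc m ⌝ ⌜ N C m ⌝) (sym (pascal N m)))

  C-pos : ∀ {N m} → m ℕ.≤ N → 0ℚ < ⌜ N C m ⌝
  C-pos {N}     {zero}  _           = 0<⌜suc⌝ 0
  C-pos {suc N} {suc m} (ℕ.s≤s m≤N) = subst (0ℚ <_) (sym (pascal N m))
    (+-mono-<-≤ (C-pos m≤N) (0≤⌜⌝ (N C suc m)))

  -- Averages over the subsets of size m

  -- The average of f over the subsets of size m, for m ≤ N.
  𝔼 : ∀ N m → (Subset N → ℚ) → ℚ
  𝔼 N m f = recip ⌜ N C m ⌝ * ∑ (level N m) f

  module _ {N m} (m≤N : m ℕ.≤ N) where

    private
      0<C = C-pos m≤N
      0≤r : 0ℚ ≤ recip ⌜ N C m ⌝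
      0≤r = recip-nonNeg 0<C

    𝔼-mono : ∀ {f g} → (∀ S → card S ≡ m → f S ≤ g S) → 𝔼 N m f ≤ 𝔼 N m g
    𝔼-mono h = *-monoˡ 0≤r (∑-filter-mono (λ S → card S ℕ.≟ m) (subsets N) h)

    𝔼-const : ∀ c → 𝔼 N m (λ _ → c) ≡ c
    𝔼-const c = begin-equality
      r * ∑ (level N m) (λ _ → c)       ≡⟨ cong (r *_) (∑-const (level N m) c) ⟩
      r * (⌜ length (level N m) ⌝ * c)  ≡⟨ cong (λ l → r * (l * c)) (length-level N m) ⟩
      r * (b * c)                       ≡⟨ solve 3 (λ r b c → r :* (b :* c) := b :* r :* c) refl r b c ⟩
      b * r * c                         ≡⟨ cong (_* c) (recip-inverse 0<C) ⟩
      1ℚ * c                            ≡⟨ *-identityˡ c ⟩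
      c                                 ∎
      where
      b = ⌜ N C m ⌝
      r = recip b

    ∑-level-𝔼 : ∀ f → ∑ (level N m) f ≡ ⌜ N C m ⌝ * 𝔼 N m f
    ∑-level-𝔼 f = sym (trans (sym (*-assoc b (recip b) s))
      (trans (cong (_* s) (recip-inverse 0<C)) (*-identityˡ s)))
      where
      b = ⌜ N C m ⌝
      s = ∑ (level N m) f

  module _ (N m : ℕ) where

    𝔼-+ : ∀ f g → 𝔼 N m (λ S → f S + g S) ≡ 𝔼 N m f + 𝔼 N m g
    𝔼-+ f g = trans (cong (r *_) (∑-+ (level N m) f g))
      (*-distribˡ-+ r (∑ (level N m) f) (∑ (level N m) g))
      where r = recip ⌜ N C m ⌝

    𝔼-- : ∀ f g → 𝔼 N m (λ S → f S - g S) ≡ 𝔼 N m f - 𝔼 N m g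
    𝔼-- f g = trans (cong (r *_) (∑-- (level N m) f g))
      (solve 3 (λ r a b → r :* (a :- b) := r :* a :- r :* b) refl r (∑ (level N m) f) (∑ (level N m) g))
      where r = recip ⌜ N C m ⌝

    𝔼-* : ∀ c f → 𝔼 N m (λ S → c * f S) ≡ c * 𝔼 N m f
    𝔼-* c f = trans (cong (r *_) (∑-*ˡ (level N m) c f))
      (solve 3 (λ r a b → r :* (a :* b) := a :* (r :* b)) refl r c (∑ (level N m) f))
      where r = recip ⌜ N C m ⌝

    𝔼-∑ : ∀ {A : Set} (xs : List A) (f : A → Subset N → ℚ) →
          𝔼 N m (λ S → ∑ xs (λ x → f x S)) ≡ ∑ xs (λ x → 𝔼 N m (f x))
    𝔼-∑ xs f = trans (cong (r *_) (∑-swap (level N m) xs (λ S x → f x S)))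
      (sym (∑-*ˡ xs r (λ x → ∑ (level N m) (f x))))
      where r = recip ⌜ N C m ⌝

  -- Maclaurin's inequality for weights of mean 1.
  𝔼-∏≤1 : ∀ N m (x : Fin N → ℚ) → m ℕ.≤ N → (∀ i → 0ℚ ≤ x i) → ∑ (allFin N) x ≡ ⌜ N ⌝ →
           𝔼 N m (λ S → ∏ (select S x)) ≤ 1ℚ
  𝔼-∏≤1 N m x m≤N 0≤x eq = begin
    r * ∑ (level N m) (λ S → ∏ (select S x)) ≡⟨ cong (r *_) (∑-level-∏ N m x) ⟩
    r * elementary N m x                     ≤⟨ *-monoˡ (recip-nonNeg (C-pos m≤N))
      (maclaurin N m x 0≤x 0≤1 (trans (*-identityʳ ⌜ N ⌝) (sym eq))) ⟩
    r * (⌜ N C m ⌝ * 1ℚ ^ m)                 ≡⟨ cong (λ z → r * (⌜ N C m ⌝ * z)) (1^ m) ⟩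
    r * (⌜ N C m ⌝ * 1ℚ)                     ≡⟨ solve 2 (λ r b → r :* (b :* con 1ℚ) := b :* r)
        refl r ⌜ N C m ⌝ ⟩
    ⌜ N C m ⌝ * r                            ≡⟨ recip-inverse (C-pos m≤N) ⟩
    1ℚ ∎
    where r = recip ⌜ N C m ⌝

  -- Double counting of a set and a new element

  -- S ↦ S ∪ i is a bijection from the sets avoiding i to those containing i.
  ∑-insert : ∀ {N} (i : Fin N) (f : Subset N → ℚ) →
    ∑ (subsets N) (λ S → [ not (lookup S i) ] * f (S [ i ]≔ true)) ≡
    ∑ (subsets N) (λ S → [ lookup S i ] * f S)
  ∑-insert {suc N} zero f = begin-equality
    ∑ (subsets (suc N)) (λ S → [ not (lookup S zero) ] * f (S [ zero ]≔ true))
      ≡⟨ ∑-subsets-suc N _ ⟩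
    ∑ (subsets N) (λ S → 0ℚ * f (true ∷ S)) + ∑ (subsets N) (λ S → 1ℚ * f (true ∷ S))
      ≡⟨ +-comm (∑ (subsets N) (λ S → 0ℚ * f (true ∷ S))) _ ⟩
    ∑ (subsets N) (λ S → 1ℚ * f (true ∷ S)) + ∑ (subsets N) (λ S → 0ℚ * f (true ∷ S))
      ≡⟨ cong (∑ (subsets N) (λ S → 1ℚ * f (true ∷ S)) +_)
           (∑-cong (subsets N) (λ S → trans (*-zeroˡ (f (true ∷ S))) (sym (*-zeroˡ (f (false ∷ S)))))) ⟩
    ∑ (subsets N) (λ S → 1ℚ * f (true ∷ S)) + ∑ (subsets N) (λ S → 0ℚ * f (false ∷ S))
      ≡⟨ ∑-subsets-suc N _ ⟨
    ∑ (subsets (suc N)) (λ S → [ lookup S zero ] * f S) ∎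
  ∑-insert {suc N} (suc i) f = trans (∑-subsets-suc N _) (trans
    (cong₂ _+_ (∑-insert i (λ S → f (true ∷ S))) (∑-insert i (λ S → f (false ∷ S))))
    (sym (∑-subsets-suc N _)))

  card-insert : ∀ {N} (S : Subset N) i → lookup S i ≡ false → card (S [ i ]≔ true) ≡ suc (card S)
  card-insert (false ∷ S) zero    e = refl
  card-insert (true  ∷ S) (suc i) e = cong suc (card-insert S i e)
  card-insert (false ∷ S) (suc i) e = card-insert S i e

  -- The sum of f S i over the elements i of S, and of f (S ∪ i) i over the
  -- positions i outside S.
  inner-sum outer-sum : ∀ {N} → (Subset N → Fin N → ℚ) → Subset N → ℚ
  inner-sum {N} f S = ∑ (allFin N) (λ i → [ lookup S i ] * f S i)
  outer-sum {N} f S = ∑ (allFin N) (λ i → [ not (lookup S i) ] * f (S [ i ]≔ true) i)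

  ∑-outer≡∑-inner : ∀ N m (f : Subset N → Fin N → ℚ) →
    ∑ (level N m) (outer-sum f) ≡ ∑ (level N (suc m)) (inner-sum f)
  ∑-outer≡∑-inner N m f = begin-equality
    ∑ (level N m) (outer-sum f)
      ≡⟨ ∑-swap (level N m) (allFin N) _ ⟩
    ∑ (allFin N) (λ i → ∑ (level N m) (λ S → [ not (lookup S i) ] * f (S [ i ]≔ true) i))
      ≡⟨ ∑-cong (allFin N) (λ i → trans (∑-level N m _) (trans
           (∑-cong (subsets N) (moved i)) (trans (∑-insert i (λ S → [ does (card S ℕ.≟ suc m) ] * f S i))
           (trans (∑-cong (subsets N) (λ S → solve 3 (λ a b c → a :* (b :* c) := b :* (a :* c)) refl
              [ lookup S i ] [ does (card S ℕ.≟ suc m) ] (f S i))) (sym (∑-level N (suc m) _)))))) ⟩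
    ∑ (allFin N) (λ i → ∑ (level N (suc m)) (λ S → [ lookup S i ] * f S i))
      ≡⟨ ∑-swap (level N (suc m)) (allFin N) _ ⟨
    ∑ (level N (suc m)) (inner-sum f) ∎
    where
    moved : ∀ i S → [ does (card S ℕ.≟ m) ] * ([ not (lookup S i) ] * f (S [ i ]≔ true) i) ≡
      [ not (lookup S i) ] * ([ does (card (S [ i ]≔ true) ℕ.≟ suc m) ] * f (S [ i ]≔ true) i)
    moved i S with lookup S i in e
    ... | true  = trans (cong ([ does (card S ℕ.≟ m) ] *_) (*-zeroˡ (f (S [ i ]≔ true) i)))
                    (trans (*-zeroʳ [ does (card S ℕ.≟ m) ])
                        (sym (*-zeroˡ ([ does (card (S [ i ]≔ true) ℕ.≟ suc m) ] * f (S [ i ]≔ true) i))))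
    ... | false = trans (solve 2 (λ a b → a :* (con 1ℚ :* b) := con 1ℚ :* (a :* b)) refl
                      [ does (card S ℕ.≟ m) ] (f (S [ i ]≔ true) i))
                    (cong (λ k → 1ℚ * ([ does (k ℕ.≟ suc m) ] * f (S [ i ]≔ true) i)) (sym (card-insert S i e)))

  C-step : ∀ n k → (⌜ n ⌝ - ⌜ k ⌝) * ⌜ n C k ⌝ ≡ ⌜ suc k ⌝ * ⌜ n C suc k ⌝
  C-step n k = begin-equality
    (⌜ n ⌝ - ⌜ k ⌝) * a
      ≡⟨ solve 3 (λ n k a → (n :- k) :* a := (con 1ℚ :+ n) :* a :- (con 1ℚ :+ k) :* a) refl ⌜ n ⌝ ⌜ k ⌝ a ⟩
    (1ℚ + ⌜ n ⌝) * a - (1ℚ + ⌜ k ⌝) * a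
      ≡⟨ cong₂ (λ u v → u * a - v * a) (⌜suc⌝ n) (⌜suc⌝ k) ⟨
    ⌜ suc n ⌝ * a - ⌜ suc k ⌝ * a
      ≡⟨ cong (_- ⌜ suc k ⌝ * a) (trans (absorption n k) (cong (⌜ suc k ⌝ *_) (pascal n k))) ⟩
    ⌜ suc k ⌝ * (a + b) - ⌜ suc k ⌝ * a
      ≡⟨ solve 3 (λ k a b → k :* (a :+ b) :- k :* a := k :* b) refl ⌜ suc k ⌝ a b ⟩
    ⌜ suc k ⌝ * b ∎
    where
    a = ⌜ n C k ⌝
    b = ⌜ n C suc k ⌝

  -- A uniformly random set of size m and a uniformly random new element give
  -- a uniformly random set of size m + 1 and a uniformly random element of it.
  𝔼-outer≡𝔼-inner : ∀ {N m} (f : Subset N → Fin N → ℚ) → suc m ℕ.≤ N →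
    ⌜ suc m ⌝ * 𝔼 N m (outer-sum f) ≡ (⌜ N ⌝ - ⌜ m ⌝) * 𝔼 N (suc m) (inner-sum f)
  𝔼-outer≡𝔼-inner {N} {m} f m<N = begin-equality
    ⌜ suc m ⌝ * (recip a * ∑ (level N m) (outer-sum f))
      ≡⟨ cong (λ z → ⌜ suc m ⌝ * (recip a * z)) (trans (∑-outer≡∑-inner N m f) (∑-level-𝔼 m<N (inner-sum f))) ⟩
    ⌜ suc m ⌝ * (recip a * (b * e))
      ≡⟨ solve 4 (λ s r b e → s :* (r :* (b :* e)) := s :* b :* (r :* e)) refl ⌜ suc m ⌝ (recip a) b e ⟩
    ⌜ suc m ⌝ * b * (recip a * e)
      ≡⟨ cong (_* (recip a * e)) (C-step N m) ⟨
    d * a * (recip a * e)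
      ≡⟨ solve 4 (λ d a r e → d :* a :* (r :* e) := a :* r :* (d :* e)) refl d a (recip a) e ⟩
    a * recip a * (d * e)
      ≡⟨ cong (_* (d * e)) (recip-inverse (C-pos (ℕ.<⇒≤ m<N))) ⟩
    1ℚ * (d * e)            ≡⟨ *-identityˡ _ ⟩
    d * e ∎
    where
    a = ⌜ N C m ⌝
    b = ⌜ N C suc m ⌝
    d = ⌜ N ⌝ - ⌜ m ⌝
    e = 𝔼 N (suc m) (inner-sum f)

  -- Uniformly random labellings

  length-vectors : ∀ q k → ⌜ length (vectors (allFin q) k) ⌝ ≡ ⌜ q ⌝ ^ k
  length-vectors q k = trans (sym (trans (∑-const (vectors (allFin q) k) 1ℚ) (*-identityʳ _))) (go k)
    where
    go : ∀ k → ∑ (vectors (allFin q) k) (λ _ → 1ℚ) ≡ ⌜ q ⌝ ^ k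
    go zero    = +-identityʳ 1ℚ
    go (suc k) = trans (∑-vectors-suc (allFin q) k _)
      (trans (∑-const (allFin q) _) (cong₂ _*_ (cong ⌜_⌝ (length-tabulate id)) (go k)))

  ∑-point : ∀ {q} (b : Fin q) → ∑ (allFin q) (λ a → [ does (a Fin.≟ b) ]) ≡ 1ℚ
  ∑-point {suc q} zero = trans (∑-allFin-suc q (λ a → [ does (a Fin.≟ zero) ])) (trans
    (cong (1ℚ +_) (∑-zero (allFin q))) (+-identityʳ 1ℚ))
  ∑-point {suc q} (suc b) = trans (∑-allFin-suc q (λ a → [ does (a Fin.≟ suc b) ])) (trans (+-identityˡ _)
    (trans (∑-cong (allFin q) (λ a → []-cong (suc a Fin.≟ suc b) (a Fin.≟ b) Fin.suc-injective
        (cong suc))) (∑-point b)))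

  -- Two given positions receive equal labels with probability 1/q.
  ∑-collisions : ∀ q {k} {i j : Fin k} → i ≢ j →
    ⌜ q ⌝ * ∑ (vectors (allFin q) k) (λ x → [ does (lookup x i Fin.≟ lookup x j) ]) ≡ ⌜ q ⌝ ^ k
  ∑-collisions q {suc k} {zero}  {zero}  i≢j = contradiction refl i≢j
  ∑-collisions q {suc k} {zero}  {suc j} i≢j = cong (⌜ q ⌝ *_) (begin-equality
    ∑ (vectors (allFin q) (suc k)) (λ x → [ does (lookup x zero Fin.≟ lookup x (suc j)) ])
      ≡⟨ ∑-vectors-suc (allFin q) k _ ⟩
    ∑ (allFin q) (λ a → ∑ (vectors (allFin q) k) (λ x → [ does (a Fin.≟ lookup x j) ]))
      ≡⟨ ∑-swap (allFin q) (vectors (allFin q) k) _ ⟩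
    ∑ (vectors (allFin q) k) (λ x → ∑ (allFin q) (λ a → [ does (a Fin.≟ lookup x j) ]))
      ≡⟨ ∑-cong (vectors (allFin q) k) (λ x → ∑-point (lookup x j)) ⟩
    ∑ (vectors (allFin q) k) (λ _ → 1ℚ)
      ≡⟨ trans (∑-const (vectors (allFin q) k) 1ℚ) (*-identityʳ _) ⟩
    ⌜ length (vectors (allFin q) k) ⌝     ≡⟨ length-vectors q k ⟩
    ⌜ q ⌝ ^ k ∎)
  ∑-collisions q {suc k} {suc i} {zero}  i≢j = trans
    (cong (⌜ q ⌝ *_) (∑-cong (vectors (allFin q) (suc k)) (λ x →
      []-cong (lookup x (suc i) Fin.≟ lookup x zero) (lookup x zero Fin.≟ lookup x (suc i)) sym sym)))
    (∑-collisions q {suc k} {zero} {suc i} (λ ()))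
  ∑-collisions q {suc k} {suc i} {suc j} i≢j = cong (⌜ q ⌝ *_) (begin-equality
    ∑ (vectors (allFin q) (suc k)) (λ x → [ does (lookup x (suc i) Fin.≟ lookup x (suc j)) ])
      ≡⟨ ∑-vectors-suc (allFin q) k _ ⟩
    ∑ (allFin q) (λ a → s)                 ≡⟨ ∑-const (allFin q) s ⟩
    ⌜ length (allFin q) ⌝ * s              ≡⟨ cong (λ l → ⌜ l ⌝ * s) (length-tabulate id) ⟩
    ⌜ q ⌝ * s                              ≡⟨ ∑-collisions q (i≢j ∘ cong suc) ⟩
    ⌜ q ⌝ ^ k ∎)
    where s = ∑ (vectors (allFin q) k) (λ x → [ does (lookup x i Fin.≟ lookup x j) ])

  -- Pairs of vertices

  ∑-pairs : ∀ n (g : Fin n × Fin n → ℚ) → ∑ (pairs n) g ≡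
    ∑ (allFin n) (λ u → ∑ (allFin n) (λ v → [ does (u Fin.<? v) ] * g (u , v)))
  ∑-pairs n g = trans (∑-filter (λ (u , v) → u Fin.<? v) (cartesianProduct (allFin n) (allFin n)) g)
    (∑-cartesianProductWith _,_ (allFin n) (allFin n) (λ (u , v) → [ does (u Fin.<? v) ] * g (u , v)))

  -- The number of pairs u < v, as a double sum.
  increasing : ℕ → ℚ
  increasing n = ∑ (allFin n) (λ u → ∑ (allFin n) (λ v → [ does (u Fin.<? v) ]))

  length-pairs : ∀ n → ⌜ length (pairs n) ⌝ ≡ increasing n
  length-pairs n = begin-equality
    ⌜ length (pairs n) ⌝          ≡⟨ *-identityʳ _ ⟨
    ⌜ length (pairs n) ⌝ * 1ℚ     ≡⟨ ∑-const (pairs n) 1ℚ ⟨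
    ∑ (pairs n) (λ _ → 1ℚ)        ≡⟨ ∑-pairs n (λ _ → 1ℚ) ⟩
    ∑ (allFin n) (λ u → ∑ (allFin n) (λ v → [ does (u Fin.<? v) ] * 1ℚ))
      ≡⟨ ∑-cong (allFin n) (λ u → ∑-cong (allFin n) (λ v → *-identityʳ [ does (u Fin.<? v) ])) ⟩
    increasing n ∎

  ∑-allFin-const : ∀ n c → ∑ (allFin n) (λ _ → c) ≡ ⌜ n ⌝ * c
  ∑-allFin-const n c = trans (∑-const (allFin n) c) (cong (λ k → ⌜ k ⌝ * c) (length-tabulate {n = n} id))

  ∑-allFin-1 : ∀ n → ∑ (allFin n) (λ _ → 1ℚ) ≡ ⌜ n ⌝
  ∑-allFin-1 n = trans (∑-allFin-const n 1ℚ) (*-identityʳ ⌜ n ⌝)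

  increasing-suc : ∀ n → increasing (suc n) ≡ ⌜ n ⌝ + increasing n
  increasing-suc n = trans (∑-allFin-suc n (λ u → ∑ (allFin (suc n)) (λ v → [ does (u Fin.<? v) ])))
    (cong₂ _+_
      (trans (∑-allFin-suc n (λ v → [ does (zero {n} Fin.<? v) ]))
        (trans (+-identityˡ _) (trans (∑-allFin-const n 1ℚ) (*-identityʳ ⌜ n ⌝))))
      (∑-cong (allFin n) (λ u → trans (∑-allFin-suc n (λ v → [ does (suc u Fin.<? v) ]))
        (trans (+-identityˡ _) (∑-cong (allFin n) (λ v →
          []-cong (suc u Fin.<? suc v) (u Fin.<? v) ℕ.s<s⁻¹ ℕ.s<s))))))

  length-pairs-C : ∀ n → ⌜ length (pairs n) ⌝ ≡ ⌜ n C 2 ⌝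
  length-pairs-C n = trans (length-pairs n) (go n)
    where
    go : ∀ n → increasing n ≡ ⌜ n C 2 ⌝
    go zero    = sym ⌜0⌝
    go (suc n) = trans (increasing-suc n)
      (trans (cong₂ _+_ (cong ⌜_⌝ (sym (nC1≡n n))) (go n)) (sym (pascal n 1)))

  -- 2 C(n, 2) + n = n².
  twice-pairs : ∀ n → 2ℚ * ⌜ length (pairs n) ⌝ + ⌜ n ⌝ ≡ ⌜ n ⌝ * ⌜ n ⌝
  twice-pairs n = trans (cong (λ z → 2ℚ * z + ⌜ n ⌝) (length-pairs n)) (go n)
    where
    go : ∀ n → 2ℚ * increasing n + ⌜ n ⌝ ≡ ⌜ n ⌝ * ⌜ n ⌝
    go zero    = trans (cong (λ z → 2ℚ * 0ℚ + z) ⌜0⌝) (sym (cong₂ _*_ ⌜0⌝ ⌜0⌝))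
    go (suc n) = begin-equality
      2ℚ * increasing (suc n) + ⌜ suc n ⌝
        ≡⟨ cong₂ (λ a b → 2ℚ * a + b) (increasing-suc n) (⌜suc⌝ n) ⟩
      2ℚ * (⌜ n ⌝ + increasing n) + (1ℚ + ⌜ n ⌝)
        ≡⟨ solve 2 (λ n t → con 2ℚ :* (n :+ t) :+ (con 1ℚ :+ n) := (con 2ℚ :* t :+ n) :+ con 2ℚ :* n :+ con 1ℚ)
             refl ⌜ n ⌝ (increasing n) ⟩
      (2ℚ * increasing n + ⌜ n ⌝) + 2ℚ * ⌜ n ⌝ + 1ℚ
        ≡⟨ cong (λ z → z + 2ℚ * ⌜ n ⌝ + 1ℚ) (go n) ⟩
      ⌜ n ⌝ * ⌜ n ⌝ + 2ℚ * ⌜ n ⌝ + 1ℚ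
        ≡⟨ solve 1 (λ n → n :* n :+ con 2ℚ :* n :+ con 1ℚ := (con 1ℚ :+ n) :* (con 1ℚ :+ n)) refl ⌜ n ⌝ ⟩
      (1ℚ + ⌜ n ⌝) * (1ℚ + ⌜ n ⌝)   ≡⟨ cong₂ _*_ (⌜suc⌝ n) (⌜suc⌝ n) ⟨
      ⌜ suc n ⌝ * ⌜ suc n ⌝ ∎

  twice-∑-pairs : ∀ n (g : Fin n → Fin n → ℚ) → (∀ u v → 0ℚ ≤ g u v) → (∀ u v → g u v ≡ g v u) →
    2ℚ * ∑ (pairs n) (λ (u , v) → g u v) ≤ ∑ (allFin n) (λ u → ∑ (allFin n) (λ v → g u v))
  twice-∑-pairs n g 0≤g symm = begin
    2ℚ * ∑ (pairs n) (λ (u , v) → g u v)  ≡⟨ cong (2ℚ *_) (∑-pairs n (λ (u , v) → g u v)) ⟩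
    2ℚ * s                                ≡⟨ solve 1 (λ s → con 2ℚ :* s := s :+ s) refl s ⟩
    s + s                                 ≡⟨ cong (s +_) (∑-swap (allFin n) (allFin n)
        (λ u v → [ does (u Fin.<? v) ] * g u v)) ⟩
    s + ∑ (allFin n) (λ v → ∑ (allFin n) (λ u → [ does (u Fin.<? v) ] * g u v))
      ≡⟨ ∑-+ (allFin n) _ _ ⟨
    ∑ (allFin n) (λ u → ∑ (allFin n) (λ v → [ does (u Fin.<? v) ] * g u v) +
                        ∑ (allFin n) (λ v → [ does (v Fin.<? u) ] * g v u))
      ≡⟨ ∑-cong (allFin n) (λ u → ∑-+ (allFin n) (λ v → [ does (u Fin.<? v) ] * g u v)
                                                 (λ v → [ does (v Fin.<? u) ] * g v u)) ⟨
    ∑ (allFin n) (λ u → ∑ (allFin n) (λ v → [ does (u Fin.<? v) ] * g u v + [ does (v Fin.<? u) ] * g v u))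
      ≤⟨ ∑-mono (allFin n) (λ u → ∑-mono (allFin n) (λ v → bound u v)) ⟩
    ∑ (allFin n) (λ u → ∑ (allFin n) (λ v → g u v)) ∎
    where
    s = ∑ (allFin n) (λ u → ∑ (allFin n) (λ v → [ does (u Fin.<? v) ] * g u v))
    bound : ∀ u v → [ does (u Fin.<? v) ] * g u v + [ does (v Fin.<? u) ] * g v u ≤ g u v
    bound u v = begin
      [ does (u Fin.<? v) ] * g u v + [ does (v Fin.<? u) ] * g v u
        ≡⟨ cong (λ z → [ does (u Fin.<? v) ] * g u v + [ does (v Fin.<? u) ] * z) (symm v u) ⟩
      [ does (u Fin.<? v) ] * g u v + [ does (v Fin.<? u) ] * g u v
        ≡⟨ *-distribʳ-+ (g u v) [ does (u Fin.<? v) ] [ does (v Fin.<? u) ] ⟨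
      ([ does (u Fin.<? v) ] + [ does (v Fin.<? u) ]) * g u v
        ≤⟨ *-monoʳ (0≤g u v) ([]-disjoint (u Fin.<? v) (v Fin.<? u) ℕ.<-asym) ⟩
      1ℚ * g u v   ≡⟨ *-identityˡ (g u v) ⟩
      g u v ∎

  cauchy-schwarz : ∀ {A : Set} (xs : List A) f → ∑ xs f * ∑ xs f ≤ ⌜ length xs ⌝ * ∑ xs (λ x → f x * f x)
  cauchy-schwarz []       f = ≤-reflexive (sym (*-zeroʳ ⌜ 0 ⌝))
  cauchy-schwarz (x ∷ xs) f = begin
    (a + s) * (a + s)
      ≡⟨ solve 2 (λ a s → (a :+ s) :* (a :+ s) := a :* a :+ con 2ℚ :* a :* s :+ s :* s) refl a s ⟩
    a * a + 2ℚ * a * s + s * s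
      ≤⟨ +-mono-≤ (+-monoʳ-≤ (a * a) (mixed xs)) (cauchy-schwarz xs f) ⟩
    a * a + (⌜ length xs ⌝ * (a * a) + q) + ⌜ length xs ⌝ * q
      ≡⟨ solve 3 (λ a l q → a :* a :+ (l :* (a :* a) :+ q) :+ l :* q := (con 1ℚ :+ l) :* (a :* a :+ q))
          refl a ⌜ length xs ⌝ q ⟩
    (1ℚ + ⌜ length xs ⌝) * (a * a + q)   ≡⟨ cong (_* (a * a + q)) (⌜suc⌝ (length xs)) ⟨
    ⌜ suc (length xs) ⌝ * (a * a + q) ∎
    where
    a = f x
    s = ∑ xs f
    q = ∑ xs (λ x → f x * f x)
    mixed : ∀ ys → 2ℚ * a * ∑ ys f ≤ ⌜ length ys ⌝ * (a * a) + ∑ ys (λ y → f y * f y)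
    mixed []       = ≤-reflexive (trans (*-zeroʳ (2ℚ * a)) (sym (trans (+-identityʳ _)
      (trans (cong (_* (a * a)) ⌜0⌝) (*-zeroˡ (a * a))))))
    mixed (y ∷ ys) = begin
      2ℚ * a * (f y + ∑ ys f)
        ≡⟨ *-distribˡ-+ (2ℚ * a) (f y) (∑ ys f) ⟩
      2ℚ * a * f y + 2ℚ * a * ∑ ys f
        ≤⟨ +-mono-≤ (by-difference {2ℚ * a * f y} {a * a + f y * f y} (0≤² (a - f y))
             (solve 2 (λ a b → a :* a :+ b :* b :- con 2ℚ :* a :* b := (a :- b) :* (a :- b)) refl a (f y)))
           (mixed ys) ⟩
      a * a + f y * f y + (⌜ length ys ⌝ * (a * a) + ∑ ys (λ y → f y * f y))
        ≡⟨ solve 4 (λ a b l q → a :+ b :+ (l :* a :+ q) := (con 1ℚ :+ l) :* a :+ (b :+ q)) refl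
             (a * a) (f y * f y) ⌜ length ys ⌝ (∑ ys (λ y → f y * f y)) ⟩
      (1ℚ + ⌜ length ys ⌝) * (a * a) + (f y * f y + ∑ ys (λ y → f y * f y))
        ≡⟨ cong (λ l → l * (a * a) + (f y * f y + ∑ ys (λ y → f y * f y))) (⌜suc⌝ (length ys)) ⟨
      ⌜ suc (length ys) ⌝ * (a * a) + (f y * f y + ∑ ys (λ y → f y * f y)) ∎

  ∑-pick : ∀ {q} (a : Fin q) (h : Fin q → ℚ) → ∑ (allFin q) (λ j → [ does (j Fin.≟ a) ] * h j) ≡ h a
  ∑-pick {q} a h = begin-equality
    ∑ (allFin q) (λ j → [ does (j Fin.≟ a) ] * h j)  ≡⟨ ∑-cong (allFin q) same ⟩
    ∑ (allFin q) (λ j → [ does (j Fin.≟ a) ] * h a)  ≡⟨ ∑-*ʳ (allFin q) (h a) _ ⟩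
    ∑ (allFin q) (λ j → [ does (j Fin.≟ a) ]) * h a  ≡⟨ cong (_* h a) (∑-point a) ⟩
    1ℚ * h a                                         ≡⟨ *-identityˡ (h a) ⟩
    h a ∎
    where
    same : ∀ j → [ does (j Fin.≟ a) ] * h j ≡ [ does (j Fin.≟ a) ] * h a
    same j with j Fin.≟ a
    ... | yes refl = refl
    ... | no _     = trans (*-zeroˡ (h j)) (sym (*-zeroˡ (h a)))

  module _ {n q : ℕ} (ρ : Fin n → Fin q) where

    private
      -- The size of the class with label j is class j.
      hit : Fin n → Fin q → ℚ
      hit u j = [ does (j Fin.≟ ρ u) ]

      class : Fin q → ℚ
      class j = ∑ (allFin n) (λ u → hit u j)

      ∑-class : ∑ (allFin q) class ≡ ⌜ n ⌝
      ∑-class = begin-equality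
        ∑ (allFin q) class  ≡⟨ ∑-swap (allFin q) (allFin n) (λ j u → hit u j) ⟩
        ∑ (allFin n) (λ u → ∑ (allFin q) (λ j → hit u j))  ≡⟨ ∑-cong (allFin n) (λ u → ∑-point (ρ u)) ⟩
        ∑ (allFin n) (λ _ → 1ℚ)  ≡⟨ ∑-allFin-const n 1ℚ ⟩
        ⌜ n ⌝ * 1ℚ               ≡⟨ *-identityʳ ⌜ n ⌝ ⟩
        ⌜ n ⌝ ∎

      ∑-class² : ∑ (allFin q) (λ j → class j * class j) ≡
        ∑ (allFin n) (λ u → ∑ (allFin n) (λ v → [ does (ρ u Fin.≟ ρ v) ]))
      ∑-class² = begin-equality
        ∑ (allFin q) (λ j → class j * class j)
          ≡⟨ ∑-cong (allFin q) (λ j → sym (∑-*ʳ (allFin n) (class j) (λ u → hit u j))) ⟩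
        ∑ (allFin q) (λ j → ∑ (allFin n) (λ u → hit u j * class j))
          ≡⟨ ∑-swap (allFin q) (allFin n) (λ j u → hit u j * class j) ⟩
        ∑ (allFin n) (λ u → ∑ (allFin q) (λ j → hit u j * class j))
          ≡⟨ ∑-cong (allFin n) (λ u → ∑-pick (ρ u) class) ⟩
        ∑ (allFin n) (λ u → ∑ (allFin n) (λ v → [ does (ρ u Fin.≟ ρ v) ])) ∎

    -- At least n²/q ordered pairs have equal labels.
    ∑-same-label : ⌜ n ⌝ * ⌜ n ⌝ ≤ ⌜ q ⌝ * ∑ (allFin n) (λ u → ∑ (allFin n) (λ v → [ does (ρ u Fin.≟ ρ v) ]))
    ∑-same-label = begin
      ⌜ n ⌝ * ⌜ n ⌝   ≡⟨ cong₂ _*_ ∑-class ∑-class ⟨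
      ∑ (allFin q) class * ∑ (allFin q) class   ≤⟨ cauchy-schwarz (allFin q) class ⟩
      ⌜ length (allFin q) ⌝ * ∑ (allFin q) (λ j → class j * class j)
        ≡⟨ cong₂ (λ l z → ⌜ l ⌝ * z) (length-tabulate {n = q} id) ∑-class² ⟩
      ⌜ q ⌝ * ∑ (allFin n) (λ u → ∑ (allFin n) (λ v → [ does (ρ u Fin.≟ ρ v) ])) ∎

  -- Labellings of the vertices

  -- An edge set is a subset of the positions in the list of pairs.
  Pairs : ℕ → ℕ
  Pairs n = length (pairs n)

  module _ {n : ℕ} where

    src tgt : Fin (Pairs n) → Fin n
    src i = proj₁ (List.lookup (pairs n) i)
    tgt i = proj₂ (List.lookup (pairs n) i)

    src≢tgt : ∀ i → src i ≢ tgt i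
    src≢tgt i e = ℕ.<-irrefl (cong Fin.toℕ e)
      (proj₂ (∈-filter⁻ (λ (u , v) → u Fin.<? v) {xs = cartesianProduct (allFin n) (allFin n)}
          (∈-lookup {xs = pairs n} i)))

    -- A labelling ρ of the vertices stands for the partition into its classes.
    -- It separates cross many pairs, and cutSize many elements of an edge set.
    module _ {q : ℕ} (ρ : Fin n → Fin q) where

      join sep : Fin (Pairs n) → ℚ
      join i = [ does (ρ (src i) Fin.≟ ρ (tgt i)) ]
      sep  i = [ not (does (ρ (src i) Fin.≟ ρ (tgt i))) ]

      cross : ℚ
      cross = ∑ (allFin (Pairs n)) sep

      cutSize : Subset (Pairs n) → ℚ
      cutSize S = ∑ (allFin (Pairs n)) (λ i → [ lookup S i ] * sep i)

      sep-join : ∀ i → sep i ≡ 1ℚ - join i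
      sep-join i = [not] (does (ρ (src i) Fin.≟ ρ (tgt i)))

      sep-nonNeg : ∀ i → 0ℚ ≤ sep i
      sep-nonNeg i = []-nonNeg (not (does (ρ (src i) Fin.≟ ρ (tgt i))))

      sep≤1 : ∀ i → sep i ≤ 1ℚ
      sep≤1 i = []≤1 (not (does (ρ (src i) Fin.≟ ρ (tgt i))))

      cross-nonNeg : 0ℚ ≤ cross
      cross-nonNeg = ∑-nonNeg (allFin (Pairs n)) sep-nonNeg

      cross≤ : cross ≤ ⌜ Pairs n ⌝
      cross≤ = ≤-trans (∑-mono (allFin (Pairs n)) sep≤1)
        (≤-reflexive (trans (∑-allFin-const (Pairs n) 1ℚ) (*-identityʳ _)))

      -- At most a (q - 1)/q fraction of the n² ordered pairs is separated.
      cross-bound : ⌜ q ⌝ * (2ℚ * cross) ≤ (⌜ q ⌝ - 1ℚ) * (⌜ n ⌝ * ⌜ n ⌝)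
      cross-bound = begin
        ⌜ q ⌝ * (2ℚ * cross)
          ≡⟨ cong (λ z → ⌜ q ⌝ * (2ℚ * z)) (∑-lookup (pairs n) (λ (u , v) → differ u v)) ⟨
        ⌜ q ⌝ * (2ℚ * ∑ (pairs n) (λ (u , v) → differ u v))
          ≤⟨ *-monoˡ (0≤⌜⌝ q) (twice-∑-pairs n differ
               (λ u v → []-nonNeg (not (does (ρ u Fin.≟ ρ v))))
               (λ u v → trans ([not] (does (ρ u Fin.≟ ρ v))) (trans
                 (cong (λ z → 1ℚ - z) ([]-cong (ρ u Fin.≟ ρ v) (ρ v Fin.≟ ρ u) sym sym))
                 (sym ([not] (does (ρ v Fin.≟ ρ u))))))) ⟩
        ⌜ q ⌝ * ∑ (allFin n) (λ u → ∑ (allFin n) (λ v → differ u v))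
          ≡⟨ cong (⌜ q ⌝ *_) (∑-cong (allFin n) (λ u → trans
               (∑-cong (allFin n) (λ v → [not] (does (ρ u Fin.≟ ρ v))))
               (trans (∑-- (allFin n) (λ _ → 1ℚ) (same u)) (cong (_- ∑ (allFin n) (same u)) ∑1)))) ⟩
        ⌜ q ⌝ * ∑ (allFin n) (λ u → ⌜ n ⌝ - ∑ (allFin n) (same u))
          ≡⟨ cong (⌜ q ⌝ *_) (trans (∑-- (allFin n) (λ _ → ⌜ n ⌝) (λ u → ∑ (allFin n) (same u)))
               (cong (_- t) (∑-allFin-const n ⌜ n ⌝))) ⟩
        ⌜ q ⌝ * (⌜ n ⌝ * ⌜ n ⌝ - t)
          ≤⟨ by-difference (0≤- (∑-same-label ρ)) (solve 3 (λ q m t →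
               (q :- con 1ℚ) :* m :- q :* (m :- t) := q :* t :- m) refl ⌜ q ⌝ (⌜ n ⌝ * ⌜ n ⌝) t) ⟩
        (⌜ q ⌝ - 1ℚ) * (⌜ n ⌝ * ⌜ n ⌝) ∎
        where
        differ same : Fin n → Fin n → ℚ
        differ u v = [ not (does (ρ u Fin.≟ ρ v)) ]
        same u v = [ does (ρ u Fin.≟ ρ v) ]
        t = ∑ (allFin n) (λ u → ∑ (allFin n) (same u))
        ∑1 : ∑ (allFin n) (λ _ → 1ℚ) ≡ ⌜ n ⌝
        ∑1 = trans (∑-allFin-const n 1ℚ) (*-identityʳ ⌜ n ⌝)

  -- Edges and sizes of cuts

  [∈] : ∀ {N} i (S : Subset N) → [ does (i ∈? S) ] ≡ [ lookup S i ]
  [∈] zero    (true  ∷ S) = refl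
  [∈] zero    (false ∷ S) = refl
  [∈] (suc i) (b ∷ S) = trans ([]-cong (suc i ∈? b ∷ S) (i ∈? S) (λ { (Vec.there p) → p }) Vec.there) ([∈] i S)

  ∑-card : ∀ {N} (S : Subset N) → ∑ (allFin N) (λ i → [ lookup S i ]) ≡ ⌜ card S ⌝
  ∑-card {N} S = begin-equality
    ∑ (allFin N) (λ i → [ lookup S i ])       ≡⟨ ∑-cong (allFin N) (λ i → *-identityʳ [ lookup S i ]) ⟨
    ∑ (allFin N) (λ i → [ lookup S i ] * 1ℚ)  ≡⟨ ∑-select S (λ _ → 1ℚ) (λ _ → 1ℚ) ⟨
    ∑ (select S (λ _ → 1ℚ)) (λ _ → 1ℚ)        ≡⟨ ∑-const (select S (λ _ → 1ℚ)) 1ℚ ⟩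
    ⌜ length (select S (λ _ → 1ℚ)) ⌝ * 1ℚ     ≡⟨ *-identityʳ _ ⟩
    ⌜ length (select S (λ _ → 1ℚ)) ⌝          ≡⟨ cong ⌜_⌝ (length-select S (λ _ → 1ℚ)) ⟩
    ⌜ card S ⌝ ∎

  ∑-insert-point : ∀ {N} (S : Subset N) i (f : Fin N → ℚ) → lookup S i ≡ false →
    ∑ (allFin N) (λ j → [ lookup (S [ i ]≔ true) j ] * f j) ≡ ∑ (allFin N) (λ j → [ lookup S j ] * f j) + f i
  ∑-insert-point {suc N} (false ∷ S) zero f e = begin-equality
    ∑ (allFin (suc N)) (λ j → [ lookup (true ∷ S) j ] * f j)
        ≡⟨ ∑-allFin-suc N (λ j → [ lookup (true ∷ S) j ] * f j) ⟩
    1ℚ * f zero + s                ≡⟨ solve 2 (λ f s → con 1ℚ :* f :+ s := con 0ℚ :* f :+ s :+ f)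
        refl (f zero) s ⟩
    0ℚ * f zero + s + f zero       ≡⟨ cong (_+ f zero) (∑-allFin-suc N (λ j → [ lookup (false ∷ S) j ] * f j)) ⟨
    ∑ (allFin (suc N)) (λ j → [ lookup (false ∷ S) j ] * f j) + f zero ∎
    where s = ∑ (allFin N) (λ j → [ lookup S j ] * f (suc j))
  ∑-insert-point {suc N} (b ∷ S) (suc i) f e = begin-equality
    ∑ (allFin (suc N)) (λ j → [ lookup (b ∷ (S [ i ]≔ true)) j ] * f j)
      ≡⟨ ∑-allFin-suc N (λ j → [ lookup (b ∷ (S [ i ]≔ true)) j ] * f j) ⟩
    [ b ] * f zero + ∑ (allFin N) (λ j → [ lookup (S [ i ]≔ true) j ] * f (suc j))
      ≡⟨ cong ([ b ] * f zero +_) (∑-insert-point S i (f ∘ suc) e) ⟩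
    [ b ] * f zero + (∑ (allFin N) (λ j → [ lookup S j ] * f (suc j)) + f (suc i))
      ≡⟨ +-assoc ([ b ] * f zero) (∑ (allFin N) (λ j → [ lookup S j ] * f (suc j))) (f (suc i)) ⟨
    [ b ] * f zero + ∑ (allFin N) (λ j → [ lookup S j ] * f (suc j)) + f (suc i)
      ≡⟨ cong (_+ f (suc i)) (∑-allFin-suc N (λ j → [ lookup (b ∷ S) j ] * f j)) ⟨
    ∑ (allFin (suc N)) (λ j → [ lookup (b ∷ S) j ] * f j) + f (suc i) ∎

  module _ {n r : ℕ} where

    size-cutSize : ∀ S (c : Cut r n) → ⌜ size (graph S) c ⌝ ≡ cutSize (lookup c) S
    size-cutSize S c = begin-equality
      ⌜ size (graph S) c ⌝   ≡⟨ length-filter (λ (u , v) → ¬? (lookup c u Fin.≟ lookup c v))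
          (edges {n} (graph S)) ⟩
      ∑ (edges {n} (graph S)) (λ (u , v) → [ not (does (lookup c u Fin.≟ lookup c v)) ])
        ≡⟨ ∑-map (List.lookup (pairs n)) (filter (_∈? S) (allFin (Pairs n))) _ ⟩
      ∑ (filter (_∈? S) (allFin (Pairs n))) (sep (lookup c))
        ≡⟨ ∑-filter (_∈? S) (allFin (Pairs n)) (sep (lookup c)) ⟩
      ∑ (allFin (Pairs n)) (λ i → [ does (i ∈? S) ] * sep (lookup c) i)
        ≡⟨ ∑-cong (allFin (Pairs n)) (λ i → cong (_* sep (lookup c) i) ([∈] i S)) ⟩
      cutSize (lookup c) S ∎

    size-insert : ∀ (S : Subset (Pairs n)) i (c : Cut r n) → lookup S i ≡ false →
      ⌜ size (graph (S [ i ]≔ true)) c ⌝ ≡ ⌜ size (graph S) c ⌝ + sep (lookup c) i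
    size-insert S i c e = trans (size-cutSize (S [ i ]≔ true) c)
      (trans (∑-insert-point S i (sep (lookup c)) e) (cong (_+ sep (lookup c) i) (sym (size-cutSize S c))))

  ⌜⌝-injective : ∀ {m n} → ⌜ m ⌝ ≡ ⌜ n ⌝ → m ≡ n
  ⌜⌝-injective e = ℕ.≤-antisym (⌜⌝-cancel-≤ (≤-reflexive e)) (⌜⌝-cancel-≤ (≤-reflexive (sym e)))

  -- No partition separates many more edges than expected

  ∑-∈ : ∀ {A : Set} {xs : List A} {x f} → (∀ y → 0ℚ ≤ f y) → x ∈ xs → f x ≤ ∑ xs f
  ∑-∈ {xs = y ∷ ys} {f = f} 0≤f (here refl) = ≤-trans (≤-reflexive (sym (+-identityʳ (f y))))
    (+-monoʳ-≤ (f y) (∑-nonNeg ys 0≤f))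
  ∑-∈ {xs = y ∷ ys} {f = f} 0≤f (there p) = ≤-trans (∑-∈ 0≤f p)
    (≤-trans (≤-reflexive (sym (+-identityˡ (∑ ys f)))) (+-monoˡ-≤ (∑ ys f) (0≤f y)))

  ⌜2⌝ : ⌜ 2 ⌝ ≡ 2ℚ
  ⌜2⌝ = trans (⌜suc⌝ 1) (cong (1ℚ +_) ⌜1⌝)

  -- Two given positions receive distinct labels with probability (q - 1)/q.
  ∑-separations : ∀ q {k} {a b : Fin k} → a ≢ b →
    ⌜ q ⌝ * ∑ (vectors (allFin q) k) (λ x → [ not (does (lookup x a Fin.≟ lookup x b)) ]) ≡
    (⌜ q ⌝ - 1ℚ) * ⌜ q ⌝ ^ k
  ∑-separations q {k} {a} {b} a≢b = begin-equality
    ⌜ q ⌝ * ∑ X (λ x → [ not (does (lookup x a Fin.≟ lookup x b)) ])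
      ≡⟨ cong (⌜ q ⌝ *_) (trans (∑-cong X (λ x → [not] (does (lookup x a Fin.≟ lookup x b))))
           (∑-- X (λ _ → 1ℚ) (λ x → [ does (lookup x a Fin.≟ lookup x b) ]))) ⟩
    ⌜ q ⌝ * (∑ X (λ _ → 1ℚ) - c)
      ≡⟨ cong (λ z → ⌜ q ⌝ * (z - c)) (trans (∑-const X 1ℚ) (trans (*-identityʳ _) (length-vectors q k))) ⟩
    ⌜ q ⌝ * (⌜ q ⌝ ^ k - c)
      ≡⟨ solve 3 (λ q p c → q :* (p :- c) := q :* p :- q :* c) refl ⌜ q ⌝ (⌜ q ⌝ ^ k) c ⟩
    ⌜ q ⌝ * ⌜ q ⌝ ^ k - ⌜ q ⌝ * c
      ≡⟨ cong (λ z → ⌜ q ⌝ * ⌜ q ⌝ ^ k - z) (∑-collisions q a≢b) ⟩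
    ⌜ q ⌝ * ⌜ q ⌝ ^ k - ⌜ q ⌝ ^ k
      ≡⟨ solve 2 (λ q p → q :* p :- p := (q :- con 1ℚ) :* p) refl ⌜ q ⌝ (⌜ q ⌝ ^ k) ⟩
    (⌜ q ⌝ - 1ℚ) * ⌜ q ⌝ ^ k ∎
    where
    X = vectors (allFin q) k
    c = ∑ X (λ x → [ does (lookup x a Fin.≟ lookup x b) ])

  -- Tilt every pair by t (1 - α) or -t α, according to whether a
  -- 2-colouring separates it, where α is the density of separated pairs.  The
  -- weights 1 + tilt have mean 1, so by Maclaurin's inequality the product of
  -- the weights of a random m-set averages to at most 1, while the product for
  -- one set S is at least about exp (t (separated edges - α m) - 2 t² m).
  -- Summing over the 2^n colourings bounds all 2-colourings at once.
  module Deviation {n m : ℕ} (m≤N : m ℕ.≤ Pairs n) (1≤N : 1 ℕ.≤ Pairs n)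
                   {t : ℚ} (0<t : 0ℚ < t) (t≤½ : t ≤ ½) (n≤t²m : ⌜ n ⌝ ≤ t * t * ⌜ m ⌝) where

    private
      N = ⌜ Pairs n ⌝
      0<N : 0ℚ < N
      0<N = 0<⌜⌝ 1≤N
      0≤t = <⇒≤ 0<t
      I = allFin (Pairs n)
      B = 2ℚ ^ n
      0<B : 0ℚ < B
      0<B = ^-pos n (positive⁻¹ 2ℚ)
      0≤rB = recip-nonNeg 0<B
      0≤rt = recip-nonNeg 0<t

    module _ {q} (χ : Fin n → Fin q) where

      -- The fraction of the pairs that is separated.
      density : ℚ
      density = cross χ * recip N

      tilt : Fin (Pairs n) → ℚ
      tilt i = t * (sep χ i - density)

      N*density : N * density ≡ cross χ
      N*density = trans (solve 3 (λ n c r → n :* (c :* r) := c :* (n :* r)) refl N (cross χ) (recip N))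
        (trans (cong (cross χ *_) (recip-inverse 0<N)) (*-identityʳ (cross χ)))

      private
        0≤α : 0ℚ ≤ density
        0≤α = 0≤* (cross-nonNeg χ) (recip-nonNeg 0<N)

        α≤1 : density ≤ 1ℚ
        α≤1 = *-cancelˡ 0<N (≤-trans (≤-reflexive N*density)
          (≤-trans (cross≤ χ) (≤-reflexive (sym (*-identityʳ N)))))

        tilt≥ : ∀ i → 0ℚ ≤ ½ + tilt i
        tilt≥ i = subst (0ℚ ≤_)
          (solve 3 (λ t s a → (con ½ :- t) :+ t :* (s :+ (con 1ℚ :- a)) := con ½ :+ t :* (s :- a))
            refl t (sep χ i) density)
          (0≤+ (0≤- t≤½) (0≤* 0≤t (0≤+ (sep-nonNeg χ i) (0≤- α≤1))))

        1+tilt≥ : ∀ i → 0ℚ ≤ 1ℚ + tilt i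
        1+tilt≥ i = subst (0ℚ ≤_) (solve 1 (λ y → con ½ :+ (con ½ :+ y) := con 1ℚ :+ y) refl (tilt i))
          (0≤+ (nonNegative⁻¹ ½) (tilt≥ i))

        tilt² : ∀ i → tilt i * tilt i ≤ t * t
        tilt² i = by-difference
          (0≤* (0≤² t) (0≤* (0≤+ (0≤- (sep≤1 χ i)) 0≤α) (0≤+ (0≤- α≤1) (sep-nonNeg χ i))))
          (solve 3 (λ t s a → t :* t :- t :* (s :- a) :* (t :* (s :- a))
             := t :* t :* ((con 1ℚ :- s :+ a) :* (con 1ℚ :- a :+ s))) refl t (sep χ i) density)

      -- The product of the weights of the elements of S.
      weight : Subset (Pairs n) → ℚ
      weight S = ∏ (select S (λ i → 1ℚ + tilt i))

      weight-nonNeg : ∀ S → 0ℚ ≤ weight S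
      weight-nonNeg S = ∏-nonNeg (All-select S 1+tilt≥)

      𝔼-weight : 𝔼 (Pairs n) m weight ≤ 1ℚ
      𝔼-weight = 𝔼-∏≤1 (Pairs n) m (λ i → 1ℚ + tilt i) m≤N 1+tilt≥ (begin-equality
        ∑ I (λ i → 1ℚ + tilt i)       ≡⟨ ∑-+ I (λ _ → 1ℚ) tilt ⟩
        ∑ I (λ _ → 1ℚ) + ∑ I tilt
          ≡⟨ cong₂ _+_ (trans (∑-allFin-const (Pairs n) 1ℚ) (*-identityʳ N))
              (∑-*ˡ I t (λ i → sep χ i - density)) ⟩
        N + t * ∑ I (λ i → sep χ i - density)
          ≡⟨ cong (λ z → N + t * z) (trans (∑-- I (sep χ) (λ _ → density))
               (cong (λ z → cross χ - z) (trans (∑-allFin-const (Pairs n) density) N*density))) ⟩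
        N + t * (cross χ - cross χ)
          ≡⟨ solve 3 (λ n t c → n :+ t :* (c :- c) := n) refl N t (cross χ) ⟩
        N ∎)

      weight-bound : ∀ S → card S ≡ m →
        B * (1ℚ + (t * (cutSize χ S - ⌜ m ⌝ * density) - 2ℚ * (t * t) * ⌜ m ⌝) - ⌜ n ⌝) ≤ weight S
      weight-bound S refl = begin
        B * (1ℚ + (t * (cutSize χ S - M * density) - 2ℚ * (t * t) * M) - ⌜ n ⌝)
          ≤⟨ *-monoˡ (<⇒≤ 0<B) (+-monoˡ-≤ (- ⌜ n ⌝) (+-monoʳ-≤ 1ℚ lower)) ⟩
        B * (1ℚ + ∑ (select S tilt) w - ⌜ n ⌝)
          ≤⟨ exp-bound (select S tilt) (All-select S tilt≥) n ⟩
        ∏ (map (1ℚ +_) (select S tilt))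
          ≡⟨ cong ∏ (map-select (1ℚ +_) S tilt) ⟩
        weight S ∎
        where
        M = ⌜ card S ⌝
        w = λ y → y - 2ℚ * (y * y)
        e = 2ℚ * (t * t)
        term : ∀ i → [ lookup S i ] * (t * (sep χ i - density) - e) ≡
          t * ([ lookup S i ] * sep χ i) - (t * density + e) * [ lookup S i ]
        term i = solve 5 (λ b t s a e → b :* (t :* (s :- a) :- e) := t :* (b :* s) :- (t :* a :+ e) :* b)
          refl [ lookup S i ] t (sep χ i) density e
        lower : t * (cutSize χ S - M * density) - e * M ≤ ∑ (select S tilt) w
        lower = begin
          t * (cutSize χ S - M * density) - e * M
            ≡⟨ solve 5 (λ t c m a e → t :* (c :- m :* a) :- e :* m := t :* c :- (t :* a :+ e) :* m)
                 refl t (cutSize χ S) M density e ⟩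
          t * cutSize χ S - (t * density + e) * M
            ≡⟨ cong (λ z → t * cutSize χ S - (t * density + e) * z) (∑-card S) ⟨
          t * cutSize χ S - (t * density + e) * ∑ I (λ i → [ lookup S i ])
            ≡⟨ cong₂ _-_ (∑-*ˡ I t (λ i → [ lookup S i ] * sep χ i)) (∑-*ˡ I (t * density + e)
                (λ i → [ lookup S i ])) ⟨
          ∑ I (λ i → t * ([ lookup S i ] * sep χ i)) - ∑ I (λ i → (t * density + e) * [ lookup S i ])
            ≡⟨ ∑-- I (λ i → t * ([ lookup S i ] * sep χ i)) (λ i → (t * density + e) * [ lookup S i ]) ⟨
          ∑ I (λ i → t * ([ lookup S i ] * sep χ i) - (t * density + e) * [ lookup S i ])
            ≡⟨ ∑-cong I term ⟨
          ∑ I (λ i → [ lookup S i ] * (tilt i - e))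
            ≤⟨ ∑-mono I (λ i → *-monoˡ ([]-nonNeg (lookup S i)) (+-monoʳ-≤ (tilt i)
                 (neg-antimono-≤ (*-monoˡ (nonNegative⁻¹ 2ℚ) (tilt² i))))) ⟩
          ∑ I (λ i → [ lookup S i ] * w (tilt i))
            ≡⟨ ∑-select S tilt w ⟨
          ∑ (select S tilt) w ∎

    private
      P : Subset (Pairs n) → ℚ
      P S = ∑ (cuts 2 n) (λ χ → weight (lookup χ) S)
      b : ℚ
      b = 2ℚ * (t * t) * ⌜ m ⌝ + ⌜ n ⌝ - 1ℚ

    -- One quantity that dominates separated edges - α m for every 2-colouring,
    -- and has average at most 3 t m.
    excess : Subset (Pairs n) → ℚ
    excess S = recip t * (recip B * P S + b)

    𝔼-excess : 𝔼 (Pairs n) m excess ≤ (1ℚ + 2ℚ) * t * ⌜ m ⌝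
    𝔼-excess = begin
      𝔼 (Pairs n) m excess
        ≡⟨ 𝔼-* (Pairs n) m (recip t) (λ S → recip B * P S + b) ⟩
      recip t * 𝔼 (Pairs n) m (λ S → recip B * P S + b)
        ≡⟨ cong (recip t *_) (trans (𝔼-+ (Pairs n) m (λ S → recip B * P S) (λ _ → b))
             (cong₂ _+_ (𝔼-* (Pairs n) m (recip B) P) (𝔼-const m≤N b))) ⟩
      recip t * (recip B * 𝔼 (Pairs n) m P + b)
        ≤⟨ *-monoˡ 0≤rt (+-monoˡ-≤ b (*-monoˡ 0≤rB 𝔼P)) ⟩
      recip t * (recip B * B + b)
        ≡⟨ cong (λ z → recip t * (z + b)) (trans (*-comm (recip B) B) (recip-inverse 0<B)) ⟩
      recip t * (1ℚ + b)
        ≤⟨ *-monoˡ 0≤rt (by-difference {1ℚ + b} {(1ℚ + 2ℚ) * (t * t * ⌜ m ⌝)} (0≤- n≤t²m)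
            (solve 3 (λ t m n → (con 1ℚ :+ con 2ℚ) :* (t :* t :* m) :-
                (con 1ℚ :+ (con 2ℚ :* (t :* t) :* m :+ n :- con 1ℚ))
               := t :* t :* m :- n) refl t ⌜ m ⌝ ⌜ n ⌝)) ⟩
      recip t * ((1ℚ + 2ℚ) * (t * t * ⌜ m ⌝))
        ≡⟨ solve 3 (λ r t m → r :* ((con 1ℚ :+ con 2ℚ) :* (t :* t :* m))
            := t :* r :* ((con 1ℚ :+ con 2ℚ) :* t :* m))
             refl (recip t) t ⌜ m ⌝ ⟩
      t * recip t * ((1ℚ + 2ℚ) * t * ⌜ m ⌝)
        ≡⟨ trans (cong (_* ((1ℚ + 2ℚ) * t * ⌜ m ⌝)) (recip-inverse 0<t)) (*-identityˡ _) ⟩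
      (1ℚ + 2ℚ) * t * ⌜ m ⌝ ∎
      where
      𝔼P : 𝔼 (Pairs n) m P ≤ B
      𝔼P = begin
        𝔼 (Pairs n) m P   ≡⟨ 𝔼-∑ (Pairs n) m (cuts 2 n) (λ χ → weight (lookup χ)) ⟩
        ∑ (cuts 2 n) (λ χ → 𝔼 (Pairs n) m (weight (lookup χ)))
          ≤⟨ ∑-mono (cuts 2 n) (λ χ → 𝔼-weight (lookup χ)) ⟩
        ∑ (cuts 2 n) (λ _ → 1ℚ)  ≡⟨ trans (∑-const (cuts 2 n) 1ℚ) (*-identityʳ _) ⟩
        ⌜ length (cuts 2 n) ⌝    ≡⟨ trans (length-vectors 2 n) (cong (_^ n) ⌜2⌝) ⟩
        B ∎

    2-cut-deviation : ∀ S → card S ≡ m → (χ : Cut 2 n) →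
      N * cutSize (lookup χ) S ≤ ⌜ m ⌝ * cross (lookup χ) + N * excess S
    2-cut-deviation S eq χ = begin
      N * c               ≡⟨ solve 3 (λ n c x → n :* c := n :* x :+ n :* (c :- x)) refl N c (⌜ m ⌝ * α) ⟩
      N * (⌜ m ⌝ * α) + N * (c - ⌜ m ⌝ * α)
        ≤⟨ +-monoʳ-≤ (N * (⌜ m ⌝ * α)) (*-monoˡ (<⇒≤ 0<N) (*-cancelˡ 0<t bound)) ⟩
      N * (⌜ m ⌝ * α) + N * excess S
        ≡⟨ cong (_+ N * excess S) (trans (solve 3 (λ n m a → n :* (m :* a) := m :* (n :* a)) refl N ⌜ m ⌝ α)
             (cong (⌜ m ⌝ *_) (N*density (lookup χ)))) ⟩
      ⌜ m ⌝ * cross (lookup χ) + N * excess S ∎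
      where
      c = cutSize (lookup χ) S
      α = density (lookup χ)
      l = 1ℚ + (t * (c - ⌜ m ⌝ * α) - 2ℚ * (t * t) * ⌜ m ⌝) - ⌜ n ⌝
      l≤ : l ≤ recip B * P S
      l≤ = begin
        l                  ≡⟨ *-identityˡ l ⟨
        1ℚ * l             ≡⟨ cong (_* l) (trans (sym (recip-inverse 0<B)) (*-comm B (recip B))) ⟩
        recip B * B * l    ≡⟨ *-assoc (recip B) B l ⟩
        recip B * (B * l)
          ≤⟨ *-monoˡ 0≤rB (≤-trans (weight-bound (lookup χ) S eq)
               (∑-∈ {f = λ χ → weight (lookup χ) S} (λ χ → weight-nonNeg (lookup χ) S)
                   (∈-vectors ∈-allFin χ))) ⟩
        recip B * P S ∎
      bound : t * (c - ⌜ m ⌝ * α) ≤ t * excess S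
      bound = begin
        t * (c - ⌜ m ⌝ * α)
          ≡⟨ solve 4 (λ x t m n → x := con 1ℚ :+ (x :- con 2ℚ :* (t :* t) :* m) :- n :+
              (con 2ℚ :* (t :* t) :* m :+ n :- con 1ℚ))
               refl (t * (c - ⌜ m ⌝ * α)) t ⌜ m ⌝ ⌜ n ⌝ ⟩
        l + b                        ≤⟨ +-monoˡ-≤ b l≤ ⟩
        recip B * P S + b            ≡⟨ *-identityˡ _ ⟨
        1ℚ * (recip B * P S + b)     ≡⟨ cong (_* (recip B * P S + b)) (recip-inverse 0<t) ⟨
        t * recip t * (recip B * P S + b)  ≡⟨ *-assoc t (recip t) (recip B * P S + b) ⟩
        t * excess S ∎

    -- Every partition deviates by at most twice the excess, however many parts
    -- it has: colour its parts uniformly at random with two colours; every pair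
    -- of vertices in different parts is separated with probability 1/2.
    deviation : ∀ S → card S ≡ m → ∀ {q} (ρ : Fin n → Fin q) →
      N * cutSize ρ S ≤ ⌜ m ⌝ * cross ρ + 2ℚ * (N * excess S)
    deviation S eq {q} ρ = *-cancelˡ (^-pos q (positive⁻¹ 2ℚ)) (begin
      Q * (N * cutSize ρ S)
        ≡⟨ solve 3 (λ q n c → q :* (n :* c) := n :* (q :* c)) refl Q N (cutSize ρ S) ⟩
      N * (Q * cutSize ρ S)
        ≡⟨ cong (N *_) (average (λ i → [ lookup S i ])) ⟨
      N * (2ℚ * ∑ X (λ x → ∑ I (λ i → [ lookup S i ] * split x i)))
        ≡⟨ solve 2 (λ n c → n :* (con 2ℚ :* c) := con 2ℚ :* (n :* c))
            refl N (∑ X (λ x → ∑ I (λ i → [ lookup S i ] * split x i))) ⟩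
      2ℚ * (N * ∑ X (λ x → ∑ I (λ i → [ lookup S i ] * split x i)))
        ≡⟨ cong (2ℚ *_) (∑-*ˡ X N (λ x → ∑ I (λ i → [ lookup S i ] * split x i))) ⟨
      2ℚ * ∑ X (λ x → N * ∑ I (λ i → [ lookup S i ] * split x i))
        ≤⟨ *-monoˡ (nonNegative⁻¹ 2ℚ) (∑-mono X single) ⟩
      2ℚ * ∑ X (λ x → ⌜ m ⌝ * ∑ I (λ i → 1ℚ * split x i) + N * excess S)
        ≡⟨ cong (2ℚ *_) (trans (∑-+ X (λ x → ⌜ m ⌝ * ∑ I (λ i → 1ℚ * split x i)) (λ _ → N * excess S))
             (cong₂ _+_ (∑-*ˡ X ⌜ m ⌝ (λ x → ∑ I (λ i → 1ℚ * split x i)))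
               (trans (∑-const X (N * excess S)) (cong (_* (N * excess S)) (trans (length-vectors 2 q)
                   (cong (_^ q) ⌜2⌝)))))) ⟩
      2ℚ * (⌜ m ⌝ * ∑ X (λ x → ∑ I (λ i → 1ℚ * split x i)) + Q * (N * excess S))
        ≡⟨ solve 4 (λ m c q e → con 2ℚ :* (m :* c :+ q :* e) := m :* (con 2ℚ :* c) :+ q :* (con 2ℚ :* e))
             refl ⌜ m ⌝ (∑ X (λ x → ∑ I (λ i → 1ℚ * split x i))) Q (N * excess S) ⟩
      ⌜ m ⌝ * (2ℚ * ∑ X (λ x → ∑ I (λ i → 1ℚ * split x i))) + Q * (2ℚ * (N * excess S))
        ≡⟨ cong (λ z → ⌜ m ⌝ * z + Q * (2ℚ * (N * excess S))) (average (λ _ → 1ℚ)) ⟩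
      ⌜ m ⌝ * (Q * ∑ I (λ i → 1ℚ * sep ρ i)) + Q * (2ℚ * (N * excess S))
        ≡⟨ cong (λ z → ⌜ m ⌝ * (Q * z) + Q * (2ℚ * (N * excess S))) (∑-cong I (λ i → *-identityˡ (sep ρ i))) ⟩
      ⌜ m ⌝ * (Q * cross ρ) + Q * (2ℚ * (N * excess S))
        ≡⟨ solve 4 (λ m q c e → m :* (q :* c) :+ q :* e := q :* (m :* c :+ e))
            refl ⌜ m ⌝ Q (cross ρ) (2ℚ * (N * excess S)) ⟩
      Q * (⌜ m ⌝ * cross ρ + 2ℚ * (N * excess S)) ∎)
      where
      X = vectors (allFin 2) q
      Q = 2ℚ ^ q
      split : Vec (Fin 2) q → Fin (Pairs n) → ℚ
      split x = sep (λ v → lookup x (ρ v))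

      split-sum : ∀ i → 2ℚ * ∑ X (λ x → split x i) ≡ Q * sep ρ i
      split-sum i with ρ (src i) Fin.≟ ρ (tgt i)
      ... | yes e = trans (cong (2ℚ *_)
          (trans (∑-cong X (λ x → trans ([not] (does (lookup x (ρ (src i)) Fin.≟ lookup x (ρ (tgt i)))))
          (cong (λ z → 1ℚ - z) ([]-yes (lookup x (ρ (src i)) Fin.≟ lookup x (ρ (tgt i)))
              (cong (lookup x) e))))) (∑-zero X)))
        (trans (*-zeroʳ 2ℚ) (sym (*-zeroʳ Q)))
      ... | no ¬e = trans (cong (_* ∑ X (λ x → split x i)) (sym ⌜2⌝)) (trans (∑-separations 2 ¬e)
        (trans (cong₂ (λ a b → (a - 1ℚ) * b) ⌜2⌝ (cong (_^ q) ⌜2⌝)) (*-comm 1ℚ Q)))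

      average : ∀ f → 2ℚ * ∑ X (λ x → ∑ I (λ i → f i * split x i)) ≡ Q * ∑ I (λ i → f i * sep ρ i)
      average f = begin-equality
        2ℚ * ∑ X (λ x → ∑ I (λ i → f i * split x i))
          ≡⟨ cong (2ℚ *_) (∑-swap X I (λ x i → f i * split x i)) ⟩
        2ℚ * ∑ I (λ i → ∑ X (λ x → f i * split x i))
          ≡⟨ ∑-*ˡ I 2ℚ (λ i → ∑ X (λ x → f i * split x i)) ⟨
        ∑ I (λ i → 2ℚ * ∑ X (λ x → f i * split x i))
          ≡⟨ ∑-cong I (λ i → trans (cong (2ℚ *_) (∑-*ˡ X (f i) (λ x → split x i)))
               (trans (solve 3 (λ t f s → t :* (f :* s) := f :* (t :* s)) refl 2ℚ (f i) (∑ X (λ x → split x i)))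
               (trans (cong (f i *_) (split-sum i))
                 (solve 3 (λ f q s → f :* (q :* s) := q :* (f :* s)) refl (f i) Q (sep ρ i))))) ⟩
        ∑ I (λ i → Q * (f i * sep ρ i))
          ≡⟨ ∑-*ˡ I Q (λ i → f i * sep ρ i) ⟩
        Q * ∑ I (λ i → f i * sep ρ i) ∎

      single : ∀ x → N * ∑ I (λ i → [ lookup S i ] * split x i)
          ≤ ⌜ m ⌝ * ∑ I (λ i → 1ℚ * split x i) + N * excess S
      single x = subst₂ (λ a b → N * a ≤ ⌜ m ⌝ * b + N * excess S)
        (∑-cong I (λ i → cong ([ lookup S i ] *_) (same i)))
        (∑-cong I (λ i → trans (same i) (sym (*-identityˡ (split x i)))))
        (2-cut-deviation S eq χ)
        where
        χ = Vec.tabulate (λ v → lookup x (ρ v))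
        same : ∀ i → sep (lookup χ) i ≡ split x i
        same i = cong₂ (λ a b → [ not (does (a Fin.≟ b)) ]) 
          (lookup∘tabulate (λ v → lookup x (ρ v)) (src {n} i)) (lookup∘tabulate (λ v → lookup x (ρ v))
              (tgt {n} i))

  -- Maximum cuts and equivalence of vertices

  [not]-mono : ∀ b {x y} → (b ≡ false → x ≤ y) → [ not b ] * x ≤ [ not b ] * y
  [not]-mono true  {x} {y} h = ≤-reflexive (trans (*-zeroˡ x) (sym (*-zeroˡ y)))
  [not]-mono false         h = *-monoˡ 0≤1 (h refl)

  module MaxCut (r₀ n : ℕ) where

    private
      r = suc r₀
      I = allFin (Pairs n)
      Edges = Subset (Pairs n)

    gr : Edges → Graph n
    gr S = graph S

    -- A maximum cut, the same one for each occurrence of the graph.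
    best : Edges → Cut r n
    best S = argmax (size (gr S)) (Vec.replicate n zero) (cuts r n)

    private
      all≤best : ∀ S → All (λ c → size (gr S) c ℕ.≤ size (gr S) (best S)) (cuts r n)
      all≤best S = f[xs]≤f[argmax] {f = size (gr S)} (Vec.replicate n zero) (cuts r n)

    size≤best : ∀ S c → size (gr S) c ℕ.≤ size (gr S) (best S)
    size≤best S c = All.lookup (all≤best S) (∈-vectors ∈-allFin c)

    size-best : ∀ S → size (gr S) (best S) ≡ maxCut r (gr S)
    size-best S = ℕ.≤-antisym
      (All.lookup (xs≤max 0 sizes) (∈-map⁺ (size (gr S)) (∈-vectors ∈-allFin (best S))))
      (max≤v⁺ {xs = sizes} ℕ.z≤n (All.map⁺ (all≤best S)))
      where
      sizes : List ℕ
      sizes = map (size (gr S)) (cuts r n)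

    size≤maxCut : ∀ S c → size (gr S) c ℕ.≤ maxCut r (gr S)
    size≤maxCut S c = subst (size (gr S) c ℕ.≤_) (size-best S) (size≤best S c)

    deficit-best : ∀ S k → deficit (gr S) (best S) ℕ.≤ k
    deficit-best S k = subst (ℕ._≤ k)
      (sym (trans (cong (maxCut r (gr S) ℕ.∸_) (size-best S)) (ℕ.n∸n≡0 (maxCut r (gr S))))) ℕ.z≤n

    separated joined : Cut r n → Fin (Pairs n) → Set
    joined c i = lookup c (src i) ≡ lookup c (tgt i)
    separated c i = ¬ joined c i

    size-insert-joined : ∀ S i c → lookup S i ≡ false → joined c i →
      size (gr (S [ i ]≔ true)) c ≡ size (gr S) c
    size-insert-joined S i c e j = ⌜⌝-injective (trans (size-insert S i c e)
      (trans (cong (⌜ size (gr S) c ⌝ +_) (trans (sep-join (lookup c) i)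
        (cong (λ z → 1ℚ - z) ([]-yes (lookup c (src i) Fin.≟ lookup c (tgt i)) j)))) (+-identityʳ _)))

    size-insert-separated : ∀ S i c → lookup S i ≡ false → separated c i →
      size (gr (S [ i ]≔ true)) c ≡ suc (size (gr S) c)
    size-insert-separated S i c e s = ⌜⌝-injective (trans (size-insert S i c e)
      (trans (cong (⌜ size (gr S) c ⌝ +_) (trans (sep-join (lookup c) i)
        (cong (λ z → 1ℚ - z) ([]-no (lookup c (src i) Fin.≟ lookup c (tgt i)) s))))
        (trans (+-comm ⌜ size (gr S) c ⌝ 1ℚ) (sym (⌜suc⌝ (size (gr S) c))))))

    -- A maximum cut of the larger graph that does not cut the new edge has the
    -- same size in the smaller graph, so the maximum did not grow.
    maxCut-insert : ∀ S i → lookup S i ≡ false → joined (best (S [ i ]≔ true)) i →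
      maxCut r (gr (S [ i ]≔ true)) ℕ.≤ maxCut r (gr S)
    maxCut-insert S i e j = subst (ℕ._≤ maxCut r (gr S))
      (trans (sym (size-insert-joined S i (best (S [ i ]≔ true)) e j)) (size-best (S [ i ]≔ true)))
      (size≤maxCut S (best (S [ i ]≔ true)))

    equivalent-0 : ∀ S i → lookup S i ≡ false → joined (best (S [ i ]≔ true)) i →
      Equivalent 0 r (gr S) (src i) (tgt i)
    equivalent-0 S i e j c def =
      decidable-stable (lookup c (src i) Fin.≟ lookup c (tgt i)) λ ¬p → ℕ.<-irrefl refl
      (ℕ.≤-trans (ℕ.≤-reflexive (sym (size-insert-separated S i c e ¬p)))
        (ℕ.≤-trans (size≤maxCut (S [ i ]≔ true) c)
        (ℕ.≤-trans (maxCut-insert S i e j) (ℕ.m∸n≡0⇒m≤n (ℕ.n≤0⇒n≡0 def)))))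

    -- A cut of deficit at most k + 1 that separates a pair gains an edge when
    -- the pair is added, and the maximum stays, so its deficit drops to k.
    equivalent-suc : ∀ k S i → lookup S i ≡ false →
      Equivalent k r (gr (S [ i ]≔ true)) (src i) (tgt i) → Equivalent (suc k) r (gr S) (src i) (tgt i)
    equivalent-suc k S i e eqv c def =
      decidable-stable (lookup c (src i) Fin.≟ lookup c (tgt i)) λ ¬p → ¬p (eqv c (ℕ.≤-trans
      (ℕ.∸-mono (maxCut-insert S i e (eqv (best (S [ i ]≔ true)) (deficit-best (S [ i ]≔ true) k)))
        (ℕ.≤-reflexive (sym (size-insert-separated S i c e ¬p))))
      (ℕ.≤-trans (ℕ.≤-reflexive (sym (ℕ.pred[m∸n]≡m∸[1+n] (maxCut r (gr S)) (size (gr S) c))))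
          (ℕ.pred-mono-≤ def))))

    -- Equivalence is the partition into the classes of a labelling, which sends
    -- a vertex to the first vertex equivalent to it.
    module _ (k : ℕ) (S : Edges) where

      private
        _~_ : Fin n → Fin n → Set
        u ~ v = Equivalent k r (gr S) u v

        related : Fin n → List (Fin n)
        related v = filter (λ u → equivalent? k r (gr S) u v) (allFin n)

        headOr : Fin n → List (Fin n) → Fin n
        headOr v []      = v
        headOr v (u ∷ _) = u

      representative : Fin n → Fin n
      representative v = headOr v (related v)

      private
        representative~ : ∀ v → representative v ~ v
        representative~ v with related v | All.all-filter (λ u → equivalent? k r (gr S) u v) (allFin n)
        ... | []    | _     = λ _ _ → refl
        ... | _ ∷ _ | p ∷ _ = p

        headOr-irrelevant : ∀ {u v w xs} → w ∈ xs → headOr u xs ≡ headOr v xs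
        headOr-irrelevant (here _)  = refl
        headOr-irrelevant (there _) = refl

        ~⇒≡ : ∀ {u v} → u ~ v → representative u ≡ representative v
        ~⇒≡ {u} {v} u~v = trans
          (cong (headOr u) (filter-≐ (λ w → equivalent? k r (gr S) w u) (λ w → equivalent? k r (gr S) w v)
            ((λ w~u c d → trans (w~u c d) (u~v c d)) , (λ w~v c d → trans (w~v c d) (sym (u~v c d))))
                (allFin n)))
          (headOr-irrelevant (∈-filter⁺ (λ w → equivalent? k r (gr S) w v) (∈-allFin v) (λ _ _ → refl)))

        ≡⇒~ : ∀ {u v} → representative u ≡ representative v → u ~ v
        ≡⇒~ {u} {v} eq c d = trans (sym (representative~ u c d))
          (trans (cong (lookup c) eq) (representative~ v c d))

      -- The indicator of a pair of equivalent vertices.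
      eqv : Fin (Pairs n) → ℚ
      eqv i = [ does (equivalent? k r (gr S) (src i) (tgt i)) ]

      join-representative : ∀ i → join representative i ≡ eqv i
      join-representative i = []-cong (representative (src i) Fin.≟ representative (tgt i))
        (equivalent? k r (gr S) (src i) (tgt i)) ≡⇒~ ~⇒≡

      -- The numbers of equivalent pairs, and of edges and non-edges among them.
      eqPairs eqEdges eqNonEdges : ℚ
      eqPairs    = ∑ I eqv
      eqEdges    = ∑ I (λ i → [ lookup S i ] * eqv i)
      eqNonEdges = ∑ I (λ i → [ not (lookup S i) ] * eqv i)

      eqPairs-split : eqNonEdges ≡ eqPairs - eqEdges
      eqPairs-split = trans
        (∑-cong I (λ i → trans (cong (_* eqv i) ([not] (lookup S i)))
          (solve 2 (λ b e → (con 1ℚ :- b) :* e := e :- b :* e) refl [ lookup S i ] (eqv i))))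
        (∑-- I eqv (λ i → [ lookup S i ] * eqv i))

      cross-representative : cross representative ≡ ⌜ Pairs n ⌝ - eqPairs
      cross-representative = trans
        (∑-cong I (λ i → trans (sep-join representative i) (cong (λ z → 1ℚ - z) (join-representative i))))
        (trans (∑-- I (λ _ → 1ℚ) eqv) (cong (_- eqPairs) (∑-allFin-1 (Pairs n))))

      cutSize-representative : cutSize representative S ≡ ⌜ card S ⌝ - eqEdges
      cutSize-representative = trans
        (∑-cong I (λ i → trans (cong ([ lookup S i ] *_) (trans (sep-join representative i)
            (cong (λ z → 1ℚ - z) (join-representative i))))
          (solve 2 (λ b e → b :* (con 1ℚ :- e) := b :- b :* e) refl [ lookup S i ] (eqv i))))
        (trans (∑-- I (λ i → [ lookup S i ]) (λ i → [ lookup S i ] * eqv i)) (cong (_- eqEdges) (∑-card S)))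

      -- Equivalent vertices are in the same part of the maximum cut.
      eqPairs≤ : eqPairs ≤ ⌜ Pairs n ⌝ - cross (lookup (best S))
      eqPairs≤ = begin
        eqPairs
          ≤⟨ ∑-mono I (λ i → []-mono (equivalent? k r (gr S) (src i) (tgt i))
               (lookup (best S) (src i) Fin.≟ lookup (best S) (tgt i)) (λ e → e (best S) (deficit-best S k))) ⟩
        ∑ I (join (lookup (best S)))
          ≡⟨ ∑-cong I (λ i → trans (solve 1 (λ j → j := con 1ℚ :- (con 1ℚ :- j))
              refl (join (lookup (best S)) i))
               (cong (λ z → 1ℚ - z) (sym (sep-join (lookup (best S)) i)))) ⟩
        ∑ I (λ i → 1ℚ - sep (lookup (best S)) i)
          ≡⟨ trans (∑-- I (λ _ → 1ℚ) (sep (lookup (best S)))) (cong (_- cross (lookup (best S)))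
              (∑-allFin-1 (Pairs n))) ⟩
        ⌜ Pairs n ⌝ - cross (lookup (best S)) ∎

      equivalentPairs-eqPairs : ⌜ equivalentPairs k r (gr S) ⌝ ≡ eqPairs
      equivalentPairs-eqPairs = trans (length-filter (λ (u , v) → equivalent? k r (gr S) u v) (pairs n))
        (∑-lookup (pairs n) (λ (u , v) → [ does (equivalent? k r (gr S) u v) ]))

    -- The size of a maximum cut.
    bestSize : Edges → ℚ
    bestSize S = cutSize (lookup (best S)) S

    -- A uniformly random cut cuts every edge with probability (r - 1)/r, so a
    -- maximum cut has at least this fraction of the edges.
    bestSize-lower : ∀ S → (⌜ r ⌝ - 1ℚ) * ⌜ card S ⌝ ≤ ⌜ r ⌝ * bestSize S
    bestSize-lower S = *-cancelˡ (^-pos n (0<⌜suc⌝ r₀)) (begin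
      R * ((⌜ r ⌝ - 1ℚ) * ⌜ card S ⌝)
        ≡⟨ solve 3 (λ p q s → p :* (q :* s) := q :* p :* s) refl R (⌜ r ⌝ - 1ℚ) ⌜ card S ⌝ ⟩
      (⌜ r ⌝ - 1ℚ) * R * ⌜ card S ⌝
        ≡⟨ cong ((⌜ r ⌝ - 1ℚ) * R *_) (∑-card S) ⟨
      (⌜ r ⌝ - 1ℚ) * R * ∑ I (λ i → [ lookup S i ])
        ≡⟨ ∑-*ˡ I ((⌜ r ⌝ - 1ℚ) * R) (λ i → [ lookup S i ]) ⟨
      ∑ I (λ i → (⌜ r ⌝ - 1ℚ) * R * [ lookup S i ])
        ≡⟨ ∑-cong I (λ i → cong (_* [ lookup S i ]) (∑-separations r (src≢tgt {n} i))) ⟨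
      ∑ I (λ i → ⌜ r ⌝ * ∑ (cuts r n) (λ c → sep (lookup c) i) * [ lookup S i ])
        ≡⟨ ∑-cong I (λ i → trans (solve 3 (λ r s b → r :* s :* b := r :* (b :* s))
            refl ⌜ r ⌝ (∑ (cuts r n) (λ c → sep (lookup c) i)) [ lookup S i ])
             (cong (⌜ r ⌝ *_) (sym (∑-*ˡ (cuts r n) [ lookup S i ] (λ c → sep (lookup c) i))))) ⟩
      ∑ I (λ i → ⌜ r ⌝ * ∑ (cuts r n) (λ c → [ lookup S i ] * sep (lookup c) i))
        ≡⟨ ∑-*ˡ I ⌜ r ⌝ (λ i → ∑ (cuts r n) (λ c → [ lookup S i ] * sep (lookup c) i)) ⟩
      ⌜ r ⌝ * ∑ I (λ i → ∑ (cuts r n) (λ c → [ lookup S i ] * sep (lookup c) i))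
        ≡⟨ cong (⌜ r ⌝ *_) (∑-swap I (cuts r n) (λ i c → [ lookup S i ] * sep (lookup c) i)) ⟩
      ⌜ r ⌝ * ∑ (cuts r n) (λ c → cutSize (lookup c) S)
        ≤⟨ *-monoˡ (0≤⌜⌝ r) (∑-mono (cuts r n) (λ c → subst₂ _≤_ (size-cutSize S c) (size-cutSize S (best S))
             (⌜⌝-mono (size≤best S c)))) ⟩
      ⌜ r ⌝ * ∑ (cuts r n) (λ _ → bestSize S)
        ≡⟨ cong (⌜ r ⌝ *_) (trans (∑-const (cuts r n) (bestSize S)) (cong (_* bestSize S)
            (length-vectors r n))) ⟩
      ⌜ r ⌝ * (R * bestSize S)
        ≡⟨ solve 3 (λ r p b → r :* (p :* b) := p :* (r :* b)) refl ⌜ r ⌝ R (bestSize S) ⟩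
      R * (⌜ r ⌝ * bestSize S) ∎)
      where R = ⌜ r ⌝ ^ n

    outer-eqv : ∀ k S → outer-sum (eqv k) S ≤ eqNonEdges (suc k) S
    outer-eqv k S = ∑-mono I bound
      where
      bound : ∀ i → [ not (lookup S i) ] * eqv k (S [ i ]≔ true) i ≤ [ not (lookup S i) ] * eqv (suc k) S i
      bound i = [not]-mono (lookup S i) λ e → []-mono (equivalent? k r (gr (S [ i ]≔ true)) (src i) (tgt i))
        (equivalent? (suc k) r (gr S) (src i) (tgt i)) (equivalent-suc k S i e)

    -- The indicator of a pair inside a part of the chosen maximum cut.
    uncut : Edges → Fin (Pairs n) → ℚ
    uncut S = join (lookup (best S))

    outer-uncut : ∀ S → outer-sum uncut S ≤ eqNonEdges 0 S
    outer-uncut S = ∑-mono I bound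
      where
      bound : ∀ i → [ not (lookup S i) ] * uncut (S [ i ]≔ true) i ≤ [ not (lookup S i) ] * eqv 0 S i
      bound i = [not]-mono (lookup S i) λ e → []-mono
        (lookup (best (S [ i ]≔ true)) (src i) Fin.≟ lookup (best (S [ i ]≔ true)) (tgt i))
        (equivalent? 0 r (gr S) (src i) (tgt i)) (equivalent-0 S i e)

    inner-uncut : ∀ S → inner-sum uncut S ≡ ⌜ card S ⌝ - bestSize S
    inner-uncut S = trans
      (∑-cong I (λ i → trans (solve 2 (λ b j → b :* j := b :- b :* (con 1ℚ :- j))
          refl [ lookup S i ] (uncut S i))
        (cong (λ z → [ lookup S i ] - [ lookup S i ] * z) (sym (sep-join (lookup (best S)) i)))))
      (trans (∑-- I (λ i → [ lookup S i ]) (λ i → [ lookup S i ] * sep (lookup (best S)) i))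
        (cong (_- bestSize S) (∑-card S)))

  -- The average number of equivalent pairs

  3ℚ 6ℚ 7ℚ 13ℚ : ℚ
  3ℚ = 1ℚ + 2ℚ
  6ℚ = 2ℚ * 3ℚ
  7ℚ = 1ℚ + 6ℚ
  13ℚ = 6ℚ + 7ℚ

  -- Here ι and u are the average numbers of equivalent pairs and non-edges of a
  -- random graph with M edges, v is the average number of equivalent edges of a
  -- random graph with M + 1 edges (at deficit 0, of edges inside a part of a
  -- maximum cut), and N is the number of pairs.
  step-arithmetic : ∀ {N M t u v ι Y W} → 0ℚ ≤ M → 0ℚ < N - M → 0ℚ ≤ N →
    (N - M) * v ≤ (1ℚ + M) * u →
    N * u ≤ (N - M) * ι + 6ℚ * t * N * M →
    (1ℚ + M) * (Y - 6ℚ * t * N) ≤ N * v →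
    6ℚ * t * N * N ≤ (N - M) * W →
    Y - W ≤ ι
  step-arithmetic {N} {M} {t} {u} {v} {ι} {Y} {W} 0≤M 0<D 0≤N h₁ h₂ h₃ h₄ =
    *-cancelˡ 0<M′ (*-cancelˡ 0<D (by-difference
      (0≤+ (0≤+ (0≤+ (0≤* 0≤M′ (0≤- h₂)) (0≤* 0≤N (0≤- h₁))) (0≤* (<⇒≤ 0<D) (0≤- h₃))) (0≤* 0≤M′ (0≤- h₄)))
      (solve 8 (λ N M t u v ι Y W →
        (N :- M) :* ((con 1ℚ :+ M) :* ι) :- (N :- M) :* ((con 1ℚ :+ M) :* (Y :- W))
        := (con 1ℚ :+ M) :* ((N :- M) :* ι :+ con 6ℚ :* t :* N :* M :- N :* u)
        :+ N :* ((con 1ℚ :+ M) :* u :- (N :- M) :* v)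
        :+ (N :- M) :* (N :* v :- (con 1ℚ :+ M) :* (Y :- con 6ℚ :* t :* N))
        :+ (con 1ℚ :+ M) :* ((N :- M) :* W :- con 6ℚ :* t :* N :* N))
        refl N M t u v ι Y W)))
    where
    0<M′ : 0ℚ < 1ℚ + M
    0<M′ = +-mono-<-≤ (positive⁻¹ 1ℚ) 0≤M
    0≤M′ = <⇒≤ 0<M′

  module Rigidity (r₀ : ℕ) {n m₀ : ℕ} {t : ℚ} (0<t : 0ℚ < t) (t≤½ : t ≤ ½)
                  (1≤N : 1 ℕ.≤ Pairs n) (n≤t²m : ⌜ n ⌝ ≤ t * t * ⌜ m₀ ⌝) where

    open MaxCut r₀ n

    private
      r = suc r₀
      R = ⌜ r ⌝
      0<R : 0ℚ < R
      0<R = 0<⌜suc⌝ r₀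
      0≤R = <⇒≤ 0<R
      N = ⌜ Pairs n ⌝
      0<N : 0ℚ < N
      0<N = 0<⌜⌝ 1≤N
      0≤N = <⇒≤ 0<N
      0≤t = <⇒≤ 0<t

      𝔼-affine : ∀ m a b (f g : Subset (Pairs n) → ℚ) →
        𝔼 (Pairs n) m (λ S → a * f S + b * g S) ≡ a * 𝔼 (Pairs n) m f + b * 𝔼 (Pairs n) m g
      𝔼-affine m a b f g = trans (𝔼-+ (Pairs n) m (λ S → a * f S) (λ S → b * g S))
        (cong₂ _+_ (𝔼-* (Pairs n) m a f) (𝔼-* (Pairs n) m b g))

    -- The consequences of the deviation bound for graphs with m ≥ m₀ edges; the
    -- hypothesis n ≤ t² m₀ passes on to m.
    module Size {m : ℕ} (m₀≤m : m₀ ℕ.≤ m) (m≤N : m ℕ.≤ Pairs n) where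

      private
        M = ⌜ m ⌝
        0≤M = 0≤⌜⌝ m
        𝔼′ = 𝔼 (Pairs n) m

      open Deviation m≤N 1≤N 0<t t≤½ (≤-trans n≤t²m (*-monoˡ (0≤² t) (⌜⌝-mono m₀≤m))) public

      2N𝔼-excess : 2ℚ * N * 𝔼′ excess ≤ 6ℚ * t * N * M
      2N𝔼-excess = ≤-trans (*-monoˡ (0≤* (nonNegative⁻¹ 2ℚ) 0≤N) 𝔼-excess)
        (≤-reflexive (solve 3 (λ n t m → con 2ℚ :* n :* (con 3ℚ :* t :* m) := con 6ℚ :* t :* n :* m)
            refl N t M))

      excess-nonNeg : ∀ S → card S ≡ m → 0ℚ ≤ 2ℚ * (N * excess S)
      excess-nonNeg S eq = subst₂ _≤_ (trans (cong (N *_) cut0) (*-zeroʳ N))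
        (trans (cong (λ z → M * z + 2ℚ * (N * excess S)) cross0)
          (trans (cong (_+ 2ℚ * (N * excess S)) (*-zeroʳ M)) (+-identityˡ _)))
        (deviation S eq ρ)
        where
        ρ : Fin n → Fin 1
        ρ _ = zero
        cross0 : cross ρ ≡ 0ℚ
        cross0 = ∑-zero (allFin (Pairs n))
        cut0 : cutSize ρ S ≡ 0ℚ
        cut0 = trans (∑-cong (allFin (Pairs n)) (λ i → *-zeroʳ [ lookup S i ])) (∑-zero (allFin (Pairs n)))

      -- A random edge is nearly as likely to be equivalent as a random pair.
      𝔼-eqEdges : ∀ k → M * 𝔼′ (eqPairs k) ≤ N * 𝔼′ (eqEdges k) + 6ℚ * t * N * M
      𝔼-eqEdges k = begin
        M * 𝔼′ (eqPairs k)               ≡⟨ 𝔼-* (Pairs n) m M (eqPairs k) ⟨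
        𝔼′ (λ S → M * eqPairs k S)       ≤⟨ 𝔼-mono m≤N pointwise ⟩
        𝔼′ (λ S → N * eqEdges k S + 2ℚ * N * excess S)   ≡⟨ 𝔼-affine m N (2ℚ * N) (eqEdges k) excess ⟩
        N * 𝔼′ (eqEdges k) + 2ℚ * N * 𝔼′ excess         ≤⟨ +-monoʳ-≤ (N * 𝔼′ (eqEdges k)) 2N𝔼-excess ⟩
        N * 𝔼′ (eqEdges k) + 6ℚ * t * N * M ∎
        where
        pointwise : ∀ S → card S ≡ m → M * eqPairs k S ≤ N * eqEdges k S + 2ℚ * N * excess S
        pointwise S refl = by-difference
          (0≤- (subst₂ (λ a b → N * a ≤ M * b + 2ℚ * (N * excess S))
            (cutSize-representative k S) (cross-representative k S) (deviation S refl (representative k S))))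
          (solve 5 (λ N M i e z → N :* e :+ con 2ℚ :* N :* z :- M :* i
              := M :* (N :- i) :+ con 2ℚ :* (N :* z) :- N :* (M :- e))
                  refl N M (eqPairs k S) (eqEdges k S) (excess S))

      -- A random non-edge is at most slightly more likely to be equivalent.
      𝔼-eqNonEdges : ∀ k → N * 𝔼′ (eqNonEdges k) ≤ (N - M) * 𝔼′ (eqPairs k) + 6ℚ * t * N * M
      𝔼-eqNonEdges k = begin
        N * 𝔼′ (eqNonEdges k)
          ≤⟨ *-monoˡ 0≤N (𝔼-mono m≤N (λ S _ → ≤-reflexive (eqPairs-split k S))) ⟩
        N * 𝔼′ (λ S → eqPairs k S - eqEdges k S)
          ≡⟨ cong (N *_) (𝔼-- (Pairs n) m (eqPairs k) (eqEdges k)) ⟩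
        N * (𝔼′ (eqPairs k) - 𝔼′ (eqEdges k))
          ≤⟨ by-difference (0≤- (𝔼-eqEdges k))
            (solve 5 (λ N M i e z → (N :- M) :* i :+ z :- N :* (i :- e) := N :* e :+ z :- M :* i)
              refl N M (𝔼′ (eqPairs k)) (𝔼′ (eqEdges k)) (6ℚ * t * N * M)) ⟩
        (N - M) * 𝔼′ (eqPairs k) + 6ℚ * t * N * M ∎

      n≤2tN : ⌜ n ⌝ ≤ 2ℚ * (t * N)
      n≤2tN = begin
        ⌜ n ⌝               ≤⟨ n≤t²m ⟩
        t * t * ⌜ m₀ ⌝      ≤⟨ *-monoˡ (0≤² t) (⌜⌝-mono (ℕ.≤-trans m₀≤m m≤N)) ⟩
        t * t * N           ≤⟨ *-monoʳ 0≤N (*-monoˡ 0≤t (≤-trans t≤½ (*≤* (ℤ.+≤+ (ℕ.s≤s ℕ.z≤n))))) ⟩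
        t * 2ℚ * N          ≡⟨ solve 2 (λ t N → t :* con 2ℚ :* N := con 2ℚ :* (t :* N)) refl t N ⟩
        2ℚ * (t * N) ∎

      cross≤′ : (c : Cut r n) → R * cross (lookup c) ≤ (R - 1ℚ) * N + R * (t * N)
      cross≤′ c = *-cancelˡ (positive⁻¹ 2ℚ) (begin
        2ℚ * (R * x)            ≡⟨ solve 2 (λ r x → con 2ℚ :* (r :* x) := r :* (con 2ℚ :* x)) refl R x ⟩
        R * (2ℚ * x)            ≤⟨ cross-bound (lookup c) ⟩
        (R - 1ℚ) * (⌜ n ⌝ * ⌜ n ⌝)    ≡⟨ cong ((R - 1ℚ) *_) (twice-pairs n) ⟨
        (R - 1ℚ) * (2ℚ * N + ⌜ n ⌝)
          ≤⟨ by-difference (0≤+ (0≤* 0≤R (0≤- n≤2tN)) (0≤⌜⌝ n))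
               (solve 4 (λ r N n z → con 2ℚ :* ((r :- con 1ℚ) :* N :+ r :* z) :-
                   (r :- con 1ℚ) :* (con 2ℚ :* N :+ n)
                  := r :* (con 2ℚ :* z :- n) :+ n) refl R N ⌜ n ⌝ (t * N)) ⟩
        2ℚ * ((R - 1ℚ) * N + R * (t * N)) ∎)
        where x = cross (lookup c)

      -- A maximum cut averages at most about m (r - 1)/r edges.
      𝔼-bestSize : R * 𝔼′ bestSize ≤ M * (R - 1ℚ + 7ℚ * (R * t))
      𝔼-bestSize = *-cancelˡ 0<N (begin
        N * (R * 𝔼′ bestSize)            ≡⟨ trans (sym (*-assoc N R (𝔼′ bestSize)))
            (sym (𝔼-* (Pairs n) m (N * R) bestSize)) ⟩
        𝔼′ (λ S → N * R * bestSize S)    ≤⟨ 𝔼-mono m≤N pointwise ⟩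
        𝔼′ (λ S → c + R * (2ℚ * N) * excess S)
          ≡⟨ trans (𝔼-+ (Pairs n) m (λ _ → c) (λ S → R * (2ℚ * N) * excess S))
               (cong₂ _+_ (𝔼-const m≤N c) (𝔼-* (Pairs n) m (R * (2ℚ * N)) excess)) ⟩
        c + R * (2ℚ * N) * 𝔼′ excess
          ≡⟨ cong (c +_) (*-assoc R (2ℚ * N) (𝔼′ excess)) ⟩
        c + R * (2ℚ * N * 𝔼′ excess)     ≤⟨ +-monoʳ-≤ c (*-monoˡ 0≤R 2N𝔼-excess) ⟩
        c + R * (6ℚ * t * N * M)
          ≡⟨ solve 4 (λ r t N M → M :* ((r :- con 1ℚ) :* N :+ r :* (t :* N)) :+ r :* (con 6ℚ :* t :* N :* M)
               := N :* (M :* (r :- con 1ℚ :+ con 7ℚ :* (r :* t)))) refl R t N M ⟩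
        N * (M * (R - 1ℚ + 7ℚ * (R * t))) ∎)
        where
        c = M * ((R - 1ℚ) * N + R * (t * N))
        pointwise : ∀ S → card S ≡ m → N * R * bestSize S ≤ c + R * (2ℚ * N) * excess S
        pointwise S eq = by-difference
          (0≤+ (0≤* 0≤R (0≤- (deviation S eq (lookup (best S))))) (0≤* 0≤M (0≤- (cross≤′ (best S)))))
          (solve 7 (λ N M R b x q z → M :* q :+ R :* (con 2ℚ :* N) :* z :- N :* R :* b
            := R :* (M :* x :+ con 2ℚ :* (N :* z) :- N :* b) :+ M :* (q :- R :* x))
            refl N M R (bestSize S) (cross (lookup (best S))) ((R - 1ℚ) * N + R * (t * N)) (excess S))

      -- At most about N/r pairs are equivalent, for every graph of small excess.
      eqPairs-upper : ∀ k S → card S ≡ m → R * M * eqPairs k S ≤ N * M + R * (2ℚ * N) * excess S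
      eqPairs-upper k S refl = by-difference
        (0≤+ (0≤+ (0≤* (0≤* 0≤R 0≤M) (0≤- (eqPairs≤ k S))) (0≤* 0≤R (0≤- (deviation S refl (lookup (best S))))))
          (0≤* 0≤N (0≤- (bestSize-lower S))))
        (solve 7 (λ N M R e b x z → N :* M :+ R :* (con 2ℚ :* N) :* z :- R :* M :* e
          := R :* M :* (N :- x :- e) :+ R :* (M :* x :+ con 2ℚ :* (N :* z) :- N :* b)
               :+ N :* (R :* b :- (R :- con 1ℚ) :* M))
          refl N M R (eqPairs k S) (bestSize S) (cross (lookup (best S))) (excess S))

    module _ {g : ℚ} (0<g : 0ℚ < g) where

      private
        -- Y is about N/r, and W = 6 t N / g is the loss in every step.
        W Y : ℚ
        W = 6ℚ * t * N * recip g
        Y = recip R * N - t * N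

        module _ {m} (m₀≤m : m₀ ℕ.≤ m) (m<N : suc m ℕ.≤ Pairs n) (g≤ : g * N ≤ N - ⌜ m ⌝) where

          𝔼ₘ = 𝔼 (Pairs n) m
          𝔼₊ = 𝔼 (Pairs n) (suc m)
          M = ⌜ m ⌝
          module L = Size m₀≤m (ℕ.<⇒≤ m<N)
          module U = Size (ℕ.m≤n⇒m≤1+n m₀≤m) m<N

          0<D : 0ℚ < N - M
          0<D = <-≤-trans (positive⁻¹ (g * N) {{pos*pos⇒pos g {{positive 0<g}} N {{positive 0<N}}}}) g≤

          W-bound : 6ℚ * t * N * N ≤ (N - M) * W
          W-bound = begin
            6ℚ * t * N * N                    ≡⟨ *-identityʳ _ ⟨
            6ℚ * t * N * N * 1ℚ               ≡⟨ cong (6ℚ * t * N * N *_) (recip-inverse 0<g) ⟨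
            6ℚ * t * N * N * (g * recip g)
              ≡⟨ solve 4 (λ a N g h → a :* N :* (g :* h) := g :* N :* (a :* h))
                  refl (6ℚ * t * N) N g (recip g) ⟩
            g * N * W
              ≤⟨ *-monoʳ (0≤* (0≤* (0≤* (nonNegative⁻¹ 6ℚ) 0≤t) 0≤N) (recip-nonNeg 0<g)) g≤ ⟩
            (N - M) * W ∎

          -- From f on edges of a random graph with m + 1 edges to equivalent
          -- pairs of a random graph with m edges, by double counting.
          descend : ∀ k f y → (∀ S → outer-sum f S ≤ eqNonEdges k S) →
            ⌜ suc m ⌝ * (y - 6ℚ * t * N) ≤ N * 𝔼₊ (inner-sum f) → y - W ≤ 𝔼ₘ (eqPairs k)
          descend k f y h₁ h₂ = step-arithmetic {N} {M} {t} {𝔼ₘ (eqNonEdges k)} {𝔼₊ (inner-sum f)}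
            {𝔼ₘ (eqPairs k)} {y} {W} (0≤⌜⌝ m) 0<D 0≤N
            (≤-trans (≤-reflexive (sym (𝔼-outer≡𝔼-inner f m<N)))
              (≤-trans (*-monoˡ (0≤⌜⌝ (suc m)) (𝔼-mono (ℕ.<⇒≤ m<N) (λ S _ → h₁ S)))
                (≤-reflexive (cong (_* 𝔼ₘ (eqNonEdges k)) (⌜suc⌝ m)))))
            (L.𝔼-eqNonEdges k)
            (subst (λ z → z * (y - 6ℚ * t * N) ≤ N * 𝔼₊ (inner-sum f)) (⌜suc⌝ m) h₂)
            W-bound

          step-suc : ∀ k → 𝔼₊ (eqPairs k) - W ≤ 𝔼ₘ (eqPairs (suc k))
          step-suc k = descend (suc k) (eqv k) (𝔼₊ (eqPairs k)) (outer-eqv k)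
              (by-difference (0≤- (U.𝔼-eqEdges k))
            (solve 5 (λ N M i e t → N :* e :- M :* (i :- con 6ℚ :* t :* N)
                := N :* e :+ con 6ℚ :* t :* N :* M :- M :* i)
              refl N ⌜ suc m ⌝ (𝔼₊ (eqPairs k)) (𝔼₊ (eqEdges k)) t))

          step-zero : Y - W ≤ 𝔼ₘ (eqPairs 0)
          step-zero = descend 0 uncut Y outer-uncut (*-cancelˡ 0<R (begin
            R * (M₊ * (Y - 6ℚ * t * N))
              ≡⟨ solve 5 (λ R h N M t → R :* (M :* (h :* N :- t :* N :- con 6ℚ :* t :* N))
                   := M :* (R :* h :* N :- con 7ℚ :* (R :* t) :* N)) refl R (recip R) N M₊ t ⟩
            M₊ * (R * recip R * N - 7ℚ * (R * t) * N)
              ≡⟨ cong (λ z → M₊ * (z * N - 7ℚ * (R * t) * N)) (recip-inverse 0<R) ⟩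
            M₊ * (1ℚ * N - 7ℚ * (R * t) * N)
              ≤⟨ by-difference (0≤* 0≤N (0≤- U.𝔼-bestSize))
                   (solve 5 (λ R N M b z → N :* (R :* (M :- b)) :- M :* (con 1ℚ :* N :- z :* N)
                      := N :* (M :* (R :- con 1ℚ :+ z) :- R :* b)) refl R N M₊ (𝔼₊ bestSize) (7ℚ * (R * t))) ⟩
            N * (R * (M₊ - 𝔼₊ bestSize))
              ≡⟨ solve 3 (λ n r b → n :* (r :* b) := r :* (n :* b)) refl N R (M₊ - 𝔼₊ bestSize) ⟩
            R * (N * (M₊ - 𝔼₊ bestSize))
              ≡⟨ cong (λ z → R * (N * z)) (trans (𝔼-- (Pairs n) (suc m) (λ _ → M₊) bestSize)
                   (cong (_- 𝔼₊ bestSize) (𝔼-const m<N M₊))) ⟨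
            R * (N * 𝔼₊ (λ S → M₊ - bestSize S))
              ≤⟨ *-monoˡ 0≤R (*-monoˡ 0≤N (𝔼-mono m<N (λ S eq → ≤-reflexive
                   (trans (cong (λ z → ⌜ z ⌝ - bestSize S) (sym eq)) (sym (inner-uncut S)))))) ⟩
            R * (N * 𝔼₊ (inner-sum uncut)) ∎))
            where M₊ = ⌜ suc m ⌝

      -- Every step trades one unit of the deficit for one more edge, ending with
      -- deficit 0 and m + k edges.
      𝔼-eqPairs-lower : ∀ k {m} → m₀ ℕ.≤ m → suc (m ℕ.+ k) ℕ.≤ Pairs n → g * N ≤ N - ⌜ m ℕ.+ k ⌝ →
        Y - ⌜ suc k ⌝ * W ≤ 𝔼 (Pairs n) m (eqPairs k)
      𝔼-eqPairs-lower zero {m} m₀≤m m<N g≤ = ≤-trans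
        (≤-reflexive (cong (λ z → Y - z) (trans (cong (_* W) ⌜1⌝) (*-identityˡ W))))
        (step-zero m₀≤m (subst (λ z → suc z ℕ.≤ Pairs n) (ℕ.+-identityʳ m) m<N)
          (subst (λ z → g * N ≤ N - ⌜ z ⌝) (ℕ.+-identityʳ m) g≤))
      𝔼-eqPairs-lower (suc k) {m} m₀≤m m<N g≤ = begin
        Y - ⌜ suc (suc k) ⌝ * W
          ≡⟨ cong (λ z → Y - z * W) (⌜suc⌝ (suc k)) ⟩
        Y - (1ℚ + ⌜ suc k ⌝) * W
          ≡⟨ solve 3 (λ y k w → y :- (con 1ℚ :+ k) :* w := y :- k :* w :- w) refl Y ⌜ suc k ⌝ W ⟩
        Y - ⌜ suc k ⌝ * W - W
          ≤⟨ +-monoˡ-≤ (- W) (𝔼-eqPairs-lower k (ℕ.m≤n⇒m≤1+n m₀≤m)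
               (subst (λ z → suc z ℕ.≤ Pairs n) (ℕ.+-suc m k) m<N)
               (subst (λ z → g * N ≤ N - ⌜ z ⌝) (ℕ.+-suc m k) g≤)) ⟩
        𝔼 (Pairs n) (suc m) (eqPairs k) - W
          ≤⟨ step-suc m₀≤m (ℕ.≤-trans (ℕ.s≤s (ℕ.≤-trans (ℕ.m≤m+n m k) (ℕ.+-monoʳ-≤ m (ℕ.n≤1+n k)))) m<N)
               (≤-trans g≤ (+-monoʳ-≤ N (neg-antimono-≤ (⌜⌝-mono (ℕ.m≤m+n m (suc k)))))) k ⟩
        𝔼 (Pairs n) m (eqPairs (suc k)) ∎

      -- Markov's inequality: the number of equivalent pairs averages at least
      -- about N/r and exceeds N/r by little on average, hence is rarely below
      -- (1 - ε) N/r.  The indicator of the event is a.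
      bad-bound : ∀ d {ε} (a : Subset (Pairs n) → ℚ) → 1 ℕ.≤ m₀ → 0ℚ ≤ ε → g ≤ 1ℚ →
        suc (m₀ ℕ.+ d) ℕ.≤ Pairs n → g * N ≤ N - ⌜ m₀ ℕ.+ d ⌝ →
        (∀ S → R * eqPairs d S * a S ≤ (1ℚ - ε) * N * a S) → (∀ S → 0ℚ ≤ a S) → (∀ S → a S ≤ 1ℚ) →
        ε * g * 𝔼 (Pairs n) m₀ a ≤ 13ℚ * R * ⌜ suc d ⌝ * t
      bad-bound d {ε} a 1≤m₀ 0≤ε g≤1 m+d<N g≤ bad 0≤a a≤1 = *-cancelˡ 0<N (begin
        N * (ε * g * p)
          ≤⟨ by-difference (0≤+ (0≤* (<⇒≤ 0<g) (0≤- averaged)) (0≤* (0≤* (<⇒≤ 0<g) 0≤R)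
              (0≤- (𝔼-eqPairs-lower d ℕ.≤-refl m+d<N g≤))))
             (solve 9 (λ N ε g p t R h ι w →
                g :* (N :+ con 6ℚ :* R :* t :* N) :- g :* R :* (h :* N :- t :* N :- w) :- N :* (ε :* g :* p)
                := g :* (N :+ con 6ℚ :* R :* t :* N :- (R :* ι :+ ε :* N :* p)) :+ g :* R :* (ι :-
                    (h :* N :- t :* N :- w)))
                refl N ε g p t R (recip R) ι (⌜ suc d ⌝ * W)) ⟩
        g * (N + 6ℚ * R * t * N) - g * R * (Y - ⌜ suc d ⌝ * W)
          ≡⟨ solve 7 (λ N g t R h d j →
               g :* (N :+ con 6ℚ :* R :* t :* N) :- g :* R :* (h :* N :- t :* N :- d :* (con 6ℚ :* t :* N :* j))
               := N :* (g :* (con 1ℚ :- R :* h) :+ (con 7ℚ :* R :* g :+ con 6ℚ :* R :* d :* (g :* j)) :* t))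
               refl N g t R (recip R) ⌜ suc d ⌝ (recip g) ⟩
        N * (g * (1ℚ - R * recip R) + (7ℚ * R * g + 6ℚ * R * ⌜ suc d ⌝ * (g * recip g)) * t)
          ≡⟨ cong₂ (λ x y → N * (g * (1ℚ - x) + (7ℚ * R * g + 6ℚ * R * ⌜ suc d ⌝ * y) * t))
              (recip-inverse 0<R) (recip-inverse 0<g) ⟩
        N * (g * (1ℚ - 1ℚ) + (7ℚ * R * g + 6ℚ * R * ⌜ suc d ⌝ * 1ℚ) * t)
          ≤⟨ *-monoˡ 0≤N (by-difference (0≤* (0≤* (0≤* (nonNegative⁻¹ 7ℚ) 0≤R) (0≤- (≤-trans g≤1 1≤d+1))) 0≤t)
               (solve 4 (λ g R d t → con 13ℚ :* R :* d :* t :- (g :* (con 1ℚ :- con 1ℚ) :+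
                   (con 7ℚ :* R :* g :+ con 6ℚ :* R :* d :* con 1ℚ) :* t)
                 := con 7ℚ :* R :* (d :- g) :* t) refl g R ⌜ suc d ⌝ t)) ⟩
        N * (13ℚ * R * ⌜ suc d ⌝ * t) ∎)
        where
        m≤N : m₀ ℕ.≤ Pairs n
        m≤N = ℕ.≤-trans (ℕ.m≤m+n m₀ d) (ℕ.<⇒≤ m+d<N)
        open Size ℕ.≤-refl m≤N
        p = 𝔼 (Pairs n) m₀ a
        ι = 𝔼 (Pairs n) m₀ (eqPairs d)
        M₀ = ⌜ m₀ ⌝
        0<M₀ : 0ℚ < M₀
        0<M₀ = 0<⌜⌝ 1≤m₀
        1≤d+1 : 1ℚ ≤ ⌜ suc d ⌝
        1≤d+1 = ≤-trans (≤-reflexive (sym ⌜1⌝)) (⌜⌝-mono (ℕ.s≤s ℕ.z≤n))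
        pointwise : ∀ S → card S ≡ m₀ → R * M₀ * eqPairs d S + ε * N * M₀ * a S
            ≤ N * M₀ + R * (2ℚ * N) * excess S
        pointwise S eq = by-difference
          (0≤+ (0≤+ (0≤* (0≤- (a≤1 S)) (0≤- (eqPairs-upper d S eq)))
            (0≤* (<⇒≤ 0<M₀) (0≤- (bad S)))) (0≤* (0≤* 0≤R (0≤a S)) (excess-nonNeg S eq)))
          (solve 7 (λ N M₀ R e z a ε → N :* M₀ :+ R :* (con 2ℚ :* N) :* z :- (R :* M₀ :* e :+ ε :* N :* M₀ :* a)
            := (con 1ℚ :- a) :* (N :* M₀ :+ R :* (con 2ℚ :* N) :* z :- R :* M₀ :* e)
               :+ M₀ :* ((con 1ℚ :- ε) :* N :* a :- R :* e :* a) :+ R :* a :* (con 2ℚ :* (N :* z)))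
            refl N M₀ R (eqPairs d S) (excess S) (a S) ε)
        averaged : R * ι + ε * N * p ≤ N + 6ℚ * R * t * N
        averaged = *-cancelˡ 0<M₀ (begin
          M₀ * (R * ι + ε * N * p)
            ≡⟨ solve 6 (λ M₀ R i e N p → M₀ :* (R :* i :+ e :* N :* p)
                := R :* M₀ :* i :+ e :* N :* M₀ :* p) refl M₀ R ι ε N p ⟩
          R * M₀ * ι + ε * N * M₀ * p
            ≡⟨ 𝔼-affine m₀ (R * M₀) (ε * N * M₀) (eqPairs d) a ⟨
          𝔼 (Pairs n) m₀ (λ S → R * M₀ * eqPairs d S + ε * N * M₀ * a S)
            ≤⟨ 𝔼-mono m≤N pointwise ⟩
          𝔼 (Pairs n) m₀ (λ S → N * M₀ + R * (2ℚ * N) * excess S)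
            ≡⟨ trans (𝔼-+ (Pairs n) m₀ (λ _ → N * M₀) (λ S → R * (2ℚ * N) * excess S))
                 (cong₂ _+_ (𝔼-const m≤N (N * M₀)) (trans (𝔼-* (Pairs n) m₀ (R * (2ℚ * N)) excess)
                     (*-assoc R (2ℚ * N) (𝔼 (Pairs n) m₀ excess)))) ⟩
          N * M₀ + R * (2ℚ * N * 𝔼 (Pairs n) m₀ excess)
            ≤⟨ +-monoʳ-≤ (N * M₀) (*-monoˡ 0≤R 2N𝔼-excess) ⟩
          N * M₀ + R * (6ℚ * t * N * M₀)
            ≡⟨ solve 4 (λ N M₀ R t → N :* M₀ :+ R :* (con 6ℚ :* t :* N :* M₀)
                := M₀ :* (N :+ con 6ℚ :* R :* t :* N)) refl N M₀ R t ⟩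
          M₀ * (N + 6ℚ * R * t * N) ∎)

  -- The bound for rational parameters

  ratio-* : ∀ a {b} → 1 ℕ.≤ b → ⌜ b ⌝ * ratio a b ≡ ⌜ a ⌝
  ratio-* a {suc b} _ = trans (cong (_* ratio a (suc b)) (⌜⌝-def (suc b))) (trans (toℚᵘ-injective
    (ℚᵘ.≃-trans (toℚᵘ-homo-* (ℤ.+ suc b / 1) (ℤ.+ a / suc b))
    (ℚᵘ.≃-trans (ℚᵘ.*-cong (toℚᵘ-/ (suc b) 0) (toℚᵘ-/ a b))
    (ℚᵘ.≃-trans eq (ℚᵘ.≃-sym (toℚᵘ-/ a 0)))))) (sym (⌜⌝-def a)))
    where
    eq : ℚᵘ.mkℚᵘ (ℤ.+ suc b) 0 ℚᵘ.* ℚᵘ.mkℚᵘ (ℤ.+ a) b ℚᵘ.≃ ℚᵘ.mkℚᵘ (ℤ.+ a) 0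
    eq = ℚᵘ.*≡* (trans (ℤ.*-identityʳ _) (trans (ℤ.*-comm (ℤ.+ suc b) (ℤ.+ a))
      (cong (ℤ.+ a ℤ.*_) (cong (λ z → ℤ.+ suc z) (sym (ℕ.+-identityʳ b))))))

  ratio≡recip : ∀ a {b} → 1 ℕ.≤ b → ratio a b ≡ recip ⌜ b ⌝ * ⌜ a ⌝
  ratio≡recip a {b} 1≤b = begin-equality
    ratio a b                        ≡⟨ *-identityˡ (ratio a b) ⟨
    1ℚ * ratio a b                   ≡⟨ cong (_* ratio a b) (recip-inverse (0<⌜⌝ 1≤b)) ⟨
    ⌜ b ⌝ * recip ⌜ b ⌝ * ratio a b  ≡⟨ solve 3 (λ b r q → b :* r :* q := r :* (b :* q))
        refl ⌜ b ⌝ (recip ⌜ b ⌝) (ratio a b) ⟩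
    recip ⌜ b ⌝ * (⌜ b ⌝ * ratio a b) ≡⟨ cong (recip ⌜ b ⌝ *_) (ratio-* a 1≤b) ⟩
    recip ⌜ b ⌝ * ⌜ a ⌝ ∎

  ℙ≡𝔼 : ∀ {n m} {A : Pred (Graph n) 0ℓ} (A? : Decidable A) → m ℕ.≤ Pairs n →
    ℙ n m A? ≡ 𝔼 (Pairs n) m (λ S → [ does (A? (graph S)) ])
  ℙ≡𝔼 {n} {m} A? m≤N = trans (ratio≡recip _ (⌜⌝-cancel-≤ 1≤))
    (cong₂ (λ a b → recip a * b) total
      (trans (length-filter A? (graphs n m)) (∑-map (graph {n}) (level (Pairs n) m) (λ G → [ does (A? G) ]))))
    where
    total : ⌜ length (graphs n m) ⌝ ≡ ⌜ Pairs n C m ⌝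
    total = trans (cong ⌜_⌝ (length-map (graph {n}) (level (Pairs n) m))) (length-level (Pairs n) m)
    1≤C : 1 ℕ.≤ Pairs n C m
    1≤C with Pairs n C m | C-pos m≤N
    ... | zero  | p = contradiction p (<-irrefl (sym ⌜0⌝))
    ... | suc _ | _ = ℕ.s≤s ℕ.z≤n
    1≤ : ⌜ 1 ⌝ ≤ ⌜ length (graphs n m) ⌝
    1≤ = ≤-trans (⌜⌝-mono 1≤C) (≤-reflexive (sym total))

  []-guard : ∀ {P : Set} (P? : Dec P) {x y} → (P → x ≤ y) → x * [ does P? ] ≤ y * [ does P? ]
  []-guard (yes p)         h = *-monoʳ 0≤1 (h p)
  []-guard (no _)  {x} {y} h = ≤-reflexive (trans (*-zeroʳ x) (sym (*-zeroʳ y)))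

  1≤⌜⌝ : ∀ {n} → 1 ℕ.≤ n → 1ℚ ≤ ⌜ n ⌝
  1≤⌜⌝ h = ≤-trans (≤-reflexive (sym ⌜1⌝)) (⌜⌝-mono h)

  -- Here 2 g plays the part of δ, and t that of the square root of n/m.
  module _ {n m : ℕ} (r₀ d : ℕ) {ε g t : ℚ} {A : Pred (Graph n) 0ℓ} (A? : Decidable A)
    (1≤m : 1 ℕ.≤ m) (0<t : 0ℚ < t) (n≤t²m : ⌜ n ⌝ ≤ t * t * ⌜ m ⌝)
    (0<g : 0ℚ < g) (g≤1 : g ≤ 1ℚ) (m≤ : ⌜ m ⌝ ≤ (1ℚ - 2ℚ * g) * ⌜ n C 2 ⌝)
    (0≤ε : 0ℚ ≤ ε) (ε≤1 : ε ≤ 1ℚ)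
    (A⇒ : ∀ {G} → A G → ⌜ suc r₀ ⌝ * ⌜ equivalentPairs d (suc r₀) G ⌝ ≤ (1ℚ - ε) * ⌜ n C 2 ⌝) where

    private
      open MaxCut r₀ n
      R = ⌜ suc r₀ ⌝
      N = ⌜ Pairs n ⌝
      D = ⌜ suc d ⌝
      0≤g = <⇒≤ 0<g
      0≤t = <⇒≤ 0<t
      1≤R : 1ℚ ≤ R
      1≤R = 1≤⌜⌝ (ℕ.s≤s ℕ.z≤n)
      1≤D : 1ℚ ≤ D
      1≤D = 1≤⌜⌝ (ℕ.s≤s ℕ.z≤n)

      m≤′ : ⌜ m ⌝ ≤ (1ℚ - 2ℚ * g) * N
      m≤′ = subst (λ z → ⌜ m ⌝ ≤ (1ℚ - 2ℚ * g) * z) (sym (length-pairs-C n)) m≤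

      m≤N : m ℕ.≤ Pairs n
      m≤N = ⌜⌝-cancel-≤ (by-difference (0≤+ (0≤- m≤′) (0≤* (0≤* (nonNegative⁻¹ 2ℚ) 0≤g) (0≤⌜⌝ (Pairs n))))
        (solve 3 (λ N m g → N :- m := (con 1ℚ :- con 2ℚ :* g) :* N :- m :+ con 2ℚ :* g :* N) refl N ⌜ m ⌝ g))

      1≤N : 1 ℕ.≤ Pairs n
      1≤N = ℕ.≤-trans 1≤m m≤N

      a : Subset (Pairs n) → ℚ
      a S = [ does (A? (graph S)) ]

      p = 𝔼 (Pairs n) m a

      p≤1 : p ≤ 1ℚ
      p≤1 = ≤-trans (𝔼-mono m≤N (λ S _ → []≤1 (does (A? (graph S))))) (≤-reflexive (𝔼-const m≤N 1ℚ))

      εgp≤g : ε * g * p ≤ g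
      εgp≤g = by-difference (0≤+ (0≤* 0≤g (0≤- ε≤1)) (0≤* (0≤* 0≤ε 0≤g) (0≤- p≤1)))
        (solve 3 (λ e g p → g :- e :* g :* p := g :* (con 1ℚ :- e) :+ e :* g :* (con 1ℚ :- p)) refl ε g p)

      target : ℚ
      target = 13ℚ * R * D * t

      Dt≤target : D * t ≤ target
      Dt≤target = by-difference
        (0≤* (0≤* (0≤+ (nonNegative⁻¹ (6ℚ + 6ℚ)) (0≤* (nonNegative⁻¹ 13ℚ) (0≤- 1≤R))) (0≤⌜⌝ (suc d))) 0≤t)
        (solve 3 (λ R D t → con 13ℚ :* R :* D :* t :- D :* t
            := (con (6ℚ + 6ℚ) :+ con 13ℚ :* (R :- con 1ℚ)) :* D :* t)
          refl R D t)

      -- The left-hand side is at most g ≤ 1.  For large t the right-hand side is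
      -- at least 1, and for large d it is at least g.
      large-t : ½ ≤ t → ε * g * p ≤ target
      large-t ½≤t = ≤-trans εgp≤g (≤-trans g≤1 (by-difference
        (0≤+ (0≤+ (0≤* (0≤* (nonNegative⁻¹ 13ℚ) 0≤t) (0≤+ (0≤* (0≤- 1≤R) (0≤⌜⌝ (suc d))) (0≤- 1≤D)))
          (0≤* (nonNegative⁻¹ 13ℚ) (0≤- ½≤t))) (nonNegative⁻¹ (13ℚ * ½ - 1ℚ)))
        (solve 3 (λ R D t → con 13ℚ :* R :* D :* t :- con 1ℚ :=
          con 13ℚ :* t :* ((R :- con 1ℚ) :* D :+ (D :- con 1ℚ)) :+ con 13ℚ :* (t :- con ½) :+ con
              (13ℚ * ½ - 1ℚ))
          refl R D t)))

      1≤tN : t ≤ ½ → 1ℚ ≤ t * N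
      1≤tN t≤½ = begin
        1ℚ              ≤⟨ 1≤⌜⌝ (1≤n n 1≤N) ⟩
        ⌜ n ⌝           ≤⟨ n≤t²m ⟩
        t * t * ⌜ m ⌝   ≤⟨ *-monoˡ (0≤² t) (⌜⌝-mono m≤N) ⟩
        t * t * N       ≤⟨ *-monoʳ (0≤⌜⌝ (Pairs n)) (*-monoˡ 0≤t (≤-trans t≤½ (*≤* (ℤ.+≤+ (ℕ.s≤s ℕ.z≤n))))) ⟩
        t * 1ℚ * N      ≡⟨ cong (_* N) (*-identityʳ t) ⟩
        t * N ∎
        where
        1≤n : ∀ n → 1 ℕ.≤ Pairs n → 1 ℕ.≤ n
        1≤n (suc n) _ = ℕ.s≤s ℕ.z≤n

      large-d : t ≤ ½ → g * N ≤ ⌜ d ⌝ → ε * g * p ≤ target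
      large-d t≤½ gN≤d = begin
        ε * g * p     ≤⟨ εgp≤g ⟩
        g             ≡⟨ *-identityʳ g ⟨
        g * 1ℚ        ≤⟨ *-monoˡ 0≤g (1≤tN t≤½) ⟩
        g * (t * N)   ≡⟨ solve 3 (λ g t N → g :* (t :* N) := g :* N :* t) refl g t N ⟩
        g * N * t     ≤⟨ *-monoʳ 0≤t (≤-trans gN≤d (⌜⌝-mono (ℕ.n≤1+n d))) ⟩
        D * t         ≤⟨ Dt≤target ⟩
        target ∎

      small-d : t ≤ ½ → ⌜ d ⌝ ≤ g * N → ε * g * p ≤ target
      small-d t≤½ d≤gN = Rigidity.bad-bound r₀ 0<t t≤½ 1≤N n≤t²m 0<g d {ε} a 1≤m 0≤ε g≤1 m+d<N gap
        (λ S → []-guard (A? (graph S)) (λ AG → subst₂ (λ x y → R * x ≤ (1ℚ - ε) * y)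
          (equivalentPairs-eqPairs d S) (sym (length-pairs-C n)) (A⇒ AG)))
        (λ S → []-nonNeg (does (A? (graph S)))) (λ S → []≤1 (does (A? (graph S))))
        where
        gap : g * N ≤ N - ⌜ m ℕ.+ d ⌝
        gap = by-difference (0≤+ (0≤- m≤′) (0≤- d≤gN))
          (trans (cong (λ z → N - z - g * N) (⌜+⌝ m d))
            (solve 4 (λ N m d g → N :- (m :+ d) :- g :* N := (con 1ℚ :- con 2ℚ :* g) :* N :- m :+ (g :* N :- d))
              refl N ⌜ m ⌝ ⌜ d ⌝ g))
        m+d<N : m ℕ.+ d ℕ.< Pairs n
        m+d<N = ℕ.≰⇒> λ N≤ → <-irrefl refl (<-≤-trans
          (<-≤-trans (positive⁻¹ (g * N) {{pos*pos⇒pos g {{positive 0<g}} N {{positive (0<⌜⌝ 1≤N)}}}}) gap)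
          (≤-trans (+-monoʳ-≤ N (neg-antimono-≤ (⌜⌝-mono N≤))) (≤-reflexive (+-inverseʳ N))))

    rational-bound : ε * g * ℙ n m A? ≤ 13ℚ * ⌜ suc r₀ ⌝ * ⌜ suc d ⌝ * t
    rational-bound = subst (λ z → ε * g * z ≤ target) (sym (ℙ≡𝔼 A? m≤N)) (cases (≤-total t ½)
        (≤-total ⌜ d ⌝ (g * N)))
      where
      cases : t ≤ ½ ⊎ ½ ≤ t → ⌜ d ⌝ ≤ g * N ⊎ g * N ≤ ⌜ d ⌝ → ε * g * p ≤ target
      cases (inj₂ ½≤t) _           = large-t ½≤t
      cases (inj₁ t≤½) (inj₁ d≤gN) = small-d t≤½ d≤gN
      cases (inj₁ t≤½) (inj₂ gN≤d) = large-d t≤½ gN≤d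

  -- Passage to real parameters

  p≤∣p∣ : ∀ p → p ≤ ∣ p ∣
  p≤∣p∣ p with ≤-total 0ℚ p
  ... | inj₁ 0≤p = ≤-reflexive (sym (0≤p⇒∣p∣≡p 0≤p))
  ... | inj₂ p≤0 = ≤-trans p≤0 (0≤∣p∣ p)

  ≤-limit : ∀ {p q} → (∀ η → 0ℚ < η → p ≤ q + η) → p ≤ q
  ≤-limit {p} {q} h = ≮⇒≥ λ q<p →
    let 0<η = half-pos (subst (_< p - q) (+-inverseʳ q) (+-monoˡ-< (- q) q<p))
    in <-irrefl refl (<-≤-trans 0<η (by-difference {(p - q) * ½} {0ℚ} (0≤- (h _ 0<η))
         (solve 2 (λ p q → con 0ℚ :- (p :- q) :* con ½ := q :+ (p :- q) :* con ½ :- p) refl p q)))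

  -- From some index on, every term of a positive real is positive and at most
  -- twice every other.
  half-below : ∀ {x} → Cauchy x → (∃ λ c → 0ℚ < c × ∃ λ N → ∀ k → N ℕ.≤ k → 0ℚ + c ≤ x k) →
    ∃ λ K → ∀ k → K ℕ.≤ k → 0ℚ < x k × (∀ j → K ℕ.≤ j → x k * ½ ≤ x j)
  half-below {x} cx (c , 0<c , N , lower) = M ℕ.⊔ N , λ k K≤k →
    <-≤-trans 0<c (c≤ k K≤k) , λ j K≤j → by-difference
      (0≤+ (0≤- (≤-trans (p≤∣p∣ (x k - x j))
             (close k j (ℕ.≤-trans (ℕ.m≤m⊔n M N) K≤k) (ℕ.≤-trans (ℕ.m≤m⊔n M N) K≤j))))
           (0≤* (0≤- (c≤ k K≤k)) (nonNegative⁻¹ ½)))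
      (solve 3 (λ a b c → b :- a :* con ½ := c :* con ½ :- (a :- b) :+ (a :- c) :* con ½) refl (x k) (x j) c)
    where
    M = proj₁ (cx (c * ½) (half-pos 0<c))
    close = proj₂ (cx (c * ½) (half-pos 0<c))
    c≤ : ∀ k → M ℕ.⊔ N ℕ.≤ k → c ≤ x k
    c≤ k h = subst (_≤ x k) (+-identityˡ c) (lower k (ℕ.≤-trans (ℕ.m≤n⊔m M N) h))

  step≤1 : ∀ k → step k ≤ 1ℚ
  step≤1 k = toℚᵘ-cancel-≤ (ℚᵘ.≤-trans (ℚᵘ.≤-reflexive (toℚᵘ-/ 1 k)) (ℚᵘ.*≤* (ℤ.+≤+ (ℕ.s≤s ℕ.z≤n))))

  step-nonNeg : ∀ k → 0ℚ ≤ step k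
  step-nonNeg k = nonNegative⁻¹ _ {{normalize-nonNeg 1 (suc k)}}

  -- The error 1/(k + 1) of the approximate root is eventually at most the root.
  step≤root : ∀ {q} → 0ℚ < q → ∃ λ K → ∀ k → K ℕ.≤ k → step k ≤ root k q
  step≤root {q} 0<q = proj₁ small , λ k K≤k → ≮⇒≥ λ root<step → <-irrefl refl (begin-strict
    q                ≡⟨ 0≤p⇒∣p∣≡p (<⇒≤ 0<q) ⟨
    ∣ q ∣            <⟨ root-upper k q ⟩
    (root k q + step k) * (root k q + step k)
      ≤⟨ ²-mono (0≤+ (root-nonNeg k q) (step-nonNeg k)) (+-monoˡ-≤ (step k) (<⇒≤ root<step)) ⟩
    (step k + step k) * (step k + step k)
      ≤⟨ by-difference (0≤* (0≤* (nonNegative⁻¹ (2ℚ + 2ℚ)) (0≤- (step≤1 k))) (step-nonNeg k))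
           (solve 1 (λ s → con (2ℚ + 2ℚ) :* s :- (s :+ s) :* (s :+ s)
               := con (2ℚ + 2ℚ) :* (con 1ℚ :- s) :* s) refl (step k)) ⟩
    (2ℚ + 2ℚ) * step k   ≤⟨ *-monoˡ (nonNegative⁻¹ (2ℚ + 2ℚ)) (proj₂ small k K≤k) ⟩
    (2ℚ + 2ℚ) * (q * ½ * ½)
      ≡⟨ solve 1 (λ q → con (2ℚ + 2ℚ) :* (q :* con ½ :* con ½) := q) refl q ⟩
    q ∎)
    where small = step-small (half-pos (half-pos 0<q))

  208ℚ : ℚ
  208ℚ = ℤ.+ 208 / 1

  ratio-pos : ∀ {a b} → 1 ℕ.≤ a → 1 ℕ.≤ b → 0ℚ < ratio a b
  ratio-pos {suc a} {suc b} _ _ = positive⁻¹ (ratio (suc a) (suc b)) {{normalize-pos (suc a) (suc b)}}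

  module _ (n m d r₀ : ℕ) (1≤m : 1 ℕ.≤ m) where

    private
      r = suc r₀
      R = ⌜ r ⌝
      D = ⌜ suc d ⌝
      B = ⌜ n C 2 ⌝
      q = ratio n m

    -- The rational bound with ε/2 and δ/2 in place of ε and δ, and with
    -- t = root + step ≤ 2 root; the constant is 2 · 4 · 2 · 13 = 208.
    from-parameters : ∀ {ε δ} {A : Pred (Graph n) 0ℓ} (A? : Decidable A) k →
      0ℚ < δ → δ ≤ 1ℚ → 0ℚ < ε → ε ≤ 1ℚ → m ℕ.≤ n C 2 → step k ≤ root k q →
      ⌜ m ⌝ ≤ (1ℚ - δ * ½) * B → (∀ {G} → A G → R * ⌜ equivalentPairs d r G ⌝ ≤ (1ℚ - ε * ½) * B) →
      ℙ n m A? ≤ 208ℚ * R * recip ε * (D * recip δ * root k q)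
    from-parameters {ε} {δ} A? k 0<δ δ≤1 0<ε ε≤1 m≤B step≤ m≤ A⇒ =
      *-cancelˡ (half-pos 0<ε) (*-cancelˡ (half-pos (half-pos 0<δ)) (begin
        δ * ½ * ½ * (ε * ½ * ℙ n m A?)
          ≡⟨ solve 3 (λ d e p → d :* con ½ :* con ½ :* (e :* con ½ :* p)
              := e :* con ½ :* (d :* con ½ :* con ½) :* p)
               refl δ ε (ℙ n m A?) ⟩
        ε * ½ * (δ * ½ * ½) * ℙ n m A?
          ≤⟨ rational-bound r₀ d A? 1≤m 0<t n≤t²m (half-pos (half-pos 0<δ))
               (≤-trans (by-difference (0≤* (<⇒≤ 0<δ) (nonNegative⁻¹ (1ℚ - ½ * ½)))
                 (solve 1 (λ d → d :- d :* con ½ :* con ½ := d :* con (1ℚ - ½ * ½)) refl δ)) δ≤1)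
               (subst (λ z → ⌜ m ⌝ ≤ (1ℚ - z) * B) (solve 1 (λ d → d :* con ½
                   := con 2ℚ :* (d :* con ½ :* con ½)) refl δ) m≤)
               (<⇒≤ (half-pos 0<ε))
               (≤-trans (by-difference (0≤* (<⇒≤ 0<ε) (nonNegative⁻¹ ½))
                 (solve 1 (λ d → d :- d :* con ½ := d :* con ½) refl ε)) ε≤1) A⇒ ⟩
        13ℚ * R * D * t
          ≤⟨ *-monoˡ (0≤* (0≤* (nonNegative⁻¹ 13ℚ) (0≤⌜⌝ r)) (0≤⌜⌝ (suc d))) (+-monoʳ-≤ s step≤) ⟩
        13ℚ * R * D * (s + s)
          ≡⟨ solve 3 (λ R D s → con 13ℚ :* R :* D :* (s :+ s) :=
               con ½ :* con ½ :* con ½ :* (con 208ℚ :* R :* D :* s) :* con 1ℚ :* con 1ℚ) refl R D s ⟩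
        ½ * ½ * ½ * (208ℚ * R * D * s) * 1ℚ * 1ℚ
          ≡⟨ cong₂ (λ x y → ½ * ½ * ½ * (208ℚ * R * D * s) * x * y) (recip-inverse 0<ε) (recip-inverse 0<δ) ⟨
        ½ * ½ * ½ * (208ℚ * R * D * s) * (ε * recip ε) * (δ * recip δ)
          ≡⟨ solve 7 (λ R D s e e′ d d′ →
               con ½ :* con ½ :* con ½ :* (con 208ℚ :* R :* D :* s) :* (e :* e′) :* (d :* d′) :=
               d :* con ½ :* con ½ :* (e :* con ½ :* (con 208ℚ :* R :* e′ :* (D :* d′ :* s))))
               refl R D s ε (recip ε) δ (recip δ) ⟩
        δ * ½ * ½ * (ε * ½ * (208ℚ * R * recip ε * (D * recip δ * s))) ∎))
      where
      s = root k q
      t = s + step k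
      0<t : 0ℚ < t
      0<t = +-mono-≤-< (root-nonNeg k q) (positive⁻¹ (step k) {{normalize-pos 1 (suc k)}})
      n≤t²m : ⌜ n ⌝ ≤ t * t * ⌜ m ⌝
      n≤t²m = begin
        ⌜ n ⌝          ≡⟨ ratio-* n 1≤m ⟨
        ⌜ m ⌝ * q      ≡⟨ *-comm ⌜ m ⌝ q ⟩
        q * ⌜ m ⌝      ≤⟨ *-monoʳ (0≤⌜⌝ m) (≤-trans (p≤∣p∣ q) (<⇒≤ (root-upper k q))) ⟩
        t * t * ⌜ m ⌝ ∎

  non-rigid-bound : ∀ (δ ε : ℝ.ℝ) (0<δ : ℝ.0ℝ ℝ.< δ) (δ<1 : δ ℝ.< ℝ.1ℝ) (0<ε : ℝ.0ℝ ℝ.< ε) (ε<1 : ε ℝ.< ℝ.1ℝ)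
    (d m n r : ℕ) → 2 ℕ.≤ r → 1 ℕ.≤ m → ℝ.fromℕ m ℝ.≤ (ℝ.1ℝ ℝ.- δ) ℝ.* ℝ.fromℕ (n C 2) →
    ℝ.ProbAtMost n m (λ G → ¬ Rigid d r ε G)
      (ℝ.fromℕ 208 ℝ.* ℝ.fromℕ r ℝ./ ε [ 0<ε ] ℝ.*
        ((ℝ.fromℕ (d ℕ.+ 1) ℝ./ δ [ 0<δ ] ℝ.+ ℝ.fromℕ r) ℝ.* (ℝ.√ ℝ.fromℚ (ratio n m))
          ℝ.+ (ℝ.∜ ℝ.fromℚ (ratio n m))))
  non-rigid-bound (real x cx) (real y cy) 0<δ (c₁ , 0<c₁ , N₁ , δ<1) 0<ε (c₂ , 0<c₂ , N₂ , ε<1) d m n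
      (suc r₀) _ 1≤m m≤ {A} A? A⊆ η 0<η =
    K , λ k K≤k → final k
      (ℕ.≤-trans (ℕ.m≤m⊔n K₀ K₁) K≤k) (ℕ.≤-trans (ℕ.m≤n⊔m K₀ K₁) K≤k)
    where
    r = suc r₀
    R = ⌜ r ⌝
    B = ⌜ n C 2 ⌝
    q = ratio n m
    Kδ = proj₁ (half-below cx 0<δ)
    below-δ = proj₂ (half-below cx 0<δ)
    Kε = proj₁ (half-below cy 0<ε)
    below-ε = proj₂ (half-below cy 0<ε)

    x≤1 : ∀ k → N₁ ℕ.≤ k → x k ≤ 1ℚ
    x≤1 k h = by-difference (0≤+ (0≤- (δ<1 k h)) (<⇒≤ 0<c₁))
      (solve 2 (λ x c → con 1ℚ :- x := con 1ℚ :- (x :+ c) :+ c) refl (x k) c₁)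

    y≤1 : ∀ k → N₂ ℕ.≤ k → y k ≤ 1ℚ
    y≤1 k h = by-difference (0≤+ (0≤- (ε<1 k h)) (<⇒≤ 0<c₂))
      (solve 2 (λ x c → con 1ℚ :- x := con 1ℚ :- (x :+ c) :+ c) refl (y k) c₂)

    m≤half : ∀ k → Kδ ℕ.≤ k → ⌜ m ⌝ ≤ (1ℚ - x k * ½) * B
    m≤half k Kδ≤k = ≤-limit λ η 0<η →
      let N = proj₁ (m≤ η 0<η)
          j = Kδ ℕ.⊔ N
      in begin
        ⌜ m ⌝                          ≡⟨ ⌜⌝-def m ⟩
        ℤ.+ m / 1                      ≤⟨ proj₂ (m≤ η 0<η) j (ℕ.m≤n⊔m Kδ N) ⟩
        (1ℚ - x j) * (ℤ.+ (n C 2) / 1) + η  ≡⟨ cong (λ z → (1ℚ - x j) * z + η) (⌜⌝-def (n C 2)) ⟨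
        (1ℚ - x j) * B + η
          ≤⟨ +-monoˡ-≤ η (*-monoʳ (0≤⌜⌝ (n C 2)) (+-monoʳ-≤ 1ℚ
               (neg-antimono-≤ (proj₂ (below-δ k Kδ≤k) j (ℕ.m≤m⊔n Kδ N))))) ⟩
        (1ℚ - x k * ½) * B + η ∎

    m≤B : m ℕ.≤ n C 2
    m≤B = ⌜⌝-cancel-≤ (by-difference
      (0≤+ (0≤- (m≤half Kδ ℕ.≤-refl)) (0≤* (<⇒≤ (half-pos (proj₁ (below-δ Kδ ℕ.≤-refl)))) (0≤⌜⌝ (n C 2))))
      (solve 3 (λ m c h → c :- m := (con 1ℚ :- h) :* c :- m :+ h :* c) refl ⌜ m ⌝ B (x Kδ * ½)))

    -- A graph with more equivalent pairs is rigid, because the terms of ε are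
    -- eventually at least y k / 2.
    A⇒ : ∀ k → Kε ℕ.≤ k → ∀ {G} → A G → R * ⌜ equivalentPairs d r G ⌝ ≤ (1ℚ - y k * ½) * B
    A⇒ k Kε≤k {G} AG = ≮⇒≥ λ many → A⊆ AG λ η 0<η → Kε , λ j Kε≤j → begin
      (1ℚ - y j) * h * (ℤ.+ (n C 2) / 1)
        ≡⟨ cong ((1ℚ - y j) * h *_) (⌜⌝-def (n C 2)) ⟨
      (1ℚ - y j) * h * B
        ≤⟨ by-difference
            (0≤+ (0≤* (0≤* 0≤h (0≤- (proj₂ (below-ε k Kε≤k) j Kε≤j))) (0≤⌜⌝ (n C 2)))
                (0≤* 0≤h (0≤- (<⇒≤ many))))
            (solve 6 (λ h a b B R e → h :* (R :* e) :- (con 1ℚ :- b) :* h :* B :=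
               h :* (b :- a) :* B :+ h :* (R :* e :- (con 1ℚ :- a) :* B)) refl h (y k * ½) (y j) B R e) ⟩
      h * (R * e)      ≡⟨ solve 3 (λ h R e → h :* (R :* e) := R :* h :* e) refl h R e ⟩
      R * h * e        ≡⟨ cong (_* e) (trans (ratio-* 1 (ℕ.s≤s ℕ.z≤n)) ⌜1⌝) ⟩
      1ℚ * e           ≡⟨ *-identityˡ e ⟩
      e                ≡⟨ ⌜⌝-def (equivalentPairs d r G) ⟩
      ℤ.+ (equivalentPairs d r G) / 1   ≡⟨ +-identityʳ _ ⟨
      ℤ.+ (equivalentPairs d r G) / 1 + 0ℚ  ≤⟨ +-monoʳ-≤ (ℤ.+ (equivalentPairs d r G) / 1) (<⇒≤ 0<η) ⟩
      ℤ.+ (equivalentPairs d r G) / 1 + η ∎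
      where
      h = ratio 1 r
      e = ⌜ equivalentPairs d r G ⌝
      0≤h : 0ℚ ≤ h
      0≤h = nonNegative⁻¹ h {{normalize-nonNeg 1 r}}

    1≤n : ∀ n → 1 ℕ.≤ n C 2 → 1 ℕ.≤ n
    1≤n (suc n) _ = ℕ.s≤s ℕ.z≤n

    Kq = step≤root (ratio-pos (1≤n n (ℕ.≤-trans 1≤m m≤B)) 1≤m)

    K₀ = Kδ ℕ.⊔ Kε ℕ.⊔ proj₁ Kq
    K₁ = N₁ ℕ.⊔ N₂
    K = K₀ ℕ.⊔ K₁

    final : ∀ k → K₀ ℕ.≤ k → K₁ ℕ.≤ k → ℙ n m A? ≤
      208ℚ * (ℤ.+ r / 1) * recip (y k) *
        (((ℤ.+ (d ℕ.+ 1) / 1) * recip (x k) + (ℤ.+ r / 1)) * root k q + root k (root k q)) + η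
    final k h₀ h₁ = begin
      ℙ n m A?
        ≤⟨ from-parameters n m d r₀ 1≤m A? k (proj₁ (below-δ k kδ)) (x≤1 k (ℕ.≤-trans (ℕ.m≤m⊔n N₁ N₂) h₁)) 0<y
             (y≤1 k (ℕ.≤-trans (ℕ.m≤n⊔m N₁ N₂) h₁)) m≤B
             (proj₂ Kq k (ℕ.≤-trans (ℕ.m≤n⊔m (Kδ ℕ.⊔ Kε) (proj₁ Kq)) h₀)) (m≤half k kδ) (A⇒ k kε) ⟩
      208ℚ * R * recip (y k) * (D * recip (x k) * s)
        ≡⟨ cong₂ (λ a b → 208ℚ * a * recip (y k) * (b * recip (x k) * s)) (⌜⌝-def r)
             (trans (cong ⌜_⌝ (ℕ.+-comm 1 d)) (⌜⌝-def (d ℕ.+ 1))) ⟩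
      208ℚ * R′ * recip (y k) * (D′ * recip (x k) * s)
        ≤⟨ *-monoˡ (0≤* (0≤* (nonNegative⁻¹ 208ℚ) 0≤R′) (recip-nonNeg 0<y)) (by-difference
             (0≤+ (0≤* 0≤R′ (root-nonNeg k q)) (root-nonNeg k s))
             (solve 4 (λ a r s u → (a :+ r) :* s :+ u :- a :* s := r :* s :+ u)
                 refl (D′ * recip (x k)) R′ s (root k s))) ⟩
      208ℚ * R′ * recip (y k) * ((D′ * recip (x k) + R′) * s + root k s)
        ≡⟨ +-identityʳ _ ⟨
      208ℚ * R′ * recip (y k) * ((D′ * recip (x k) + R′) * s + root k s) + 0ℚ
        ≤⟨ +-monoʳ-≤ (208ℚ * R′ * recip (y k) * ((D′ * recip (x k) + R′) * s + root k s)) (<⇒≤ 0<η) ⟩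
      208ℚ * R′ * recip (y k) * ((D′ * recip (x k) + R′) * s + root k s) + η ∎
      where
      s = root k q
      D = ⌜ suc d ⌝
      D′ = ℤ.+ (d ℕ.+ 1) / 1
      R′ = ℤ.+ r / 1
      0≤R′ : 0ℚ ≤ R′
      0≤R′ = nonNegative⁻¹ R′ {{normalize-nonNeg r 1}}
      kδ = ℕ.≤-trans (ℕ.m≤m⊔n Kδ Kε) (ℕ.≤-trans (ℕ.m≤m⊔n (Kδ ℕ.⊔ Kε) (proj₁ Kq)) h₀)
      kε = ℕ.≤-trans (ℕ.m≤n⊔m Kδ Kε) (ℕ.≤-trans (ℕ.m≤m⊔n (Kδ ℕ.⊔ Kε) (proj₁ Kq)) h₀)
      0<y = proj₁ (below-ε k kε)

open import Defs

theorem2p1 : ∃ λ (K : ℝ) →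
    ∀ (δ ε : ℝ) (0<δ : 0ℝ < δ) (δ<1 : δ < 1ℝ) (0<ε : 0ℝ < ε) (ε<1 : ε < 1ℝ)
    (d m n r : ℕ) →
    2 ℕ.≤ r → 1 ℕ.≤ m → fromℕ m ≤ (1ℝ - δ) * fromℕ (n C 2) →
    ProbAtMost n m (λ G → ¬ Rigid d r ε G)
    (K * fromℕ r / ε [ 0<ε ] *
    ((fromℕ (d ℕ.+ 1) / δ [ 0<δ ] + fromℕ r) * (√ fromℚ (ratio n m))
    + (∜ fromℚ (ratio n m))))
theorem2p1 = fromℕ 208 , Rationals.non-rigid-bound
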